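{- Let $q$ be a power of $2$ and let $f(X)=X+aX^{q(q-1)+1}+bX^{2(q-1)+1}\in\mathbb{F}_{q^2}[X]$, where $a\in\mathbb{F}_{q^2}^*$ and $b\in\mathbb{F}_q^*$. Then $f$ is a permutation polynomial of $\mathbb{F}_{q^2}$ (i.e., the map $x\mapsto f(x)$ is a bijection of $\mathbb{F}_{q^2}$) if and only if one of the following holds: (i) $b=1$, $a\in\mathbb{F}_q^*$ and $\mathrm{Tr}_{q/2}(1+a^{ -1})=0$; or (ii) $b\ne 1$, $\mathrm{Tr}_{q/2}\bigl(b/(b+1)\bigr)=0$ and $a^2=b(b+1)$.
   Context: $\mathbb{F}_q$ denotes the finite field with $q$ elements, and $\mathrm{Tr}_{q/2}:\mathbb{F}_q\to\mathbb{F}_2$ is the absolute trace map $x\mapsto x+x^2+x^{2^2}+\cdots+x^{q/2}$. -}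

module Defs where

open import Level using (Level; _⊔_; suc)
open import Data.Nat using (ℕ; zero; suc)
import Data.Nat as ℕ
open import Data.Fin using (Fin)
open import Data.Product using (Σ; ∃)
open import Relation.Nullary using (¬_)
open import Relation.Binary.PropositionalEquality using (_≡_)
open import Algebra.Bundles using (CommutativeRing)
open import Function.Definitions using (Bijective)

-- A field: a commutative ring with 0 ≠ 1 and a multiplicative inverse
-- operation that inverts every nonzero element (the value of x ⁻¹ at 0 is
-- irrelevant).
record Field (c ℓ : Level) : Set (Level.suc (c ⊔ ℓ)) where
  field
    commutativeRing : CommutativeRing c ℓ
  open CommutativeRing commutativeRing public
  field
    _⁻¹     : Carrier → Carrier
    0≉1     : ¬ (0# ≈ 1#)
    inverseʳ : ∀ x → ¬ (x ≈ 0#) → (x * (x ⁻¹)) ≈ 1#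

module FieldOps {c ℓ} (F : Field c ℓ) where
  open Field F

  infixr 8 _^_
  _^_ : Carrier → ℕ → Carrier
  x ^ zero  = 1#
  x ^ suc n = x * (x ^ n)

  _/_ : Carrier → Carrier → Carrier
  x / y = x * (y ⁻¹)

  HasCardinality : ℕ → Set (c ⊔ ℓ)
  HasCardinality n = Σ (Fin n → Carrier) (λ e → Bijective _≡_ _≈_ e)

  -- absolute trace Tr_{q/2} for q = 2^k :  x + x^2 + x^(2^2) + ... + x^(2^(k-1))
  Tr : ℕ → Carrier → Carrier
  Tr zero    x = 0#
  Tr (suc i) x = Tr i x + x ^ (2 ℕ.^ i)

  InSubfield : ℕ → Carrier → Set ℓ
  InSubfield q x = x ^ q ≈ x

{-# OPTIONS --safe #-}
-- Write x̄ = x^q.  Then Φ(x) = f(x) x x̄ is a cubic form in x and x̄, and f is injective iff it has no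
-- nontrivial zero and f(x)/f(y) ∈ 𝔽_q forces x/y ∈ 𝔽_q.  The expression Φ(x)Φ̄(y) + Φ̄(x)Φ(y) is xȳ + x̄y
-- times a quadratic form C ȳ² + T yȳ + C̄ y² in y whose coefficients depend on x, so by Artin–Schreier
-- theory f is injective iff every x ≉ 0 satisfies
--   T ≉ 0 and Tr (C C̄ / T²) ≈ 0,   or   T ≈ 0 and x² C̄ ≈ x̄² C ≉ 0.
-- Under (i) and (ii) the quotient C C̄ / T² can be computed explicitly.  Conversely, if T has a nontrivial
-- zero then the second alternative yields a ∈ 𝔽_q and b = 1.  If not, the roots of T lie outside the
-- circle y ȳ = 1, and a projectivity of the circle moving them to 0 and ∞ turns C C̄ / T² into
-- e y² + ē ȳ² + g y + ḡ ȳ + κ.  Its trace, reduced to Tr (γ y + γ̄ ȳ) with γ = √e + g, is constant on the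
-- circle.  On the circle this is a polynomial in y of degree at most q, so γ = 0 by counting roots, and
-- the relation e = g² forces a ∈ 𝔽_q and b = 1 or a² = b (b + 1).
module Submission where

open import Defs
open import Level using (Level; _⊔_)
open import Data.Nat using (ℕ; zero; suc; _∸_; _≤_; z≤n; s≤s)
import Data.Nat as ℕ
open import Data.Product using (_×_; _,_; proj₁; proj₂; ∃; map₂)
open import Data.Sum using (_⊎_; inj₁; inj₂; [_,_]′)
import Data.Sum as Sum
open import Relation.Nullary using (¬_; Dec; yes; no; ¬?; contradiction; decidable-stable)
open import Function.Definitions using (Bijective; Congruent; Injective)
open import Function.Bundles using (_⇔_; mk⇔)
open import Function.Base using (_∘_; case_of_)
open import Algebra.Bundles using (CommutativeRing; RawRing)
import Algebra.Solver.Ring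
open import Algebra.Solver.Ring.AlmostCommutativeRing
  using (fromCommutativeRing; _-Raw-AlmostCommutative⟶_)
open import Data.Bool using (Bool; true; false; _xor_; _∧_; if_then_else_)
open import Data.Fin using (Fin; punchIn; punchOut)
import Data.Fin as Fin
open import Data.Fin.Patterns using (0F; 1F; 2F; 3F; 4F; 5F; 6F)
open import Data.Fin.Permutation using (Permutation′; permutation; _⟨$⟩ʳ_; remove; punchIn-permute)
open import Data.Fin.Properties
  using (any?; injective⇒≤; inject≤-injective; punchOut-injective; punchInᵢ≢i; punchIn-injective; suc-injective)
open import Data.Maybe using (Maybe; just; nothing)
import Data.Nat.Properties as ℕ
open import Data.Vec using (Vec; []; _∷_)
open import Data.Vec.Relation.Binary.Pointwise.Inductive as Pointwise using (Pointwise; []; _∷_)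
open import Relation.Binary.PropositionalEquality using (_≡_; _≢_)
import Relation.Binary.PropositionalEquality as ≡

-- For x ≉ 0 we have x^(q-1) = x̄/x, so f(x) = x + a x²/x̄ + b x̄²/x is homogeneous of degree one
-- over 𝔽_q; only directions matter. Dividing the quadratic form in y by T yȳ and putting w =
-- Cȳ/(Ty) turns its vanishing into w + w̄ = 1 and w² + w = C C̄/T². Solutions come in pairs w, w +
-- 1, hence as two directions of y, while the harmless direction y ∥ x is only one. So T ≉ 0 allows
-- no zero at all; if T ≈ 0 the form is a square with a single zero direction, which has to be that
-- of x. This explains the two alternatives. The converse extracts algebra from an 𝔽₂-valued trace.
-- Making T constant on the circle removes the denominator, and trading e y² for √e y keeps the
-- polynomial at degree q against q + 1 points on the circle; with y² left in place the degree would
-- be too large. The relation e = g² still contains the unknown phase a/ā, and excluding a nonreal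
-- phase takes one more Artin-Schreier argument.

module CharTwo {c ℓ} (R : CommutativeRing c ℓ)
  (1+1≈0 : CommutativeRing._≈_ R
             (CommutativeRing._+_ R (CommutativeRing.1# R) (CommutativeRing.1# R))
             (CommutativeRing.0# R)) where

  open CommutativeRing R
  open import Algebra.Properties.Ring ring using (-0#≈0#)
  open import Algebra.Properties.AbelianGroup +-abelianGroup using (inverseˡ-unique)

  private
    -- Coefficients in 𝔽₂ instead of ℤ let the solver cancel `x + x` by normalisation, so the
    -- identities below need neither signs nor explicit appeals to `1+1≈0`.
    𝔽₂ : RawRing _ _
    𝔽₂ = record
      { Carrier = Bool ; _≈_ = _≡_ ; _+_ = _xor_ ; _*_ = _∧_
      ; -_ = λ x → x ; 0# = false ; 1# = true }

    ⟦_⟧₂ : Bool → Carrier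
    ⟦ b ⟧₂ = if b then 1# else 0#

    𝔽₂⟶R : 𝔽₂ -Raw-AlmostCommutative⟶ fromCommutativeRing R
    𝔽₂⟶R = record
      { ⟦_⟧ = ⟦_⟧₂
      ; +-homo = λ where
          false y → sym (+-identityˡ _)
          true false → sym (+-identityʳ _)
          true true → sym 1+1≈0
      ; *-homo = λ where
          false y → sym (zeroˡ _)
          true y → sym (*-identityˡ _)
      ; -‿homo = λ where
          false → sym -0#≈0#
          true → inverseˡ-unique _ _ 1+1≈0
      ; 0-homo = refl
      ; 1-homo = refl }

    coeff≟ : (x y : Bool) → Maybe (⟦ x ⟧₂ ≈ ⟦ y ⟧₂)
    coeff≟ false false = just refl
    coeff≟ false true = nothing
    coeff≟ true false = nothing
    coeff≟ true true = just refl

  open Algebra.Solver.Ring 𝔽₂ (fromCommutativeRing R) 𝔽₂⟶R coeff≟ public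
    using (Polynomial; op; con; var; _:^_; :-_; [+]; [*]; ⟦_⟧; solve; _:=_; _:+_; _:*_)

  :0 :1 : ∀ {n} → Polynomial n
  :0 = con false
  :1 = con true

  x+x≈0 : ∀ x → x + x ≈ 0#
  x+x≈0 = solve 1 (λ x → x :+ x := :0) refl

  ≈⇒+≈0 : ∀ {x y} → x ≈ y → x + y ≈ 0#
  ≈⇒+≈0 x≈y = trans (+-congʳ x≈y) (x+x≈0 _)

  -- Over characteristic 2 these reduce l ≈ r to a ring identity exhibiting l + r in the ideal generated
  -- by the sums x + y of the two sides of the hypotheses.
  linear₁ : ∀ {l r e x y} → x ≈ y → l ≈ r + e * (x + y) → l ≈ r
  linear₁ x≈y l≈ =
    trans l≈ (trans (+-congˡ (trans (*-congˡ (≈⇒+≈0 x≈y)) (zeroʳ _))) (+-identityʳ _))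

  +≈0⇒≈ : ∀ {x y} → x + y ≈ 0# → x ≈ y
  +≈0⇒≈ {x} {y} x+y≈0 = linear₁ x+y≈0
    (solve 2 (λ x y → x := y :+ :1 :* (x :+ y :+ :0)) refl x y)

  linear₂ : ∀ {l r e₁ x₁ y₁ e₂ x₂ y₂} → x₁ ≈ y₁ → x₂ ≈ y₂ →
            l ≈ r + e₁ * (x₁ + y₁) + e₂ * (x₂ + y₂) → l ≈ r
  linear₂ h₁ h₂ l≈ = linear₁ h₁ (linear₁ h₂ l≈)

  linear₃ : ∀ {l r e₁ x₁ y₁ e₂ x₂ y₂ e₃ x₃ y₃} → x₁ ≈ y₁ → x₂ ≈ y₂ → x₃ ≈ y₃ →
            l ≈ r + e₁ * (x₁ + y₁) + e₂ * (x₂ + y₂) + e₃ * (x₃ + y₃) → l ≈ r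
  linear₃ h₁ h₂ h₃ l≈ = linear₂ h₁ h₂ (linear₁ h₃ l≈)

-- Powers, polynomial functions and root counting in a field

module FieldProperties {c ℓ} (F : Field c ℓ) where
  open Field F
  open FieldOps F
  open import Relation.Binary.Reasoning.Setoid setoid

  *-cancelˡ-nonZero : ∀ {x y z} → ¬ x ≈ 0# → x * y ≈ x * z → y ≈ z
  *-cancelˡ-nonZero {x} {y} {z} x≉0 xy≈xz = trans (sym (lemma y)) (trans (*-congˡ xy≈xz) (lemma z))
    where
    lemma : ∀ w → x ⁻¹ * (x * w) ≈ w
    lemma w = trans (sym (*-assoc _ _ _))
      (trans (*-congʳ (trans (*-comm _ _) (inverseʳ x x≉0))) (*-identityˡ w))

  xy≈0⇒y≈0 : ∀ {x y} → ¬ x ≈ 0# → x * y ≈ 0# → y ≈ 0#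
  xy≈0⇒y≈0 x≉0 xy≈0 = *-cancelˡ-nonZero x≉0 (trans xy≈0 (sym (zeroʳ _)))

  *-nonZero : ∀ {x y} → ¬ x ≈ 0# → ¬ y ≈ 0# → ¬ x * y ≈ 0#
  *-nonZero x≉0 y≉0 xy≈0 = y≉0 (xy≈0⇒y≈0 x≉0 xy≈0)

  open import Algebra.Properties.CommutativeSemiring.Exp commutativeSemiring as Exp
    using () renaming (_^_ to _^ₛ_)

  private
    ^≡^ₛ : ∀ x n → x ^ n ≡ x ^ₛ n
    ^≡^ₛ x zero = ≡.refl
    ^≡^ₛ x (suc n) = ≡.cong (x *_) (^≡^ₛ x n)

  ^-congˡ : ∀ n {x y} → x ≈ y → x ^ n ≈ y ^ n
  ^-congˡ n {x} {y} x≈y rewrite ^≡^ₛ x n | ^≡^ₛ y n = Exp.^-congˡ n x≈y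

  ^-homo-* : ∀ x m n → x ^ (m ℕ.+ n) ≈ x ^ m * x ^ n
  ^-homo-* x m n rewrite ^≡^ₛ x (m ℕ.+ n) | ^≡^ₛ x m | ^≡^ₛ x n = Exp.^-homo-* x m n

  ^-assocʳ : ∀ x m n → (x ^ m) ^ n ≈ x ^ (m ℕ.* n)
  ^-assocʳ x m n rewrite ^≡^ₛ x m | ^≡^ₛ (x ^ₛ m) n | ^≡^ₛ x (m ℕ.* n) = Exp.^-assocʳ x m n

  ^-distrib-* : ∀ x y n → (x * y) ^ n ≈ x ^ n * y ^ n
  ^-distrib-* x y n rewrite ^≡^ₛ (x * y) n | ^≡^ₛ x n | ^≡^ₛ y n = Exp.^-distrib-* x y n

  0^n≈0 : ∀ {n} → 1 ≤ n → 0# ^ n ≈ 0#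
  0^n≈0 (s≤s _) = zeroˡ _

  1^n≈1 : ∀ n → 1# ^ n ≈ 1#
  1^n≈1 zero = refl
  1^n≈1 (suc n) = trans (*-identityˡ _) (1^n≈1 n)

  ^-nonZero : ∀ {x} n → ¬ x ≈ 0# → ¬ x ^ n ≈ 0#
  ^-nonZero zero x≉0 1≈0 = 0≉1 (sym 1≈0)
  ^-nonZero (suc n) x≉0 = *-nonZero x≉0 (^-nonZero n x≉0)

  -- Horner form of a polynomial function. Only values are recorded, so traces and powers of
  -- functions can be bounded in degree without any polynomial arithmetic.
  Degree≤ : ℕ → (Carrier → Carrier) → Set (c ⊔ ℓ)
  Degree≤ zero f = ∃ λ c → ∀ x → f x ≈ c
  Degree≤ (suc d) f = ∃ λ c → ∃ λ g → Degree≤ d g × (∀ x → f x ≈ c + x * g x)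

  Degree≤-cong : ∀ d {f g} → (∀ x → f x ≈ g x) → Degree≤ d f → Degree≤ d g
  Degree≤-cong zero f≈g (c , f≈) = c , λ x → trans (sym (f≈g x)) (f≈ x)
  Degree≤-cong (suc d) f≈g (c , h , dh , f≈) =
    c , h , dh , λ x → trans (sym (f≈g x)) (f≈ x)

  degree-const : ∀ d c → Degree≤ d (λ _ → c)
  degree-const zero c = c , λ _ → refl
  degree-const (suc d) c = c , (λ _ → 0#) , degree-const d 0# ,
    λ x → sym (trans (+-congˡ (zeroʳ x)) (+-identityʳ c))

  degree-≤ : ∀ {d e f} → d ≤ e → Degree≤ d f → Degree≤ e f
  degree-≤ {e = e} z≤n (c , f≈) = Degree≤-cong e (sym ∘ f≈) (degree-const e c)
  degree-≤ (s≤s d≤e) (c , g , dg , f≈) = c , g , degree-≤ d≤e dg , f≈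

  degree-+ : ∀ d {f g} → Degree≤ d f → Degree≤ d g → Degree≤ d (λ x → f x + g x)
  degree-+ zero (c , f≈) (c′ , g≈) = c + c′ , λ x → +-cong (f≈ x) (g≈ x)
  degree-+ (suc d) {f} {g} (c , f₁ , df , f≈) (c′ , g₁ , dg , g≈) =
    c + c′ , _ , degree-+ d df dg , λ x → begin
      f x + g x                           ≈⟨ +-cong (f≈ x) (g≈ x) ⟩
      (c + x * f₁ x) + (c′ + x * g₁ x)    ≈⟨ +-interchange _ _ _ _ ⟩
      (c + c′) + (x * f₁ x + x * g₁ x)    ≈⟨ +-congˡ (distribˡ x _ _) ⟨
      (c + c′) + x * (f₁ x + g₁ x)        ∎
    where
    open import Algebra.Properties.CommutativeSemigroup +-commutativeSemigroup
      renaming (interchange to +-interchange)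

  degree-*ˡ : ∀ d a {f} → Degree≤ d f → Degree≤ d (λ x → a * f x)
  degree-*ˡ zero a (c , f≈) = a * c , λ x → *-congˡ (f≈ x)
  degree-*ˡ (suc d) a {f} (c , g , dg , f≈) =
    a * c , _ , degree-*ˡ d a dg , λ x → begin
      a * f x                  ≈⟨ *-congˡ (f≈ x) ⟩
      a * (c + x * g x)        ≈⟨ distribˡ a _ _ ⟩
      a * c + a * (x * g x)    ≈⟨ +-congˡ (x∙yz≈y∙xz a x (g x)) ⟩
      a * c + x * (a * g x)    ∎
    where open import Algebra.Properties.CommutativeSemigroup *-commutativeSemigroup

  degree-* : ∀ d {e f g} → Degree≤ d f → Degree≤ e g → Degree≤ (d ℕ.+ e) (λ x → f x * g x)
  degree-* zero {e} (c , f≈) dg = Degree≤-cong e (λ x → *-congʳ (sym (f≈ x))) (degree-*ˡ e c dg)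
  degree-* (suc d) {e} {f} {g} (c , f₁ , df , f≈) dg =
    Degree≤-cong (suc d ℕ.+ e) (λ x → begin
      c * g x + (0# + x * (f₁ x * g x)) ≈⟨ +-congˡ (+-identityˡ _) ⟩
      c * g x + x * (f₁ x * g x)        ≈⟨ +-congˡ (*-assoc _ _ _) ⟨
      c * g x + x * f₁ x * g x          ≈⟨ distribʳ _ _ _ ⟨
      (c + x * f₁ x) * g x              ≈⟨ *-congʳ (f≈ x) ⟨
      f x * g x                         ∎)
    (degree-+ (suc d ℕ.+ e) (degree-≤ (ℕ.m≤n+m e (suc d)) (degree-*ˡ e c dg))
      (0# , _ , degree-* d df dg , λ x → refl))

  degree-^ : ∀ n → Degree≤ n (_^ n)
  degree-^ zero = 1# , λ _ → refl
  degree-^ (suc n) = 0# , _ , degree-^ n , λ x → sym (+-identityˡ _)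

  -- Synthetic division by x - r with quotient g; moving the products to opposite sides avoids
  -- subtraction, and the induction merely rearranges sums.
  factor : ∀ d {f} r → Degree≤ (suc d) f →
           ∃ λ g → Degree≤ d g × (∀ x → f x + r * g x ≈ f r + x * g x)
  factor zero {f} r (c , g , (c′ , g≈) , f≈) = (λ _ → c′) , (c′ , λ _ → refl) , λ x → begin
    f x + r * c′          ≈⟨ +-congʳ (trans (f≈ x) (+-congˡ (*-congˡ (g≈ x)))) ⟩
    (c + x * c′) + r * c′ ≈⟨ xy∙z≈xz∙y _ _ _ ⟩
    (c + r * c′) + x * c′ ≈⟨ +-congʳ (trans (f≈ r) (+-congˡ (*-congˡ (g≈ r)))) ⟨
    f r + x * c′          ∎
    where open import Algebra.Properties.CommutativeSemigroup +-commutativeSemigroup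
  factor (suc d) {f} r (c , g , dg , f≈) with g₁ , dg₁ , g₁≈ ← factor d r dg =
    (λ x → g r + x * g₁ x) , (g r , g₁ , dg₁ , λ _ → refl) , λ x → begin
      f x + r * (g r + x * g₁ x)              ≈⟨ +-congʳ (f≈ x) ⟩
      (c + x * g x) + r * (g r + x * g₁ x)    ≈⟨ +-congˡ (distribˡ _ _ _) ⟩
      (c + x * g x) + (r * g r + r * (x * g₁ x)) ≈⟨ +-congˡ (+-congˡ (x∙yz≈y∙xz _ _ _)) ⟩
      (c + x * g x) + (r * g r + x * (r * g₁ x)) ≈⟨ +-xyz _ _ _ _ ⟩
      (c + r * g r) + (x * g x + x * (r * g₁ x))
        ≈⟨ +-cong (sym (f≈ r)) (trans (sym (distribˡ _ _ _)) (*-congˡ (g₁≈ x))) ⟩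
      f r + x * (g r + x * g₁ x)              ∎
    where
    open import Algebra.Properties.CommutativeSemigroup *-commutativeSemigroup using (x∙yz≈y∙xz)
    open import Algebra.Properties.CommutativeSemigroup +-commutativeSemigroup
      using () renaming (interchange to +-xyz)

  -- Dividing by one root leaves a quotient that vanishes at the remaining ones, hence everywhere by
  -- induction. Since the conclusion covers every x, it can be evaluated at 0 after counting nonzero
  -- roots, which kills the constant term.
  roots⇒vanishes : ∀ d {f} → Degree≤ d f → (p : Fin (suc d) → Carrier) → Injective _≡_ _≈_ p →
                   (∀ i → f (p i) ≈ 0#) → ∀ x → f x ≈ 0#
  roots⇒vanishes zero (c , f≈) p p-inj fp≈0 x =
    trans (f≈ x) (trans (sym (f≈ _)) (fp≈0 Fin.zero))
  roots⇒vanishes (suc d) {f} df p p-inj fp≈0 x with g , dg , f≈ ← factor d (p Fin.zero) df =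
    cancel (g≈0 x)
    where
    r = p Fin.zero

    g≈0 : ∀ x → g x ≈ 0#
    g≈0 = roots⇒vanishes d dg (p ∘ Fin.suc) (λ eq → suc-injective (p-inj eq)) λ i →
      let pᵢ = p (Fin.suc i)
          eq : r * g pᵢ ≈ pᵢ * g pᵢ
          eq = begin
            r * g pᵢ         ≈⟨ +-identityˡ _ ⟨
            0# + r * g pᵢ    ≈⟨ +-congʳ (fp≈0 _) ⟨
            f pᵢ + r * g pᵢ  ≈⟨ f≈ pᵢ ⟩
            f r + pᵢ * g pᵢ  ≈⟨ +-congʳ (fp≈0 _) ⟩
            0# + pᵢ * g pᵢ   ≈⟨ +-identityˡ _ ⟩
            pᵢ * g pᵢ        ∎
          r-pᵢ≉0 : ¬ r - pᵢ ≈ 0#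
          r-pᵢ≉0 eq = contradiction (p-inj (x∙y⁻¹≈ε⇒x≈y _ _ eq)) λ ()
      in xy≈0⇒y≈0 r-pᵢ≉0 (trans ([y-z]x≈yx-zx _ _ _) (x≈y⇒x∙y⁻¹≈ε eq))
      where
      open import Algebra.Properties.Group +-group using (x∙y⁻¹≈ε⇒x≈y; x≈y⇒x∙y⁻¹≈ε)
      open import Algebra.Properties.Ring ring using ([y-z]x≈yx-zx)

    cancel : g x ≈ 0# → f x ≈ 0#
    cancel gx≈0 = begin
      f x              ≈⟨ +-identityʳ _ ⟨
      f x + 0#         ≈⟨ +-congˡ (trans (*-congˡ gx≈0) (zeroʳ r)) ⟨
      f x + r * g x    ≈⟨ f≈ x ⟩
      f r + x * g x    ≈⟨ +-cong (fp≈0 _) (trans (*-congˡ gx≈0) (zeroʳ x)) ⟩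
      0# + 0#          ≈⟨ +-identityʳ _ ⟩
      0#               ∎

-- Finite fields: enumeration, decidable equality, Fermat's little theorem

injective⇒surjective : ∀ {n} {f : Fin n → Fin n} → Injective _≡_ _≡_ f → ∀ y → ∃ λ x → f x ≡ y
injective⇒surjective {suc n} {f} f-inj y with any? (λ x → f x Fin.≟ y)
... | yes p = p
... | no f≢y = contradiction (injective⇒≤ g-inj) ℕ.1+n≰n
  where
  y≢f : ∀ x → y ≢ f x
  y≢f x y≡fx = f≢y (x , ≡.sym y≡fx)

  g-inj : Injective _≡_ _≡_ (λ x → punchOut (y≢f x))
  g-inj eq = f-inj (punchOut-injective (y≢f _) (y≢f _) eq)

module FiniteField {c ℓ} (F : Field c ℓ) {n : ℕ} (card : FieldOps.HasCardinality F n) where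
  open Field F
  open FieldOps F
  open FieldProperties F
  open import Relation.Binary.Reasoning.Setoid setoid

  enum : Fin n → Carrier
  enum = proj₁ card

  enum-injective : Injective _≡_ _≈_ enum
  enum-injective = proj₁ (proj₂ card)

  index : Carrier → Fin n
  index x = proj₁ (proj₂ (proj₂ card) x)

  enum-index : ∀ x → enum (index x) ≈ x
  enum-index x = proj₂ (proj₂ (proj₂ card) x) ≡.refl

  index-injective : ∀ {x y} → index x ≡ index y → x ≈ y
  index-injective {x} {y} eq =
    trans (sym (enum-index x)) (trans (reflexive (≡.cong enum eq)) (enum-index y))

  index-cong : ∀ {x y} → x ≈ y → index x ≡ index y
  index-cong x≈y = enum-injective (trans (enum-index _) (trans x≈y (sym (enum-index _))))

  infix 4 _≟_
  _≟_ : (x y : Carrier) → Dec (x ≈ y)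
  x ≟ y with index x Fin.≟ index y
  ... | yes eq = yes (index-injective eq)
  ... | no neq = no (neq ∘ index-cong)

  injective⇒bijective : ∀ {f} → Congruent _≈_ _≈_ f → Injective _≈_ _≈_ f → Bijective _≈_ _≈_ f
  injective⇒bijective {f} f-cong f-inj = f-inj , λ y →
    let i , eq = injective⇒surjective (enum-injective ∘ f-inj ∘ index-injective) (index y)
    in enum i , λ z≈ → trans (f-cong z≈) (index-injective eq)

module Fermat {c ℓ} (F : Field c ℓ) {n : ℕ} (card : FieldOps.HasCardinality F (suc n)) where
  open Field F
  open FieldOps F
  open FieldProperties F
  open FiniteField F card
  open import Relation.Binary.Reasoning.Setoid setoid
  open import Algebra.Properties.CommutativeMonoid.Sum *-commutativeMonoid
    using () renaming (sum to ∏; sum-permute to ∏-permute; ∑-distrib-+ to ∏-distrib-*; sum-cong-≋ to ∏-cong)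

  private
    i₀ = index 0#

  nonZeros : Fin n → Carrier
  nonZeros i = enum (punchIn i₀ i)

  nonZeros-nonZero : ∀ i → ¬ nonZeros i ≈ 0#
  nonZeros-nonZero i eq =
    punchInᵢ≢i i₀ i (enum-injective (trans eq (sym (enum-index 0#))))

  nonZeros-injective : Injective _≡_ _≈_ nonZeros
  nonZeros-injective eq = punchIn-injective i₀ _ _ (enum-injective eq)

  private
    ∏-const : ∀ x m → ∏ {m} (λ _ → x) ≈ x ^ m
    ∏-const x zero = refl
    ∏-const x (suc m) = *-congˡ (∏-const x m)

    ∏-nonZero : ∀ m (t : Fin m → Carrier) → (∀ i → ¬ t i ≈ 0#) → ¬ ∏ t ≈ 0#
    ∏-nonZero zero t _ 1≈0 = 0≉1 (sym 1≈0)
    ∏-nonZero (suc m) t t≉0 = *-nonZero (t≉0 _) (∏-nonZero m _ (t≉0 ∘ Fin.suc))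

  -- Multiplication by x permutes the nonzero elements, so their product is unchanged by the factor
  -- x^n. The permutation is built on all indices, with multiplication by `x ⁻¹` as inverse, and the
  -- fixed index of 0 is removed afterwards.
  x^n≈1 : ∀ {x} → ¬ x ≈ 0# → x ^ n ≈ 1#
  x^n≈1 {x} x≉0 = *-cancelˡ-nonZero (∏-nonZero n nonZeros nonZeros-nonZero) (begin
    ∏ nonZeros * x ^ n                      ≈⟨ *-comm _ _ ⟩
    x ^ n * ∏ nonZeros                      ≈⟨ *-congʳ (∏-const x n) ⟨
    ∏ {n} (λ _ → x) * ∏ nonZeros            ≈⟨ ∏-distrib-* {n} (λ _ → x) nonZeros ⟨
    ∏ (λ i → x * nonZeros i)                ≈⟨ ∏-cong permuted ⟨
    ∏ (λ i → nonZeros (remove i₀ π ⟨$⟩ʳ i)) ≈⟨ ∏-permute nonZeros (remove i₀ π) ⟨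
    ∏ nonZeros                              ≈⟨ *-identityʳ _ ⟨
    ∏ nonZeros * 1#                         ∎)
    where
    xx⁻¹ : ∀ {y z} → y * z ≈ 1# → ∀ i → index (y * enum (index (z * enum i))) ≡ i
    xx⁻¹ {y} {z} yz≈1 i = enum-injective (begin
      enum (index (y * enum (index (z * enum i)))) ≈⟨ enum-index _ ⟩
      y * enum (index (z * enum i))                ≈⟨ *-congˡ (enum-index _) ⟩
      y * (z * enum i)                             ≈⟨ *-assoc _ _ _ ⟨
      y * z * enum i                               ≈⟨ *-congʳ yz≈1 ⟩
      1# * enum i                                  ≈⟨ *-identityˡ _ ⟩
      enum i                                       ∎)

    π : Permutation′ (suc n)
    π = permutation (λ i → index (x * enum i)) (λ i → index (x ⁻¹ * enum i))
      (xx⁻¹ (inverseʳ x x≉0)) (xx⁻¹ (trans (*-comm _ _) (inverseʳ x x≉0)))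

    πi₀≡i₀ : π ⟨$⟩ʳ i₀ ≡ i₀
    πi₀≡i₀ = index-cong (trans (*-congˡ (enum-index 0#)) (zeroʳ x))

    permuted : ∀ i → nonZeros (remove i₀ π ⟨$⟩ʳ i) ≈ x * nonZeros i
    permuted i = begin
      enum (punchIn i₀ (remove i₀ π ⟨$⟩ʳ i))            ≡⟨ ≡.cong (λ j →
            enum (punchIn j (remove i₀ π ⟨$⟩ʳ i))) πi₀≡i₀ ⟨
      enum (punchIn (π ⟨$⟩ʳ i₀) (remove i₀ π ⟨$⟩ʳ i))   ≡⟨ ≡.cong enum (punchIn-permute π i₀ i) ⟨
      enum (π ⟨$⟩ʳ punchIn i₀ i)                        ≈⟨ enum-index _ ⟩
      x * nonZeros i                                    ∎

  x^[1+n]≈x : ∀ x → x ^ suc n ≈ x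
  x^[1+n]≈x x with x ≟ 0#
  ... | yes x≈0 = trans (*-congʳ x≈0) (trans (zeroˡ _) (sym x≈0))
  ... | no x≉0 = trans (*-congˡ (x^n≈1 x≉0)) (*-identityʳ x)

  nonZero-roots⇒vanishes : ∀ {d f} → Degree≤ d f → suc d ≤ n →
    (∀ x → ¬ x ≈ 0# → f x ≈ 0#) → ∀ x → f x ≈ 0#
  nonZero-roots⇒vanishes {d} df d<n f≈0 =
    roots⇒vanishes d df (nonZeros ∘ λ i → Fin.inject≤ i d<n)
      (λ eq → inject≤-injective d<n d<n _ _ (nonZeros-injective eq))
      (λ i → f≈0 _ (nonZeros-nonZero _))

-- Degree bounds for the two root counts over the nonzero elements

2^[1+m]≡2^m+2^m : ∀ m → 2 ℕ.^ suc m ≡ 2 ℕ.^ m ℕ.+ 2 ℕ.^ m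
2^[1+m]≡2^m+2^m m = ≡.cong (2 ℕ.^ m ℕ.+_) (ℕ.+-identityʳ _)

1+2^m*1≤n : ∀ {n} m → 1 ≤ m → suc n ≡ 2 ℕ.^ suc m → suc (2 ℕ.^ m ℕ.* 1) ≤ n
1+2^m*1≤n {n} m 1≤m 1+n≡ = ℕ.≤-pred (begin
  2 ℕ.+ 2 ℕ.^ m ℕ.* 1    ≡⟨ ≡.cong (2 ℕ.+_) (ℕ.*-identityʳ _) ⟩
  2 ℕ.+ 2 ℕ.^ m          ≤⟨ ℕ.+-monoˡ-≤ (2 ℕ.^ m) (ℕ.^-monoʳ-≤ 2 1≤m) ⟩
  2 ℕ.^ m ℕ.+ 2 ℕ.^ m    ≡⟨ 2^[1+m]≡2^m+2^m m ⟨
  2 ℕ.^ suc m            ≡⟨ 1+n≡ ⟨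
  suc n                  ∎)
  where open ℕ.≤-Reasoning

1+q*[q∸1]≤n : ∀ {n} q → 2 ≤ q → suc n ≡ q ℕ.* q → suc (q ℕ.* (q ∸ 1)) ≤ n
1+q*[q∸1]≤n {n} (suc e) 2≤q 1+n≡ = ℕ.≤-pred (begin
  2 ℕ.+ suc e ℕ.* e        ≤⟨ ℕ.+-monoˡ-≤ (suc e ℕ.* e) 2≤q ⟩
  suc e ℕ.+ suc e ℕ.* e    ≡⟨ ℕ.*-suc (suc e) e ⟨
  suc e ℕ.* suc e          ≡⟨ 1+n≡ ⟨
  suc n                    ∎)
  where open ℕ.≤-Reasoning

-- The field with q² elements: Frobenius, square roots, conjugation

module QuadraticExtension {c ℓ} (F : Field c ℓ) (k′ : ℕ)
  (card : FieldOps.HasCardinality F (2 ℕ.^ suc k′ ℕ.* 2 ℕ.^ suc k′))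
  (1+1≈0 : Field._≈_ F (Field._+_ F (Field.1# F) (Field.1# F)) (Field.0# F)) where

  open Field F
  open FieldOps F
  open FieldProperties F
  open CharTwo commutativeRing 1+1≈0
  open import Relation.Binary.Reasoning.Setoid setoid

  k q : ℕ
  k = suc k′
  q = 2 ℕ.^ k

  private
    n = ℕ.pred (q ℕ.* q)

    instance
      q≢0 : ℕ.NonZero q
      q≢0 = ℕ.m^n≢0 2 k

      q*q≢0 : ℕ.NonZero (q ℕ.* q)
      q*q≢0 = ℕ.m*n≢0 q q

    1+n≡q*q : suc n ≡ q ℕ.* q
    1+n≡q*q = ℕ.suc-pred (q ℕ.* q)

    card′ : HasCardinality (suc n)
    card′ = ≡.subst HasCardinality (≡.sym 1+n≡q*q) card

    2≤q : 2 ≤ q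
    2≤q = ℕ.*-monoʳ-≤ 2 (ℕ.m^n>0 2 k′)

    1+[q∸1]≡q : suc (q ∸ 1) ≡ q
    1+[q∸1]≡q = ℕ.suc-pred q

    1≤q∸1 : 1 ≤ q ∸ 1
    1≤q∸1 = ℕ.∸-monoˡ-≤ 1 2≤q

    2^[k+k]≡q*q : 2 ℕ.^ (k ℕ.+ k) ≡ q ℕ.* q
    2^[k+k]≡q*q = ℕ.^-distribˡ-+-* 2 k k

  open FiniteField F card public using (_≟_; injective⇒bijective)
  open FiniteField F card using (enum; index; enum-index)
  open Fermat F card′ using (x^[1+n]≈x; nonZero-roots⇒vanishes)

  x^[q*q]≈x : ∀ x → x ^ (q ℕ.* q) ≈ x
  x^[q*q]≈x x = ≡.subst (λ m → x ^ m ≈ x) 1+n≡q*q (x^[1+n]≈x x)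

  x*x≈0⇒x≈0 : ∀ {x} → x * x ≈ 0# → x ≈ 0#
  x*x≈0⇒x≈0 {x} xx≈0 with x ≟ 0#
  ... | yes x≈0 = x≈0
  ... | no x≉0 = xy≈0⇒y≈0 x≉0 xx≈0

  x*x≈y*y⇒x≈y : ∀ {x y} → x * x ≈ y * y → x ≈ y
  x*x≈y*y⇒x≈y {x} {y} eq = +≈0⇒≈ (x*x≈0⇒x≈0 (linear₁ eq
    (solve 2 (λ x y → (x :+ y) :* (x :+ y) := :0 :+ :1 :* (x :* x :+ y :* y)) refl x y)))

  xy≈0⇒x≈0∨y≈0 : ∀ {x y} → x * y ≈ 0# → x ≈ 0# ⊎ y ≈ 0#
  xy≈0⇒x≈0∨y≈0 {x} xy≈0 with x ≟ 0#
  ... | yes x≈0 = inj₁ x≈0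
  ... | no x≉0 = inj₂ (xy≈0⇒y≈0 x≉0 xy≈0)

  idempotent⇒0∨1 : ∀ {x} → x * x ≈ x → x ≈ 0# ⊎ x ≈ 1#
  idempotent⇒0∨1 {x} xx≈x with xy≈0⇒x≈0∨y≈0 {x} {x + 1#} (linear₁ xx≈x
    (solve 1 (λ x → x :* (x :+ :1) := :0 :+ :1 :* (x :* x :+ x)) refl x))
  ... | inj₁ x≈0 = inj₁ x≈0
  ... | inj₂ x+1≈0 = inj₂ (+≈0⇒≈ x+1≈0)

  x^2^[1+i] : ∀ x i → x ^ (2 ℕ.^ suc i) ≈ x ^ (2 ℕ.^ i) * x ^ (2 ℕ.^ i)
  x^2^[1+i] x i = trans (^-homo-* x (2 ℕ.^ i) _) (*-congˡ (reflexive
    (≡.cong (x ^_) (ℕ.+-identityʳ (2 ℕ.^ i)))))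

  frobenius-+ : ∀ i x y → (x + y) ^ (2 ℕ.^ i) ≈ x ^ (2 ℕ.^ i) + y ^ (2 ℕ.^ i)
  frobenius-+ zero x y = distribʳ _ _ _
  frobenius-+ (suc i) x y = begin
    (x + y) ^ (2 ℕ.^ suc i)                              ≈⟨ x^2^[1+i] (x + y) i ⟩
    (x + y) ^ (2 ℕ.^ i) * (x + y) ^ (2 ℕ.^ i)            ≈⟨ *-cong (frobenius-+ i x y) (frobenius-+ i x y) ⟩
    (x ^ (2 ℕ.^ i) + y ^ (2 ℕ.^ i)) * (x ^ (2 ℕ.^ i) + y ^ (2 ℕ.^ i))
      ≈⟨ solve 2 (λ u v → (u :+ v) :* (u :+ v) := u :* u :+ v :* v) refl (x ^ (2 ℕ.^ i)) (y ^ (2 ℕ.^ i)) ⟩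
    x ^ (2 ℕ.^ i) * x ^ (2 ℕ.^ i) + y ^ (2 ℕ.^ i) * y ^ (2 ℕ.^ i)
      ≈⟨ +-cong (x^2^[1+i] x i) (x^2^[1+i] y i) ⟨
    x ^ (2 ℕ.^ suc i) + y ^ (2 ℕ.^ suc i)                ∎

  -- Squaring is inverted by its own iterate: x^(2^(2k)) = x, and `k′ + k` is 2k - 1.
  √ : Carrier → Carrier
  √ x = x ^ (2 ℕ.^ (k′ ℕ.+ k))

  √x*√x≈x : ∀ x → √ x * √ x ≈ x
  √x*√x≈x x = begin
    √ x * √ x              ≈⟨ x^2^[1+i] x (k′ ℕ.+ k) ⟨
    x ^ (2 ℕ.^ (k ℕ.+ k))  ≡⟨ ≡.cong (x ^_) 2^[k+k]≡q*q ⟩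
    x ^ (q ℕ.* q)          ≈⟨ x^[q*q]≈x x ⟩
    x                      ∎

  √-nonZero : ∀ {x} → ¬ x ≈ 0# → ¬ √ x ≈ 0#
  √-nonZero = ^-nonZero (2 ℕ.^ (k′ ℕ.+ k))

  opaque
    -- Opaque, so that `conj x` stays an atom and is handled only through the laws of an involutive
    -- automorphism; `conj≡^q` is the way back to powers.
    conj : Carrier → Carrier
    conj x = x ^ q

    conj≡^q : ∀ x → conj x ≡ x ^ q
    conj≡^q x = ≡.refl

    conj-cong : ∀ {x y} → x ≈ y → conj x ≈ conj y
    conj-cong = ^-congˡ q

    conj-+ : ∀ x y → conj (x + y) ≈ conj x + conj y
    conj-+ = frobenius-+ k

    conj-* : ∀ x y → conj (x * y) ≈ conj x * conj y
    conj-* x y = ^-distrib-* x y q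

    conj-0 : conj 0# ≈ 0#
    conj-0 = 0^n≈0 (ℕ.≤-trans (ℕ.n≤1+n 1) 2≤q)

    conj-1 : conj 1# ≈ 1#
    conj-1 = 1^n≈1 q

    conj-conj : ∀ x → conj (conj x) ≈ x
    conj-conj x = trans (^-assocʳ x q q) (x^[q*q]≈x x)

    conj-nonZero : ∀ {x} → ¬ x ≈ 0# → ¬ conj x ≈ 0#
    conj-nonZero = ^-nonZero q

    x*x^[q∸1] : ∀ x → x * x ^ (q ∸ 1) ≈ conj x
    x*x^[q∸1] x = reflexive (≡.cong (x ^_) 1+[q∸1]≡q)

  conj-real-√ : ∀ {x} → conj x ≈ x → conj (√ x) ≈ √ x
  conj-real-√ {x} x-real = x*x≈y*y⇒x≈y (begin
    conj (√ x) * conj (√ x) ≈⟨ conj-* _ _ ⟨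
    conj (√ x * √ x)        ≈⟨ conj-cong (√x*√x≈x x) ⟩
    conj x                  ≈⟨ x-real ⟩
    x                       ≈⟨ √x*√x≈x x ⟨
    √ x * √ x               ∎)

  -- The witness z̄ + 1 has conjugate z + 1 = z (z̄ + 1). It vanishes only for z̄ = 1, where y = 1
  -- serves instead.
  hilbert90 : ∀ {z} → z * conj z ≈ 1# → ∃ λ y → ¬ y ≈ 0# × conj y ≈ z * y
  hilbert90 {z} zz̄≈1 with conj z ≟ 1#
  ... | yes z̄≈1 = 1# , 0≉1 ∘ sym , (begin
    conj 1#    ≈⟨ conj-1 ⟩
    1#         ≈⟨ zz̄≈1 ⟨
    z * conj z ≈⟨ *-congˡ z̄≈1 ⟩
    z * 1#     ∎)
  ... | no z̄≉1 = conj z + 1# , z̄≉1 ∘ +≈0⇒≈ , (begin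
    conj (conj z + 1#)    ≈⟨ conj-+ _ _ ⟩
    conj (conj z) + conj 1# ≈⟨ +-cong (conj-conj z) conj-1 ⟩
    z + 1#                ≈⟨ linear₁ zz̄≈1 (solve 2 (λ z z̄ →
      z :+ :1 := z :* (z̄ :+ :1) :+ :1 :* (z :* z̄ :+ :1)) refl z (conj z)) ⟩
    z * (conj z + 1#)     ∎)

  -- The Artin-Schreier map and the trace

  ℘ : Carrier → Carrier
  ℘ w = w * w + w

  Tr-cong : ∀ i {x y} → x ≈ y → Tr i x ≈ Tr i y
  Tr-cong zero x≈y = refl
  Tr-cong (suc i) x≈y = +-cong (Tr-cong i x≈y) (^-congˡ (2 ℕ.^ i) x≈y)

  Tr-+ : ∀ i x y → Tr i (x + y) ≈ Tr i x + Tr i y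
  Tr-+ zero x y = sym (+-identityʳ _)
  Tr-+ (suc i) x y = trans (+-cong (Tr-+ i x y) (frobenius-+ i x y))
    (solve 4 (λ a b c d → (a :+ b) :+ (c :+ d) := (a :+ c) :+ (b :+ d)) refl _ _ _ _)

  Tr-* : ∀ i x → Tr i (x * x) ≈ Tr i x * Tr i x
  Tr-* zero x = sym (zeroʳ _)
  Tr-* (suc i) x = trans (+-cong (Tr-* i x) (^-distrib-* x x (2 ℕ.^ i)))
    (solve 2 (λ a b → a :* a :+ b :* b := (a :+ b) :* (a :+ b)) refl _ _)

  Tr-℘ : ∀ i w → Tr i (℘ w) ≈ w ^ (2 ℕ.^ i) + w
  Tr-℘ zero w = solve 1 (λ w → :0 := w :* :1 :+ w) refl w
  Tr-℘ (suc i) w = begin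
    Tr i (℘ w) + (w * w + w) ^ (2 ℕ.^ i)
      ≈⟨ +-cong (Tr-℘ i w) (trans (frobenius-+ i (w * w) w) (+-congʳ (^-distrib-* w w (2 ℕ.^ i)))) ⟩
    (wⁱ + w) + (wⁱ * wⁱ + wⁱ)
      ≈⟨ solve 2 (λ u w → (u :+ w) :+ (u :* u :+ u) := u :* u :+ w) refl wⁱ w ⟩
    wⁱ * wⁱ + w ≈⟨ +-congʳ (x^2^[1+i] w i) ⟨
    w ^ (2 ℕ.^ suc i) + w ∎
    where wⁱ = w ^ (2 ℕ.^ i)

  -- The second recursion of the trace: square the partial sum and add the lowest term, instead of
  -- adding the highest. The two agree because `Tr-℘` telescopes.
  Tr-suc : ∀ i x → Tr (suc i) x ≈ Tr i x * Tr i x + x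
  Tr-suc i x = +≈0⇒≈ (begin
    Tr i x + x ^ (2 ℕ.^ i) + (Tr i x * Tr i x + x)
      ≈⟨ solve 4 (λ t p tt x → t :+ p :+ (tt :+ x) := tt :+ t :+ (p :+ x)) refl _ _ _ _ ⟩
    Tr i x * Tr i x + Tr i x + (x ^ (2 ℕ.^ i) + x)
      ≈⟨ +-congʳ (+-congʳ (Tr-* i x)) ⟨
    Tr i (x * x) + Tr i x + (x ^ (2 ℕ.^ i) + x)
      ≈⟨ +-congʳ (trans (sym (Tr-+ i (x * x) x)) (Tr-℘ i x)) ⟩
    x ^ (2 ℕ.^ i) + x + (x ^ (2 ℕ.^ i) + x)
      ≈⟨ x+x≈0 _ ⟩
    0# ∎)

  -- The trace is idempotent: its square plus itself is the trace of ℘ x, which telescopes to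
  -- x^(2^i) + x.
  Tr-0∨1 : ∀ i {x} → x ^ (2 ℕ.^ i) ≈ x → Tr i x ≈ 0# ⊎ Tr i x ≈ 1#
  Tr-0∨1 i {x} x-fixed = idempotent⇒0∨1 (+≈0⇒≈ (begin
    Tr i x * Tr i x + Tr i x  ≈⟨ +-congʳ (Tr-* i x) ⟨
    Tr i (x * x) + Tr i x     ≈⟨ Tr-+ i (x * x) x ⟨
    Tr i (℘ x)                ≈⟨ Tr-℘ i x ⟩
    x ^ (2 ℕ.^ i) + x         ≈⟨ ≈⇒+≈0 x-fixed ⟩
    0#                        ∎))

  Tr-[i+k]-real : ∀ i {x} → conj x ≈ x → Tr (i ℕ.+ k) x ≈ Tr i x + Tr k x
  Tr-[i+k]-real zero x-real = sym (+-identityˡ _)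
  Tr-[i+k]-real (suc i) {x} x-real = begin
    Tr (i ℕ.+ k) x + x ^ (2 ℕ.^ (i ℕ.+ k))
      ≈⟨ +-cong (Tr-[i+k]-real i x-real) x^2^[i+k] ⟩
    Tr i x + Tr k x + x ^ (2 ℕ.^ i)
      ≈⟨ solve 3 (λ a b c → a :+ b :+ c := a :+ c :+ b) refl _ _ _ ⟩
    Tr i x + x ^ (2 ℕ.^ i) + Tr k x ∎
    where
    x^2^[i+k] : x ^ (2 ℕ.^ (i ℕ.+ k)) ≈ x ^ (2 ℕ.^ i)
    x^2^[i+k] = begin
      x ^ (2 ℕ.^ (i ℕ.+ k))   ≡⟨ ≡.cong (x ^_) (≡.trans (ℕ.^-distribˡ-+-* 2 i k) (ℕ.*-comm _ q)) ⟩
      x ^ (q ℕ.* 2 ℕ.^ i)     ≈⟨ ^-assocʳ x q _ ⟨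
      (x ^ q) ^ (2 ℕ.^ i)     ≈⟨ ^-congˡ (2 ℕ.^ i) (trans (reflexive (≡.sym (conj≡^q x))) x-real) ⟩
      x ^ (2 ℕ.^ i)           ∎

  -- For y ≉ 0 this is y^(2^m) Tr (1+m) (δ / y), a polynomial in y whose constant term δ^(2^m)
  -- is the leading coefficient of the trace: vanishing of the trace is tested by evaluation at 0.
  reversedTr : ℕ → Carrier → Carrier → Carrier
  reversedTr zero δ y = δ
  reversedTr (suc m) δ y = y ^ (2 ℕ.^ m) * reversedTr m δ y + δ ^ (2 ℕ.^ suc m)

  reversedTr-spec : ∀ m δ {y y′} → y * y′ ≈ 1# →
                    reversedTr m δ y ≈ y ^ (2 ℕ.^ m) * Tr (suc m) (δ * y′)
  reversedTr-spec zero δ {y} {y′} yy′≈1 = linear₁ yy′≈1 (solve 3 (λ δ y y′ →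
    δ := (y :* :1) :* (:0 :+ (δ :* y′) :* :1) :+ δ :* (y :* y′ :+ :1)) refl δ y y′)
  reversedTr-spec (suc m) δ {y} {y′} yy′≈1 = begin
    yᵐ * reversedTr m δ y + δ ^ 2^[1+m]
      ≈⟨ +-cong (*-congˡ (reversedTr-spec m δ yy′≈1)) (sym last) ⟩
    yᵐ * (yᵐ * t) + y ^ 2^[1+m] * (δ * y′) ^ 2^[1+m]
      ≈⟨ +-congʳ (trans (sym (*-assoc _ _ _)) (*-congʳ (sym (x^2^[1+i] y m)))) ⟩
    y ^ 2^[1+m] * t + y ^ 2^[1+m] * (δ * y′) ^ 2^[1+m]
      ≈⟨ distribˡ _ _ _ ⟨
    y ^ 2^[1+m] * (t + (δ * y′) ^ 2^[1+m]) ∎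
    where
    2^[1+m] = 2 ℕ.^ suc m
    yᵐ = y ^ (2 ℕ.^ m)
    t = Tr (suc m) (δ * y′)

    last : y ^ 2^[1+m] * (δ * y′) ^ 2^[1+m] ≈ δ ^ 2^[1+m]
    last = trans (sym (^-distrib-* y (δ * y′) 2^[1+m])) (^-congˡ 2^[1+m] (linear₁ yy′≈1
      (solve 3 (λ δ y y′ → y :* (δ :* y′) := δ :+ δ :* (y :* y′ :+ :1)) refl δ y y′)))

  reversedTr-0 : ∀ m δ → reversedTr m δ 0# ≈ δ ^ (2 ℕ.^ m)
  reversedTr-0 zero δ = sym (*-identityʳ δ)
  reversedTr-0 (suc m) δ =
    trans (+-congʳ (trans (*-congʳ (0^n≈0 (ℕ.m^n>0 2 m))) (zeroˡ _))) (+-identityˡ _)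

  reversedTr-cong : ∀ m {δ y z} → y ≈ z → reversedTr m δ y ≈ reversedTr m δ z
  reversedTr-cong zero y≈z = refl
  reversedTr-cong (suc m) y≈z =
    +-congʳ (*-cong (^-congˡ (2 ℕ.^ m) y≈z) (reversedTr-cong m y≈z))

  degree-∘^ : ∀ i {e f} → Degree≤ e f → Degree≤ (i ℕ.* e) (λ x → f x ^ i)
  degree-∘^ zero df = degree-const 0 1#
  degree-∘^ (suc i) {e} df = degree-* e df (degree-∘^ i df)

  degree-Tr : ∀ m {e f} → Degree≤ e f → Degree≤ (2 ℕ.^ m ℕ.* e) (λ x → Tr (suc m) (f x))
  degree-Tr zero {e} df = degree-+ (1 ℕ.* e) (degree-const _ 0#) (degree-∘^ 1 df)
  degree-Tr (suc m) {e} df = degree-+ (2 ℕ.^ suc m ℕ.* e)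
    (degree-≤ (ℕ.*-monoˡ-≤ e (ℕ.^-monoʳ-≤ 2 (ℕ.n≤1+n m))) (degree-Tr m df)) (degree-∘^ (2 ℕ.^ suc m) df)

  2^[1+m]*e : ∀ m e → 2 ℕ.^ suc m ℕ.* e ≡ 2 ℕ.^ m ℕ.* e ℕ.+ 2 ℕ.^ m ℕ.* e
  2^[1+m]*e m e = ≡.trans (ℕ.*-distribʳ-+ e (2 ℕ.^ m) (2 ℕ.^ m ℕ.+ 0))
    (≡.cong (λ j → 2 ℕ.^ m ℕ.* e ℕ.+ j ℕ.* e) {y = 2 ℕ.^ m} (ℕ.+-identityʳ _))

  degree-reversedTr : ∀ m δ {e f} → Degree≤ e f →
                      Degree≤ (2 ℕ.^ m ℕ.* e) (λ x → reversedTr m δ (f x))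
  degree-reversedTr zero δ df = degree-const _ δ
  degree-reversedTr (suc m) δ {e} df = degree-+ (2 ℕ.^ suc m ℕ.* e)
    (degree-≤ (ℕ.≤-reflexive (≡.sym (2^[1+m]*e m e)))
      (degree-* (2 ℕ.^ m ℕ.* e) (degree-∘^ (2 ℕ.^ m) df) (degree-reversedTr m δ df)))
    (degree-const _ _)

  -- If the trace vanished identically, `reversedTr` with δ = 1 would have all q² - 1 nonzero
  -- elements as roots, although its degree is at most q²/2 and its value at 0 is 1.
  ∃-Tr≈1 : ∃ λ δ → Tr (k ℕ.+ k) δ ≈ 1#
  ∃-Tr≈1 with any? (λ i → ¬? (Tr (k ℕ.+ k) (enum i) ≟ 0#))
  ... | yes (i , Tr≉0) = enum i , ([ (λ Tr≈0 → contradiction Tr≈0 Tr≉0) , (λ Tr≈1 → Tr≈1) ]′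
    (Tr-0∨1 (k ℕ.+ k) (trans (reflexive (≡.cong (enum i ^_) 2^[k+k]≡q*q)) (x^[q*q]≈x _))))
  ... | no Tr-vanishes = contradiction
    (trans (sym (trans (reversedTr-0 m 1#) (1^n≈1 (2 ℕ.^ m))))
      (nonZero-roots⇒vanishes degree 1+deg≤n reversedTr≈0 0#))
    (0≉1 ∘ sym)
    where
    m = k′ ℕ.+ k

    Tr≈0 : ∀ x → Tr (k ℕ.+ k) x ≈ 0#
    Tr≈0 x = trans (Tr-cong (k ℕ.+ k) (sym (enum-index x)))
      (decidable-stable (_ ≟ _) λ Tr≉0 → Tr-vanishes (index x , Tr≉0))

    reversedTr≈0 : ∀ y → ¬ y ≈ 0# → reversedTr m 1# y ≈ 0#
    reversedTr≈0 y y≉0 = trans (reversedTr-spec m 1# (inverseʳ y y≉0))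
      (trans (*-congˡ (Tr≈0 _)) (zeroʳ _))

    degree : Degree≤ (2 ℕ.^ m ℕ.* 1) (λ y → reversedTr m 1# y)
    degree = degree-reversedTr m 1# (0# , (λ _ → 1#) , (1# , λ _ → refl) ,
      λ x → sym (trans (+-identityˡ _) (*-identityʳ x)))

    1+deg≤n : suc (2 ℕ.^ m ℕ.* 1) ≤ n
    1+deg≤n = 1+2^m*1≤n m (ℕ.≤-trans (s≤s z≤n) (ℕ.m≤n+m k k′)) (≡.trans 1+n≡q*q (≡.sym 2^[k+k]≡q*q))

  Tr-℘-conj : ∀ w → Tr k (℘ w) ≈ conj w + w
  Tr-℘-conj w = trans (Tr-℘ k w) (+-congʳ (reflexive (≡.sym (conj≡^q w))))

  conj-fixed⇒Tr-0∨1 : ∀ {x} → conj x ≈ x → Tr k x ≈ 0# ⊎ Tr k x ≈ 1#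
  conj-fixed⇒Tr-0∨1 {x} x-real = Tr-0∨1 k (trans (reflexive (≡.sym (conj≡^q x))) x-real)

  -- If Tr δ ≈ 1 then Σᵢ (Trᵢ s) δ^(2^i) is a preimage of s under ℘ (additive Hilbert 90).
  ℘-surjective-on-real : ∀ {s} → conj s ≈ s → ∃ λ w → ℘ w ≈ s
  ℘-surjective-on-real {s} s-real with δ , Trδ≈1 ← ∃-Tr≈1 = W (k ℕ.+ k) , (begin
    ℘ (W (k ℕ.+ k))
      ≈⟨ ℘W (k ℕ.+ k) ⟩
    Tr (k ℕ.+ k) s * δ ^ (2 ℕ.^ (k ℕ.+ k)) + s * (Tr (k ℕ.+ k) δ + δ + δ ^ (2 ℕ.^ (k ℕ.+ k)))
      ≈⟨ +-cong (*-congʳ Trs≈0) (*-congˡ (+-cong (+-congʳ Trδ≈1) δ-fixed)) ⟩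
    0# * δ ^ (2 ℕ.^ (k ℕ.+ k)) + s * (1# + δ + δ)
      ≈⟨ solve 3 (λ d s δ → :0 :* d :+ s :* (:1 :+ δ :+ δ) := s) refl _ s δ ⟩
    s ∎)
    where
    W : ℕ → Carrier
    W zero = 0#
    W (suc i) = W i + Tr i s * δ ^ (2 ℕ.^ i)

    -- The bracket is δ² + ... + δ^(2^i), the trace of δ with its lowest term exchanged for the next
    -- power. At i = 2k it equals 1, and the first summand carries the factor Tr s = 0.
    ℘W : ∀ i → ℘ (W i) ≈ Tr i s * δ ^ (2 ℕ.^ i) + s * (Tr i δ + δ + δ ^ (2 ℕ.^ i))
    ℘W zero = solve 2 (λ s δ → :0 :* :0 :+ :0 :=
      :0 :* (δ :* :1) :+ s :* (:0 :+ δ :+ δ :* :1)) refl s δ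
    ℘W (suc i) = begin
      (W i + S * D) * (W i + S * D) + (W i + S * D)
        ≈⟨ solve 3 (λ W S D → (W :+ S :* D) :* (W :+ S :* D) :+ (W :+ S :* D) :=
             W :* W :+ W :+ (S :* S :* (D :* D) :+ S :* D)) refl (W i) S D ⟩
      ℘ (W i) + (S * S * (D * D) + S * D)
        ≈⟨ +-congʳ (℘W i) ⟩
      S * D + s * (Tr i δ + δ + D) + (S * S * (D * D) + S * D)
        ≈⟨ solve 5 (λ S D s t δ → S :* D :+ s :* (t :+ δ :+ D) :+ (S :* S :* (D :* D) :+ S :* D) :=
             (S :* S :+ s) :* (D :* D) :+ s :* (t :+ D :+ δ :+ D :* D)) refl S D s (Tr i δ) δ ⟩
      (S * S + s) * (D * D) + s * (Tr i δ + D + δ + D * D)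
        ≈⟨ +-cong (*-cong (sym (Tr-suc i s)) (sym D²)) (*-congˡ (+-congˡ (sym D²))) ⟩
      Tr (suc i) s * δ ^ (2 ℕ.^ suc i) + s * (Tr (suc i) δ + δ + δ ^ (2 ℕ.^ suc i)) ∎
      where
      S = Tr i s
      D = δ ^ (2 ℕ.^ i)
      D² = x^2^[1+i] δ i

    -- On 𝔽_q the Frobenius powers repeat with period k, so each term occurs twice.
    Trs≈0 : Tr (k ℕ.+ k) s ≈ 0#
    Trs≈0 = trans (Tr-[i+k]-real k s-real) (x+x≈0 _)

    δ-fixed : δ ^ (2 ℕ.^ (k ℕ.+ k)) ≈ δ
    δ-fixed = trans (reflexive (≡.cong (δ ^_) 2^[k+k]≡q*q)) (x^[q*q]≈x δ)

  -- For s in 𝔽_q this is the dichotomy behind every trace condition below: the preimage lies in 𝔽_q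
  -- if the trace is 0 and is moved to w + 1 if it is 1.
  conj-preimage : ∀ {s w} → ℘ w ≈ s → conj w ≈ w + Tr k s
  conj-preimage {s} {w} ℘w≈s = begin
    conj w              ≈⟨ solve 2 (λ w̄ w → w̄ := w :+ (w̄ :+ w)) refl (conj w) w ⟩
    w + (conj w + w)    ≈⟨ +-congˡ (Tr-℘-conj w) ⟨
    w + Tr k (℘ w)      ≈⟨ +-congˡ (Tr-cong k ℘w≈s) ⟩
    w + Tr k s          ∎

  Tr-℘-real : ∀ {w} → conj w ≈ w → Tr k (℘ w) ≈ 0#
  Tr-℘-real w-real = trans (Tr-℘-conj _) (≈⇒+≈0 w-real)

  Tr-℘-shifted : ∀ {w} → conj w ≈ w + 1# → Tr k (℘ w) ≈ 1#
  Tr-℘-shifted {w} w̄≈w+1 = trans (Tr-℘-conj w) (trans (+-congʳ w̄≈w+1)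
    (solve 1 (λ w → w :+ :1 :+ w := :1) refl w))

  -- The map x ↦ x^(q-1) sends nonzero x to the circle, so composing with it replaces a count of
  -- circle points by a count of nonzero x: the degree q(q-1) is below q² - 1.
  Tr-constant-on-circle⇒0 : ∀ γ κ →
    (∀ y → y * conj y ≈ 1# → Tr k (γ * y + conj γ * conj y) ≈ κ) → γ ≈ 0#
  Tr-constant-on-circle⇒0 γ κ Tr≈κ = decidable-stable (γ ≟ 0#) λ γ≉0 →
    ^-nonZero (2 ℕ.^ k′) (conj-nonZero γ≉0) (begin
      conj γ ^ (2 ℕ.^ k′)  ≈⟨ Q[0]≈ ⟨
      Q (0# ^ (q ∸ 1))     ≈⟨ nonZero-roots⇒vanishes degree (1+q*[q∸1]≤n q 2≤q 1+n≡q*q) Q-vanishes 0# ⟩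
      0#                   ∎)
    where
    N = 2 ℕ.^ k′

    -- On the circle ȳ = 1/y, and the factor y^N, N = q/2, clears the denominators of Tr (γ̄ ȳ). The
    -- first summand vanishes at 0, which leaves γ̄^N as constant term.
    Q : Carrier → Carrier
    Q y = y ^ N * (Tr k (γ * y) + κ) + reversedTr k′ (conj γ) y

    degree : Degree≤ (q ℕ.* (q ∸ 1)) (λ x → Q (x ^ (q ∸ 1)))
    degree = degree-+ (q ℕ.* (q ∸ 1))
      (degree-≤ (ℕ.≤-reflexive (≡.sym (2^[1+m]*e k′ (q ∸ 1))))
        (degree-* (N ℕ.* (q ∸ 1)) (degree-∘^ N (degree-^ (q ∸ 1)))
          (degree-+ (N ℕ.* (q ∸ 1)) (degree-Tr k′ (degree-*ˡ _ γ (degree-^ (q ∸ 1)))) (degree-const _ κ))))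
      (degree-≤ (ℕ.*-monoˡ-≤ (q ∸ 1) (ℕ.m≤m+n N _)) (degree-reversedTr k′ (conj γ) (degree-^ (q ∸ 1))))

    Q-vanishes : ∀ x → ¬ x ≈ 0# → Q (x ^ (q ∸ 1)) ≈ 0#
    Q-vanishes x x≉0 = begin
      y ^ N * (Tr k (γ * y) + κ) + reversedTr k′ (conj γ) y
        ≈⟨ +-congˡ (reversedTr-spec k′ (conj γ) y*ȳ≈1) ⟩
      y ^ N * (Tr k (γ * y) + κ) + y ^ N * Tr k (conj γ * conj y)
        ≈⟨ solve 4 (λ yᴺ t t̄ κ → yᴺ :* (t :+ κ) :+ yᴺ :* t̄ := yᴺ :* (t :+ t̄ :+ κ)) refl _ _ _ _ ⟩
      y ^ N * (Tr k (γ * y) + Tr k (conj γ * conj y) + κ)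
        ≈⟨ *-congˡ (≈⇒+≈0 (trans (sym (Tr-+ k _ _)) (Tr≈κ y y*ȳ≈1))) ⟩
      y ^ N * 0#
        ≈⟨ zeroʳ _ ⟩
      0# ∎
      where
      y = x ^ (q ∸ 1)

      y*ȳ≈1 : y * conj y ≈ 1#
      y*ȳ≈1 = *-cancelˡ-nonZero (*-nonZero x≉0 (conj-nonZero x≉0)) (begin
        x * conj x * (y * conj y)
          ≈⟨ solve 4 (λ x x̄ y ȳ → x :* x̄ :* (y :* ȳ) := x :* y :* (x̄ :* ȳ)) refl _ _ _ _ ⟩
        x * y * (conj x * conj y)
          ≈⟨ *-cong (x*x^[q∸1] x) (trans (sym (conj-* x y)) (conj-cong (x*x^[q∸1] x))) ⟩
        conj x * conj (conj x)
          ≈⟨ *-congˡ (conj-conj x) ⟩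
        conj x * x
          ≈⟨ solve 2 (λ x x̄ → x̄ :* x := x :* x̄ :* :1) refl x (conj x) ⟩
        x * conj x * 1# ∎)

    Q[0]≈ : Q (0# ^ (q ∸ 1)) ≈ conj γ ^ N
    Q[0]≈ = begin
      y ^ N * (Tr k (γ * y) + κ) + reversedTr k′ (conj γ) y
        ≈⟨ +-cong (*-congʳ y^N≈0) (reversedTr-cong k′ y≈0) ⟩
      0# * (Tr k (γ * y) + κ) + reversedTr k′ (conj γ) 0#
        ≈⟨ trans (+-congʳ (zeroˡ _)) (trans (+-identityˡ _) (reversedTr-0 k′ (conj γ))) ⟩
      conj γ ^ N ∎
      where
      y = 0# ^ (q ∸ 1)
      y≈0 : y ≈ 0#
      y≈0 = 0^n≈0 1≤q∸1
      y^N≈0 : y ^ N ≈ 0#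
      y^N≈0 = trans (^-congˡ N y≈0) (0^n≈0 (ℕ.m^n>0 2 k′))

-- Here A and X̄ stand for the conjugates of a and X; the forms are stated for arbitrary operations so that
-- they can be used both in the field and as polynomials for the ring solver.
module Forms {v} {V : Set v} (_+_ _*_ : V → V → V) (1# : V) where
  infixl 6 _⊕_
  infixl 7 _⊗_
  private
    _⊕_ = _+_
    _⊗_ = _*_

  M : (a A b : V) → V
  M a A b = a ⊗ A ⊕ b ⊗ b

  Φ : (a b X X̄ : V) → V
  Φ a b X X̄ = X ⊗ X ⊗ X̄ ⊕ a ⊗ X ⊗ X ⊗ X ⊕ b ⊗ X̄ ⊗ X̄ ⊗ X̄

  C T : (a A b X X̄ : V) → V
  C a A b X X̄ = b ⊗ X̄ ⊗ X̄ ⊕ A ⊗ X ⊗ X̄ ⊕ M a A b ⊗ X ⊗ X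
  T a A b X X̄ = A ⊗ X̄ ⊗ X̄ ⊕ a ⊗ X ⊗ X ⊕ (M a A b ⊕ 1#) ⊗ X ⊗ X̄

  H : (a A b X X̄ Y Ȳ : V) → V
  H a A b X X̄ Y Ȳ = C a A b X X̄ ⊗ Ȳ ⊗ Ȳ ⊕ T a A b X X̄ ⊗ Y ⊗ Ȳ ⊕ C A a b X̄ X ⊗ Y ⊗ Y

-- The trinomial and its cubic form

module PermutationTrinomial {c ℓ} (F : Field c ℓ) (k′ : ℕ)
  (card : FieldOps.HasCardinality F (2 ℕ.^ suc k′ ℕ.* 2 ℕ.^ suc k′))
  (1+1≈0 : Field._≈_ F (Field._+_ F (Field.1# F) (Field.1# F)) (Field.0# F)) where

  open Field F
  open FieldOps F
  open FieldProperties F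
  open CharTwo commutativeRing 1+1≈0
  open QuadraticExtension F k′ card 1+1≈0
  open import Relation.Binary.Reasoning.Setoid setoid
  open Forms _+_ _*_ 1#
  private module :F {n} = Forms {V = Polynomial n} _:+_ _:*_ :1

  -x≈x : ∀ x → - x ≈ x
  -x≈x x = sym (inverseˡ-unique x x (x+x≈0 x))
    where open import Algebra.Properties.AbelianGroup +-abelianGroup using (inverseˡ-unique)

  -- conj is a ring endomorphism, so it acts on a polynomial expression through its variables.
  conj-⟦⟧ : ∀ {n} (p : Polynomial n) {ρ ρ̄ : Vec Carrier n} →
            Pointwise (λ x x̄ → conj x ≈ x̄) ρ ρ̄ → conj (⟦ p ⟧ ρ) ≈ ⟦ p ⟧ ρ̄
  conj-⟦⟧ (op [+] p p′) ρ̄≈ = trans (conj-+ _ _) (+-cong (conj-⟦⟧ p ρ̄≈) (conj-⟦⟧ p′ ρ̄≈))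
  conj-⟦⟧ (op [*] p p′) ρ̄≈ = trans (conj-* _ _) (*-cong (conj-⟦⟧ p ρ̄≈) (conj-⟦⟧ p′ ρ̄≈))
  conj-⟦⟧ (con true) ρ̄≈ = conj-1
  conj-⟦⟧ (con false) ρ̄≈ = conj-0
  conj-⟦⟧ (var i) ρ̄≈ = Pointwise.lookup ρ̄≈ i
  conj-⟦⟧ (p :^ zero) ρ̄≈ = conj-1
  conj-⟦⟧ (p :^ suc i) ρ̄≈ = trans (conj-* _ _) (*-cong (conj-⟦⟧ p ρ̄≈) (conj-⟦⟧ (p :^ i) ρ̄≈))
  conj-⟦⟧ (:- p) ρ̄≈ = trans (conj-cong (-x≈x _)) (trans (conj-⟦⟧ p ρ̄≈) (sym (-x≈x _)))

  module _ (a b : Carrier) where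
    f : Carrier → Carrier
    f x = x + a * x ^ (q ℕ.* (q ∸ 1) ℕ.+ 1) + b * x ^ (2 ℕ.* (q ∸ 1) ℕ.+ 1)

    f-cong : Congruent _≈_ _≈_ f
    f-cong x≈y = +-cong (+-cong x≈y (*-congˡ (^-congˡ (q ℕ.* (q ∸ 1) ℕ.+ 1) x≈y)))
      (*-congˡ (^-congˡ (2 ℕ.* (q ∸ 1) ℕ.+ 1) x≈y))

    f-0 : f 0# ≈ 0#
    f-0 = trans (+-cong (+-congˡ (*-congˡ (0^n≈0 (ℕ.m≤n+m 1 (q ℕ.* (q ∸ 1))))))
                        (*-congˡ (0^n≈0 (ℕ.m≤n+m 1 (2 ℕ.* (q ∸ 1))))))
      (solve 2 (λ a b → :0 :+ a :* :0 :+ b :* :0 := :0) refl a b)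

    -- With u = x^(q-1) the exponents give a ū x and b u² x, while x u = x̄ and x̄ ū = x. These
    -- relations also hold at x = 0, so no case distinction arises.
    f[x]*xx̄≈Φ : ∀ x → f x * (x * conj x) ≈ Φ a b x (conj x)
    f[x]*xx̄≈Φ x = begin
      (x + a * x ^ (q ℕ.* (q ∸ 1) ℕ.+ 1) + b * x ^ (2 ℕ.* (q ∸ 1) ℕ.+ 1)) * (x * x̄)
        ≈⟨ *-congʳ (+-cong (+-congˡ (*-congˡ first)) (*-congˡ second)) ⟩
      (x + a * (conj u * x) + b * (u * u * x)) * (x * x̄)
        ≈⟨ linear₂ (x*x^[q∸1] x) (trans (sym (conj-* x u)) (trans (conj-cong (x*x^[q∸1] x)) (conj-conj x)))
           (solve 6 (λ a b x x̄ u ū → (x :+ a :* (ū :* x) :+ b :* (u :* u :* x)) :* (x :* x̄) :=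
              :F.Φ a b x x̄ :+ (b :* x̄ :* (x :* u :+ x̄)) :* (x :* u :+ x̄) :+ (a :* x :* x) :* (x̄ :* ū :+ x))
            refl a b x x̄ u (conj u)) ⟩
      Φ a b x x̄ ∎
      where
      x̄ = conj x
      u = x ^ (q ∸ 1)
      first : x ^ (q ℕ.* (q ∸ 1) ℕ.+ 1) ≈ conj u * x
      first = trans (^-homo-* x (q ℕ.* (q ∸ 1)) 1) (*-cong
        (trans (reflexive (≡.cong (x ^_) (ℕ.*-comm q (q ∸ 1))))
              (trans (sym (^-assocʳ x (q ∸ 1) q)) (reflexive (≡.sym (conj≡^q u)))))
        (*-identityʳ x))
      second : x ^ (2 ℕ.* (q ∸ 1) ℕ.+ 1) ≈ u * u * x
      second = trans (^-homo-* x (2 ℕ.* (q ∸ 1)) 1) (*-cong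
        (trans (^-homo-* x (q ∸ 1) _) (*-congˡ (reflexive (≡.cong (x ^_) (ℕ.+-identityʳ (q ∸ 1))))))
        (*-identityʳ x))

  -- Injectivity in terms of the zeros of the quadratic form

  module Collisions (a b : Carrier) (b-real : conj b ≈ b) where
    A : Carrier
    A = conj a

    Ca C̄a Ta Φa : Carrier → Carrier
    Ca x = C a A b x (conj x)
    C̄a x = C A a b (conj x) x
    Ta x = T a A b x (conj x)
    Φa x = Φ a b x (conj x)

    Ha : Carrier → Carrier → Carrier
    Ha x y = H a A b x (conj x) y (conj y)

    conj-Φ : ∀ x → conj (Φa x) ≈ Φ A b (conj x) x
    conj-Φ x = conj-⟦⟧ (:F.Φ (var 0F) (var 1F) (var 2F) (var 3F))
      (refl ∷ b-real ∷ refl ∷ conj-conj x ∷ [])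

    conj-C : ∀ x → conj (Ca x) ≈ C̄a x
    conj-C x = conj-⟦⟧ (:F.C (var 0F) (var 1F) (var 2F) (var 3F) (var 4F))
      (refl ∷ conj-conj a ∷ b-real ∷ refl ∷ conj-conj x ∷ [])

    conj-T : ∀ x → conj (Ta x) ≈ Ta x
    conj-T x = trans (conj-⟦⟧ (:F.T (var 0F) (var 1F) (var 2F) (var 3F) (var 4F))
      (refl ∷ conj-conj a ∷ b-real ∷ refl ∷ conj-conj x ∷ []))
      (solve 5 (λ a A b x x̄ → :F.T A a b x̄ x := :F.T a A b x x̄) refl a A b x (conj x))

    cross-Φ : ∀ x y → Φa x * Φ A b (conj y) y + Φ A b (conj x) x * Φa y
                      ≈ (x * conj y + conj x * y) * Ha x y
    cross-Φ x y = solve 7 (λ a A b x x̄ y ȳ →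
      :F.Φ a b x x̄ :* :F.Φ A b ȳ y :+ :F.Φ A b x̄ x :* :F.Φ a b y ȳ :=
      (x :* ȳ :+ x̄ :* y) :* :F.H a A b x x̄ y ȳ) refl a A b x (conj x) y (conj y)

    f-scale : ∀ {r} → conj r ≈ r → ¬ r ≈ 0# → ∀ {x} → ¬ x ≈ 0# → f a b (r * x) ≈ r * f a b x
    f-scale {r} r-real r≉0 {x} x≉0 = *-cancelˡ-nonZero (*-nonZero rx≉0 (conj-nonZero rx≉0)) (begin
      r * x * conj (r * x) * f a b (r * x)   ≈⟨ *-comm _ _ ⟩
      f a b (r * x) * (r * x * conj (r * x)) ≈⟨ f[x]*xx̄≈Φ a b (r * x) ⟩
      Φ a b (r * x) (conj (r * x))
        ≈⟨ +-cong (+-congʳ (*-congˡ conj-rx)) (*-cong (*-cong (*-congˡ conj-rx) conj-rx) conj-rx) ⟩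
      Φ a b (r * x) (r * x̄)                  ≈⟨ solve 5 (λ a b r x x̄ →
        :F.Φ a b (r :* x) (r :* x̄) := r :* r :* r :* :F.Φ a b x x̄) refl a b r x x̄ ⟩
      r * r * r * Φ a b x x̄                  ≈⟨ *-congˡ (f[x]*xx̄≈Φ a b x) ⟨
      r * r * r * (f a b x * (x * x̄))        ≈⟨ solve 4 (λ r x x̄ y → r :* r :* r :* (y :* (x :* x̄)) :=
        r :* x :* (r :* x̄) :* (r :* y)) refl r x x̄ (f a b x) ⟩
      r * x * (r * x̄) * (r * f a b x)        ≈⟨ *-congʳ (*-congˡ conj-rx) ⟨
      r * x * conj (r * x) * (r * f a b x)   ∎)
      where
      x̄ = conj x
      rx≉0 = *-nonZero r≉0 x≉0
      conj-rx : conj (r * x) ≈ r * x̄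
      conj-rx = trans (conj-* r x) (*-congʳ r-real)

    module _ (f-inj : Injective _≈_ _≈_ (f a b)) where
      injective⇒f≉0 : ∀ {x} → ¬ x ≈ 0# → ¬ f a b x ≈ 0#
      injective⇒f≉0 x≉0 fx≈0 = x≉0 (f-inj (trans fx≈0 (sym (f-0 a b))))

      -- A zero of the form makes V W̄ real, where V = f(x) and W = f(y). By homogeneity the real
      -- multiples W W̄ x and V W̄ y have the same image W W̄ V; injectivity equates them, so x and
      -- y share a direction.
      injective⇒no-collision : ∀ {x y} → ¬ x ≈ 0# → ¬ y ≈ 0# → Ha x y ≈ 0# →
                               x * conj y ≈ conj x * y
      injective⇒no-collision {x} {y} x≉0 y≉0 H≈0 =
        *-cancelˡ-nonZero (*-nonZero W≉0 (conj-nonZero V≉0)) (begin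
          W * V̄ * (x * ȳ)    ≈⟨ solve 4 (λ W V̄ x ȳ → W :* V̄ :* (x :* ȳ) :=
                W :* x :* (V̄ :* ȳ)) refl _ _ _ _ ⟩
          W * x * (V̄ * ȳ)
            ≈⟨ *-cong Wx≈Vy (trans (sym (conj-* V y)) (trans (conj-cong (sym Wx≈Vy)) (conj-* W x))) ⟩
          V * y * (W̄ * x̄)    ≈⟨ solve 4 (λ V W̄ x̄ y → V :* y :* (W̄ :* x̄) :=
                V :* W̄ :* (x̄ :* y)) refl _ _ _ _ ⟩
          V * W̄ * (x̄ * y)    ≈⟨ *-congʳ VW̄≈WV̄ ⟩
          W * V̄ * (x̄ * y)    ∎)
        where
        x̄ = conj x
        ȳ = conj y
        V = f a b x
        W = f a b y
        V̄ = conj V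
        W̄ = conj W
        V≉0 = injective⇒f≉0 x≉0
        W≉0 = injective⇒f≉0 y≉0
        W̄≉0 = conj-nonZero W≉0

        fΦ̄ : ∀ z → conj (f a b z) * (z * conj z) ≈ Φ A b (conj z) z
        fΦ̄ z = begin
          conj (f a b z) * (z * conj z)
            ≈⟨ *-congˡ (trans (*-comm _ _) (*-congˡ (sym (conj-conj z)))) ⟩
          conj (f a b z) * (conj z * conj (conj z))   ≈⟨ *-congˡ (conj-* _ _) ⟨
          conj (f a b z) * conj (z * conj z)          ≈⟨ conj-* _ _ ⟨
          conj (f a b z * (z * conj z))               ≈⟨ conj-cong (f[x]*xx̄≈Φ a b z) ⟩
          conj (Φa z)                                 ≈⟨ conj-Φ z ⟩
          Φ A b (conj z) z                            ∎

        VW̄≈WV̄ : V * W̄ ≈ W * V̄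
        VW̄≈WV̄ = +≈0⇒≈ (xy≈0⇒y≈0
          (*-nonZero (*-nonZero x≉0 (conj-nonZero x≉0)) (*-nonZero y≉0 (conj-nonZero y≉0))) (begin
            x * x̄ * (y * ȳ) * (V * W̄ + W * V̄)
              ≈⟨ solve 6 (λ xx yy V V̄ W W̄ → xx :* yy :* (V :* W̄ :+ W :* V̄) :=
                   V :* xx :* (W̄ :* yy) :+ V̄ :* xx :* (W :* yy)) refl (x * x̄) (y * ȳ) V V̄ W W̄ ⟩
            V * (x * x̄) * (W̄ * (y * ȳ)) + V̄ * (x * x̄) * (W * (y * ȳ))
              ≈⟨ +-cong (*-cong (f[x]*xx̄≈Φ a b x) (fΦ̄ y)) (*-cong (fΦ̄ x) (f[x]*xx̄≈Φ a b y)) ⟩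
            Φa x * Φ A b ȳ y + Φ A b x̄ x * Φa y
              ≈⟨ cross-Φ x y ⟩
            (x * ȳ + x̄ * y) * Ha x y
              ≈⟨ trans (*-congˡ H≈0) (zeroʳ _) ⟩
            0# ∎))

        WW̄-real : conj (W * W̄) ≈ W * W̄
        WW̄-real = trans (conj-* _ _) (trans (*-congˡ (conj-conj W)) (*-comm _ _))

        VW̄-real : conj (V * W̄) ≈ V * W̄
        VW̄-real = trans (conj-* _ _) (trans (*-congˡ (conj-conj W)) (trans (*-comm _ _) (sym VW̄≈WV̄)))

        WW̄x≈VW̄y : W * W̄ * x ≈ V * W̄ * y
        WW̄x≈VW̄y = f-inj (begin
          f a b (W * W̄ * x)  ≈⟨ f-scale WW̄-real (*-nonZero W≉0 W̄≉0) x≉0 ⟩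
          W * W̄ * V          ≈⟨ solve 3 (λ W W̄ V → W :* W̄ :* V := V :* W̄ :* W) refl W W̄ V ⟩
          V * W̄ * W          ≈⟨ f-scale VW̄-real (*-nonZero V≉0 W̄≉0) y≉0 ⟨
          f a b (V * W̄ * y)  ∎)

        Wx≈Vy : W * x ≈ V * y
        Wx≈Vy = *-cancelˡ-nonZero W̄≉0 (trans
          (solve 3 (λ W W̄ x → W̄ :* (W :* x) := W :* W̄ :* x) refl W W̄ x) (trans WW̄x≈VW̄y
          (solve 3 (λ V W̄ y → V :* W̄ :* y := W̄ :* (V :* y)) refl V W̄ y)))

      -- Because Φ = x T + x̄ C, a common zero of T and C is a zero of f.
      injective⇒T≉0∨C≉0 : ∀ {x} → ¬ x ≈ 0# → Ta x ≈ 0# → ¬ Ca x ≈ 0#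
      injective⇒T≉0∨C≉0 {x} x≉0 T≈0 C≈0 = *-nonZero (injective⇒f≉0 x≉0) (*-nonZero x≉0 (conj-nonZero x≉0))
        (trans (f[x]*xx̄≈Φ a b x) (linear₂ T≈0 C≈0 (solve 5 (λ a A b x x̄ → :F.Φ a b x x̄ :=
          :0 :+ x :* (:F.T a A b x x̄ :+ :0) :+ x̄ :* (:F.C a A b x x̄ :+ :0)) refl a A b x (conj x))))

    -- Conversely x C = ā Φ + b Φ̄, so a zero of f is a zero of C, and then of T by Φ = x T + x̄ C.
    T≉0∨C≉0⇒f≉0 : (∀ {x} → ¬ x ≈ 0# → Ta x ≈ 0# → ¬ Ca x ≈ 0#) →
                  ∀ {x} → ¬ x ≈ 0# → ¬ f a b x ≈ 0#
    T≉0∨C≉0⇒f≉0 T≉0∨C≉0 {x} x≉0 fx≈0 = T≉0∨C≉0 x≉0 T≈0 C≈0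
      where
      Φ≈0 : Φa x ≈ 0#
      Φ≈0 = trans (sym (f[x]*xx̄≈Φ a b x)) (trans (*-congʳ fx≈0) (zeroˡ _))
      Φ̄≈0 : Φ A b (conj x) x ≈ 0#
      Φ̄≈0 = trans (sym (conj-Φ x)) (trans (conj-cong Φ≈0) conj-0)
      C≈0 : Ca x ≈ 0#
      C≈0 = xy≈0⇒y≈0 x≉0 (linear₂ Φ≈0 Φ̄≈0 (solve 5 (λ a A b x x̄ → x :* :F.C a A b x x̄ :=
        :0 :+ A :* (:F.Φ a b x x̄ :+ :0) :+ b :* (:F.Φ A b x̄ x :+ :0)) refl a A b x (conj x)))
      T≈0 : Ta x ≈ 0#
      T≈0 = xy≈0⇒y≈0 x≉0 (linear₂ Φ≈0 C≈0 (solve 5 (λ a A b x x̄ → x :* :F.T a A b x x̄ :=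
        :0 :+ :1 :* (:F.Φ a b x x̄ :+ :0) :+ x̄ :* (:F.C a A b x x̄ :+ :0)) refl a A b x (conj x)))

    norm-real : ∀ x → conj (x * conj x) ≈ x * conj x
    norm-real x = trans (conj-* _ _) (trans (*-congˡ (conj-conj x)) (*-comm _ _))

    -- Equal values force y = r x with r in 𝔽_q. Then Φ scales by r³ and the norm by r², so f scales
    -- by r and r = 1.
    no-collision⇒injective-nonZero :
      (∀ {x} → ¬ x ≈ 0# → Ta x ≈ 0# → ¬ Ca x ≈ 0#) →
      (∀ {x y} → ¬ x ≈ 0# → ¬ y ≈ 0# → Ha x y ≈ 0# → x * conj y ≈ conj x * y) →
      ∀ {x y} → ¬ x ≈ 0# → ¬ y ≈ 0# → f a b x ≈ f a b y → x ≈ y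
    no-collision⇒injective-nonZero T≉0∨C≉0 no-collision {x} {y} x≉0 y≉0 fx≈fy = sym (*-cancelˡ-nonZero
      (*-nonZero (*-nonZero (*-nonZero Φ≉0 x≉0) (conj-nonZero x≉0)) y≉0)
      (linear₃ Φ-cross Φ-cubic xȳ≈x̄y
        (solve 6 (λ Φx Φy x x̄ y ȳ → Φy :* x :* x̄ :* y :* y := Φy :* x :* x̄ :* y :* x
          :+ (y :* y) :* (Φx :* (y :* ȳ) :+ Φy :* (x :* x̄))
          :+ ȳ :* (Φx :* (y :* y :* y) :+ Φy :* (x :* x :* x))
          :+ (Φy :* x :* x) :* (x :* ȳ :+ x̄ :* y)) refl (Φa x) (Φa y) x x̄ y ȳ)))
      where
      x̄ = conj x
      ȳ = conj y

      Φ≉0 : ¬ Φa y ≈ 0#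
      Φ≉0 Φ≈0 = *-nonZero (T≉0∨C≉0⇒f≉0 T≉0∨C≉0 y≉0) (*-nonZero y≉0 (conj-nonZero y≉0))
        (trans (f[x]*xx̄≈Φ a b y) Φ≈0)

      Φ-cross : Φa x * (y * ȳ) ≈ Φa y * (x * x̄)
      Φ-cross = begin
        Φa x * (y * ȳ)                ≈⟨ *-congʳ (f[x]*xx̄≈Φ a b x) ⟨
        f a b x * (x * x̄) * (y * ȳ)   ≈⟨ *-congʳ (*-congʳ fx≈fy) ⟩
        f a b y * (x * x̄) * (y * ȳ)   ≈⟨ solve 3 (λ v s t → v :* s :* t := v :* t :* s) refl _ _ _ ⟩
        f a b y * (y * ȳ) * (x * x̄)   ≈⟨ *-congʳ (f[x]*xx̄≈Φ a b y) ⟩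
        Φa y * (x * x̄)                ∎

      Φ̄-cross : Φ A b x̄ x * (y * ȳ) ≈ Φ A b ȳ y * (x * x̄)
      Φ̄-cross = begin
        Φ A b x̄ x * (y * ȳ)       ≈⟨ *-cong (conj-Φ x) (norm-real y) ⟨
        conj (Φa x) * conj (y * ȳ) ≈⟨ conj-* _ _ ⟨
        conj (Φa x * (y * ȳ))      ≈⟨ conj-cong Φ-cross ⟩
        conj (Φa y * (x * x̄))      ≈⟨ conj-* _ _ ⟩
        conj (Φa y) * conj (x * x̄) ≈⟨ *-cong (conj-Φ y) (norm-real x) ⟩
        Φ A b ȳ y * (x * x̄)        ∎

      crossed≈0 : Φa x * Φ A b ȳ y + Φ A b x̄ x * Φa y ≈ 0#
      crossed≈0 = xy≈0⇒y≈0 (*-nonZero x≉0 (conj-nonZero x≉0)) (begin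
        x * x̄ * (Φa x * Φ A b ȳ y + Φ A b x̄ x * Φa y)
          ≈⟨ solve 5 (λ s p p̄ r r̄ → s :* (p :* r̄ :+ p̄ :* r) := p :* (r̄ :* s) :+ p̄ :* (r :* s)) refl
               (x * x̄) (Φa x) (Φ A b x̄ x) (Φa y) (Φ A b ȳ y) ⟩
        Φa x * (Φ A b ȳ y * (x * x̄)) + Φ A b x̄ x * (Φa y * (x * x̄))
          ≈⟨ +-cong (*-congˡ (sym Φ̄-cross)) (*-congˡ (sym Φ-cross)) ⟩
        Φa x * (Φ A b x̄ x * (y * ȳ)) + Φ A b x̄ x * (Φa x * (y * ȳ))
          ≈⟨ solve 3 (λ t p p̄ → p :* (p̄ :* t) :+ p̄ :* (p :* t) := :0) refl (y * ȳ) (Φa x) (Φ A b x̄ x) ⟩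
        0# ∎)

      xȳ≈x̄y : x * ȳ ≈ x̄ * y
      xȳ≈x̄y = [ +≈0⇒≈ , no-collision x≉0 y≉0 ]′ (xy≈0⇒x≈0∨y≈0 (trans (sym (cross-Φ x y)) crossed≈0))

      Φ-cubic : Φa x * (y * y * y) ≈ Φa y * (x * x * x)
      Φ-cubic = linear₁ xȳ≈x̄y (solve 6 (λ a b x x̄ y ȳ →
        :F.Φ a b x x̄ :* (y :* y :* y) := :F.Φ a b y ȳ :* (x :* x :* x) :+
          (x :* x :* y :* y :+ b :* (x̄ :* x̄ :* y :* y :+ x :* x̄ :* y :* ȳ :+ x :* x :* ȳ :* ȳ))
            :* (x :* ȳ :+ x̄ :* y)) refl a b x x̄ y ȳ)

    no-collision⇒injective :
      (∀ {x} → ¬ x ≈ 0# → Ta x ≈ 0# → ¬ Ca x ≈ 0#) →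
      (∀ {x y} → ¬ x ≈ 0# → ¬ y ≈ 0# → Ha x y ≈ 0# → x * conj y ≈ conj x * y) →
      Injective _≈_ _≈_ (f a b)
    no-collision⇒injective T≉0∨C≉0 no-collision {x} {y} fx≈fy with x ≟ 0# | y ≟ 0#
    ... | yes x≈0 | yes y≈0 = trans x≈0 (sym y≈0)
    ... | yes x≈0 | no y≉0 = contradiction
      (trans (sym fx≈fy) (trans (f-cong a b x≈0) (f-0 a b))) (T≉0∨C≉0⇒f≉0 T≉0∨C≉0 y≉0)
    ... | no x≉0 | yes y≈0 = contradiction
      (trans fx≈fy (trans (f-cong a b y≈0) (f-0 a b))) (T≉0∨C≉0⇒f≉0 T≉0∨C≉0 x≉0)
    ... | no x≉0 | no y≉0 = no-collision⇒injective-nonZero T≉0∨C≉0 no-collision x≉0 y≉0 fx≈fy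

  y[x/y]≈x : ∀ {x y} → ¬ y ≈ 0# → y * (x / y) ≈ x
  y[x/y]≈x {x} {y} y≉0 = linear₁ (inverseʳ y y≉0)
    (solve 3 (λ x y i → y :* (x :* i) := x :+ x :* (y :* i :+ :1)) refl x y (y ⁻¹))

  real-quotient : ∀ {r g h} → ¬ r ≈ 0# → conj r ≈ r → conj h ≈ h → r * g ≈ h → conj g ≈ g
  real-quotient {r} {g} {h} r≉0 r-real h-real rg≈h = *-cancelˡ-nonZero r≉0 (begin
    r * conj g       ≈⟨ *-congʳ r-real ⟨
    conj r * conj g  ≈⟨ conj-* r g ⟨
    conj (r * g)     ≈⟨ conj-cong rg≈h ⟩
    conj h           ≈⟨ h-real ⟩
    h                ≈⟨ rg≈h ⟨
    r * g            ∎)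

  module _ {a b : Carrier} (b-real : conj b ≈ b) where
    open Collisions a b b-real

    -- For w = Cȳ/(Ty), dividing the form by T yȳ leaves w + 1 + w̄ = 0, while w w̄ = C C̄/T².
    collision⇒preimage : ∀ {x y} → ¬ y ≈ 0# → ¬ Ta x ≈ 0# → Ha x y ≈ 0# →
      ∃ λ w → conj w ≈ w + 1# × ℘ w * (Ta x * Ta x) ≈ Ca x * C̄a x
    collision⇒preimage {x} {y} y≉0 T≉0 H≈0 = w , w̄≈w+1 , ℘w
      where
      ȳ = conj y
      t = Ta x
      w = (Ca x * ȳ) / (t * y)
      ȳ≉0 = conj-nonZero y≉0

      tyw≈ : t * y * w ≈ Ca x * ȳ
      tyw≈ = y[x/y]≈x (*-nonZero T≉0 y≉0)

      tȳw̄≈ : t * ȳ * conj w ≈ C̄a x * y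
      tȳw̄≈ = begin
        t * ȳ * conj w         ≈⟨ *-congʳ (*-congʳ (conj-T x)) ⟨
        conj t * ȳ * conj w    ≈⟨ *-congʳ (conj-* t y) ⟨
        conj (t * y) * conj w  ≈⟨ conj-* (t * y) w ⟨
        conj (t * y * w)       ≈⟨ conj-cong tyw≈ ⟩
        conj (Ca x * ȳ)        ≈⟨ conj-* (Ca x) ȳ ⟩
        conj (Ca x) * conj ȳ   ≈⟨ *-cong (conj-C x) (conj-conj y) ⟩
        C̄a x * y               ∎

      w̄≈w+1 : conj w ≈ w + 1#
      w̄≈w+1 = *-cancelˡ-nonZero (*-nonZero T≉0 (*-nonZero y≉0 ȳ≉0)) (linear₃ tyw≈ tȳw̄≈ H≈0
        (solve 7 (λ t c c̄ y ȳ w w̄ → t :* (y :* ȳ) :* w̄ := t :* (y :* ȳ) :* (w :+ :1)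
          :+ ȳ :* (t :* y :* w :+ c :* ȳ) :+ y :* (t :* ȳ :* w̄ :+ c̄ :* y)
          :+ :1 :* (c :* ȳ :* ȳ :+ t :* y :* ȳ :+ c̄ :* y :* y :+ :0))
          refl t (Ca x) (C̄a x) y ȳ w (conj w)))

      ℘w : ℘ w * (t * t) ≈ Ca x * C̄a x
      ℘w = *-cancelˡ-nonZero (*-nonZero y≉0 y≉0) (linear₂ tyw≈ H≈0
        (solve 6 (λ t c c̄ y ȳ w → y :* y :* ((w :* w :+ w) :* (t :* t)) := y :* y :* (c :* c̄)
          :+ (t :* y :* w :+ c :* ȳ :+ t :* y) :* (t :* y :* w :+ c :* ȳ)
          :+ c :* (c :* ȳ :* ȳ :+ t :* y :* ȳ :+ c̄ :* y :* y :+ :0))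
          refl t (Ca x) (C̄a x) y ȳ w))

  -- Sufficiency of the two conditions

  module CaseBIs1 {a b : Carrier} (a≉0 : ¬ a ≈ 0#) (b-real : conj b ≈ b) (b≈1 : b ≈ 1#)
                  (a-real : conj a ≈ a) where
    open Collisions a b b-real

    s : Carrier → Carrier
    s x = x * x + conj x * conj x + a * x * conj x

    s-real : ∀ x → conj (s x) ≈ s x
    s-real x = trans (conj-⟦⟧ (var 0F :* var 0F :+ var 1F :* var 1F :+ var 2F :* var 0F :* var 1F)
      (refl ∷ conj-conj x ∷ a-real ∷ []))
      (solve 3 (λ a x x̄ → x̄ :* x̄ :+ x :* x :+ a :* x̄ :* x := x :* x :+ x̄ :* x̄ :+ a :* x :* x̄)
        refl a x (conj x))

    T≈ : ∀ x → Ta x ≈ a * s x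
    T≈ x = linear₂ a-real b≈1 (solve 5 (λ a A b x x̄ → :F.T a A b x x̄ :=
      a :* (x :* x :+ x̄ :* x̄ :+ a :* x :* x̄) :+ (x̄ :* x̄ :+ a :* x :* x̄) :* (A :+ a)
      :+ ((b :+ :1) :* x :* x̄) :* (b :+ :1)) refl a A b x (conj x))

    C≈ : ∀ x → Ca x ≈ s x + a * a * (x * x)
    C≈ x = linear₂ a-real b≈1 (solve 5 (λ a A b x x̄ → :F.C a A b x x̄ :=
      x :* x :+ x̄ :* x̄ :+ a :* x :* x̄ :+ a :* a :* (x :* x) :+ (x :* x̄ :+ a :* x :* x) :* (A :+ a)
      :+ (x̄ :* x̄ :+ (b :+ :1) :* x :* x) :* (b :+ :1)) refl a A b x (conj x))

    C̄≈ : ∀ x → C̄a x ≈ s x + a * a * (conj x * conj x)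
    C̄≈ x = linear₂ a-real b≈1 (solve 5 (λ a A b x x̄ → :F.C A a b x̄ x :=
      x :* x :+ x̄ :* x̄ :+ a :* x :* x̄ :+ a :* a :* (x̄ :* x̄) :+ (a :* x̄ :* x̄) :* (A :+ a)
      :+ (x :* x :+ (b :+ :1) :* x̄ :* x̄) :* (b :+ :1)) refl a A b x (conj x))

    T≈0⇒s≈0 : ∀ {x} → Ta x ≈ 0# → s x ≈ 0#
    T≈0⇒s≈0 {x} T≈0 = xy≈0⇒y≈0 a≉0 (trans (sym (T≈ x)) T≈0)

    T≉0∨C≉0 : ∀ {x} → ¬ x ≈ 0# → Ta x ≈ 0# → ¬ Ca x ≈ 0#
    T≉0∨C≉0 {x} x≉0 T≈0 C≈0 = *-nonZero (*-nonZero a≉0 a≉0) (*-nonZero x≉0 x≉0) (begin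
      a * a * (x * x)        ≈⟨ +-identityˡ _ ⟨
      0# + a * a * (x * x)   ≈⟨ +-congʳ (T≈0⇒s≈0 T≈0) ⟨
      s x + a * a * (x * x)  ≈⟨ C≈ x ⟨
      Ca x                   ≈⟨ C≈0 ⟩
      0#                     ∎)

    -- With s = 0 the coefficient C reduces to a² x², so the form in y is a² (xȳ + x̄y)².
    collision-T≈0 : ∀ {x y} → Ta x ≈ 0# → Ha x y ≈ 0# → x * conj y ≈ conj x * y
    collision-T≈0 {x} {y} T≈0 H≈0 = x*x≈y*y⇒x≈y (*-cancelˡ-nonZero (*-nonZero a≉0 a≉0) (begin
      a * a * (x * ȳ * (x * ȳ))
        ≈⟨ linear₁ s≈0 (solve 5 (λ a s x x̄ ȳ → a :* a :* (x :* ȳ :* (x :* ȳ)) :=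
             (s :+ a :* a :* (x :* x)) :* ȳ :* ȳ :+ (ȳ :* ȳ) :* (s :+ :0)) refl a (s x) x x̄ ȳ) ⟩
      (s x + a * a * (x * x)) * ȳ * ȳ
        ≈⟨ *-congʳ (*-congʳ (C≈ x)) ⟨
      Ca x * ȳ * ȳ
        ≈⟨ linear₂ T≈0 H≈0 (solve 5 (λ c t c̄ y ȳ → c :* ȳ :* ȳ := c̄ :* y :* y
             :+ (y :* ȳ) :* (t :+ :0) :+ :1 :* (c :* ȳ :* ȳ :+ t :* y :* ȳ :+ c̄ :* y :* y :+ :0))
             refl (Ca x) (Ta x) (C̄a x) y ȳ) ⟩
      C̄a x * y * y
        ≈⟨ *-congʳ (*-congʳ (C̄≈ x)) ⟩
      (s x + a * a * (x̄ * x̄)) * y * y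
        ≈⟨ linear₁ s≈0 (solve 5 (λ a s x x̄ y → (s :+ a :* a :* (x̄ :* x̄)) :* y :* y :=
             a :* a :* (x̄ :* y :* (x̄ :* y)) :+ (y :* y) :* (s :+ :0)) refl a (s x) x x̄ y) ⟩
      a * a * (x̄ * y * (x̄ * y)) ∎))
      where
      x̄ = conj x
      ȳ = conj y
      s≈0 = T≈0⇒s≈0 T≈0

    -- Since x² + x̄² = s + a m, the quotient C C̄/T² equals 1 + a⁻² + ℘ (a m/s). Adding the
    -- elements g = a m/s and a⁻¹ of 𝔽_q to w leaves w̄ = w + 1 intact and brings the quotient to 1
    -- + a⁻¹.
    preimage⇒Tr≈1 : ∀ {x w} → ¬ Ta x ≈ 0# → conj w ≈ w + 1# → ℘ w * (Ta x * Ta x) ≈ Ca x * C̄a x →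
                    Tr k (1# + a ⁻¹) ≈ 1#
    preimage⇒Tr≈1 {x} {w} T≉0 w̄≈w+1 ℘w =
      trans (Tr-cong k (sym ℘w₁≈)) (Tr-℘-shifted w̄₁≈)
      where
      m = x * conj x
      g = (a * m) / s x
      i = a ⁻¹
      w₁ = w + g + i

      s≉0 : ¬ s x ≈ 0#
      s≉0 s≈0 = T≉0 (trans (T≈ x) (trans (*-congˡ s≈0) (zeroʳ a)))

      sg≈am : s x * g ≈ a * m
      sg≈am = y[x/y]≈x s≉0

      ai≈1 : a * i ≈ 1#
      ai≈1 = inverseʳ a a≉0

      g-real : conj g ≈ g
      g-real = real-quotient s≉0 (s-real x) (trans (conj-* a m) (*-cong a-real (norm-real x))) sg≈am

      i-real : conj i ≈ i
      i-real = real-quotient a≉0 a-real conj-1 ai≈1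

      w̄₁≈ : conj w₁ ≈ w₁ + 1#
      w̄₁≈ = begin
        conj (w + g + i)            ≈⟨ trans (conj-+ _ _) (+-congʳ (conj-+ _ _)) ⟩
        conj w + conj g + conj i    ≈⟨ +-cong (+-cong w̄≈w+1 g-real) i-real ⟩
        w + 1# + g + i              ≈⟨ solve 3 (λ w g i → w :+ :1 :+ g :+ i := w :+ g :+ i :+ :1) refl w g i ⟩
        w + g + i + 1#              ∎

      ℘w′ : ℘ w * (a * s x * (a * s x)) ≈ (s x + a * a * (x * x)) * (s x + a * a * (conj x * conj x))
      ℘w′ = begin
        ℘ w * (a * s x * (a * s x))   ≈⟨ *-congˡ (*-cong (T≈ x) (T≈ x)) ⟨
        ℘ w * (Ta x * Ta x)           ≈⟨ ℘w ⟩
        Ca x * C̄a x                   ≈⟨ *-cong (C≈ x) (C̄≈ x) ⟩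
        (s x + a * a * (x * x)) * (s x + a * a * (conj x * conj x)) ∎

      ℘w₁≈ : ℘ w₁ ≈ 1# + i
      ℘w₁≈ = *-cancelˡ-nonZero (*-nonZero (*-nonZero a≉0 s≉0) (*-nonZero a≉0 s≉0)) (begin
        a * s x * (a * s x) * ℘ w₁
          ≈⟨ solve 5 (λ a s w g i → a :* s :* (a :* s) :* ((w :+ g :+ i) :* (w :+ g :+ i) :+ (w :+ g :+ i)) :=
              (w :* w :+ w) :* (a :* s :* (a :* s))
              :+ (a :* a :* (s :* g) :* (s :* g) :+ a :* a :* s :* (s :* g))
              :+ (a :* i :* (a :* i) :* s :* s :+ a :* (a :* i) :* s :* s)) refl a (s x) w g i ⟩
        ℘ w * (a * s x * (a * s x))
          + (a * a * (s x * g) * (s x * g) + a * a * s x * (s x * g))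
          + (a * i * (a * i) * s x * s x + a * (a * i) * s x * s x)
          ≈⟨ +-cong (+-cong ℘w′ (+-cong (*-cong (*-congˡ sg≈am) sg≈am) (*-congˡ sg≈am)))
              (+-cong (*-congʳ (*-congʳ (*-cong ai≈1 ai≈1))) (*-congʳ (*-congʳ (*-congˡ ai≈1)))) ⟩
        (s x + a * a * (x * x)) * (s x + a * a * (conj x * conj x))
          + (a * a * (a * m) * (a * m) + a * a * s x * (a * m))
          + (1# * 1# * s x * s x + a * 1# * s x * s x)
          ≈⟨ solve 3 (λ a x x̄ → let s = x :* x :+ x̄ :* x̄ :+ a :* x :* x̄ ; m = x :* x̄ in
               (s :+ a :* a :* (x :* x)) :* (s :+ a :* a :* (x̄ :* x̄))
               :+ (a :* a :* (a :* m) :* (a :* m) :+ a :* a :* s :* (a :* m))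
               :+ (:1 :* :1 :* s :* s :+ a :* :1 :* s :* s) :=
                     a :* s :* (a :* s) :+ a :* s :* s) refl a x (conj x) ⟩
        a * s x * (a * s x) + a * s x * s x
          ≈⟨ linear₁ ai≈1 (solve 3 (λ a i s → a :* s :* (a :* s) :+ a :* s :* s :=
               a :* s :* (a :* s) :* (:1 :+ i) :+ (a :* s :* s) :* (a :* i :+ :1)) refl a i (s x)) ⟩
        a * s x * (a * s x) * (1# + i) ∎)

    injective : Tr k (1# + a ⁻¹) ≈ 0# → Injective _≈_ _≈_ (f a b)
    injective Tr≈0 = no-collision⇒injective T≉0∨C≉0 λ {x} x≉0 y≉0 H≈0 → proportional x y≉0 H≈0
      where
      proportional : ∀ x {y} → ¬ y ≈ 0# → Ha x y ≈ 0# → x * conj y ≈ conj x * y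
      proportional x y≉0 H≈0 = case Ta x ≟ 0# of λ where
        (yes T≈0) → collision-T≈0 T≈0 H≈0
        (no T≉0) → let w , w̄≈w+1 , ℘w = collision⇒preimage b-real y≉0 T≉0 H≈0 in
          contradiction (trans (sym Tr≈0) (preimage⇒Tr≈1 T≉0 w̄≈w+1 ℘w)) 0≉1

  module RealA {a b : Carrier} (b-real : conj b ≈ b) (a-real : conj a ≈ a) (aa≈ : a * a ≈ b * (b + 1#)) where
    open Collisions a b b-real

    n : Carrier → Carrier
    n x = x * x + conj x * conj x

    T≈ : ∀ x → Ta x ≈ a * n x + (b + 1#) * (x * conj x)
    T≈ x = linear₂ a-real aa≈ (solve 5 (λ a A b x x̄ → :F.T a A b x x̄ :=
      a :* (x :* x :+ x̄ :* x̄) :+ (b :+ :1) :* (x :* x̄) :+ (x̄ :* x̄ :+ a :* x :* x̄) :* (A :+ a)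
      :+ (x :* x̄) :* (a :* a :+ b :* (b :+ :1))) refl a A b x (conj x))

    C≈ : ∀ x → Ca x ≈ b * n x + a * (x * conj x)
    C≈ x = linear₂ a-real aa≈ (solve 5 (λ a A b x x̄ → :F.C a A b x x̄ :=
      b :* (x :* x :+ x̄ :* x̄) :+ a :* (x :* x̄) :+ (x :* x̄ :+ a :* x :* x) :* (A :+ a)
      :+ (x :* x) :* (a :* a :+ b :* (b :+ :1))) refl a A b x (conj x))

    C̄≈ : ∀ x → C̄a x ≈ b * n x + a * (x * conj x)
    C̄≈ x = linear₂ a-real aa≈ (solve 5 (λ a A b x x̄ → :F.C A a b x̄ x :=
      b :* (x :* x :+ x̄ :* x̄) :+ a :* (x :* x̄) :+ (a :* x̄ :* x̄) :* (A :+ a)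
      :+ (x̄ :* x̄) :* (a :* a :+ b :* (b :+ :1))) refl a A b x (conj x))

    -- C and T are both real here, and either side equals b (b+1) (b n² + (b+1) m²). When b differs
    -- from 1 and T from 0, C C̄/T² is therefore the constant b/(b+1).
    [b+1]CC̄≈bTT : ∀ x → (b + 1#) * (Ca x * C̄a x) ≈ b * (Ta x * Ta x)
    [b+1]CC̄≈bTT x = begin
      (b + 1#) * (Ca x * C̄a x)
        ≈⟨ *-congˡ (*-cong (C≈ x) (C̄≈ x)) ⟩
      (b + 1#) * ((b * n x + a * m) * (b * n x + a * m))
        ≈⟨ linear₁ aa≈ (solve 4 (λ a b n m → (b :+ :1) :* ((b :* n :+ a :* m) :* (b :* n :+ a :* m)) :=
             b :* ((a :* n :+ (b :+ :1) :* m) :* (a :* n :+ (b :+ :1) :* m))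
             :+ (b :* n :* n :+ (b :+ :1) :* m :* m) :* (a :* a :+ b :* (b :+ :1))) refl a b (n x) m) ⟩
      b * ((a * n x + (b + 1#) * m) * (a * n x + (b + 1#) * m))
        ≈⟨ *-congˡ (*-cong (T≈ x) (T≈ x)) ⟨
      b * (Ta x * Ta x) ∎
      where m = x * conj x

  module CaseBIsNot1 {a b : Carrier} (b-real : conj b ≈ b) (b≉1 : ¬ b ≈ 1#)
                     (Tr≈0 : Tr k (b / (b + 1#)) ≈ 0#) (aa≈ : a * a ≈ b * (b + 1#)) where
    open Collisions a b b-real

    b+1≉0 : ¬ b + 1# ≈ 0#
    b+1≉0 = b≉1 ∘ +≈0⇒≈

    a-real : conj a ≈ a
    a-real = x*x≈y*y⇒x≈y (begin
      conj a * conj a    ≈⟨ conj-* a a ⟨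
      conj (a * a)       ≈⟨ conj-cong aa≈ ⟩
      conj (b * (b + 1#)) ≈⟨ conj-⟦⟧ (var 0F :* (var 0F :+ :1)) (b-real ∷ []) ⟩
      b * (b + 1#)       ≈⟨ aa≈ ⟨
      a * a              ∎)

    no-shifted-preimage : ∀ {w} → conj w ≈ w + 1# → ¬ (b + 1#) * ℘ w ≈ b
    no-shifted-preimage {w} w̄≈w+1 eq = 0≉1 (begin
      0#                 ≈⟨ Tr≈0 ⟨
      Tr k (b / (b + 1#)) ≈⟨ Tr-cong k (*-cancelˡ-nonZero b+1≉0 (trans (y[x/y]≈x b+1≉0) (sym eq))) ⟩
      Tr k (℘ w)         ≈⟨ Tr-℘-shifted w̄≈w+1 ⟩
      1#                 ∎)

    open RealA b-real a-real aa≈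

    -- At a zero of T, w = x̄²/(x² + x̄²) satisfies w̄ = w + 1 and ℘ w = m²/n² = a²/(b+1)² =
    -- b/(b+1), which would give the trace of b/(b+1) the value 1.
    T≉0 : ∀ {x} → ¬ x ≈ 0# → ¬ Ta x ≈ 0#
    T≉0 {x} x≉0 T≈0 = no-shifted-preimage w̄≈w+1 eq
      where
      x̄ = conj x
      m = x * x̄
      m≉0 : ¬ m ≈ 0#
      m≉0 = *-nonZero x≉0 (conj-nonZero x≉0)

      an≈ : a * n x ≈ (b + 1#) * m
      an≈ = +≈0⇒≈ (trans (sym (T≈ x)) T≈0)

      n≉0 : ¬ n x ≈ 0#
      n≉0 n≈0 = *-nonZero b+1≉0 m≉0 (trans (sym an≈) (trans (*-congˡ n≈0) (zeroʳ a)))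

      n-real : conj (n x) ≈ n x
      n-real = trans (conj-⟦⟧ (var 0F :* var 0F :+ var 1F :* var 1F) (refl ∷ conj-conj x ∷ [])) (+-comm _ _)

      w = (x̄ * x̄) / n x

      nw≈ : n x * w ≈ x̄ * x̄
      nw≈ = y[x/y]≈x n≉0

      nw̄≈ : n x * conj w ≈ x * x
      nw̄≈ = begin
        n x * conj w         ≈⟨ *-congʳ n-real ⟨
        conj (n x) * conj w  ≈⟨ conj-* (n x) w ⟨
        conj (n x * w)       ≈⟨ conj-cong nw≈ ⟩
        conj (x̄ * x̄)         ≈⟨ conj-* x̄ x̄ ⟩
        conj x̄ * conj x̄      ≈⟨ *-cong (conj-conj x) (conj-conj x) ⟩
        x * x                ∎

      w̄≈w+1 : conj w ≈ w + 1#
      w̄≈w+1 = *-cancelˡ-nonZero n≉0 (begin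
        n x * conj w           ≈⟨ nw̄≈ ⟩
        x * x                  ≈⟨ solve 2 (λ x x̄ → x :* x := x̄ :* x̄ :+ (x :* x :+ x̄ :* x̄)) refl x x̄ ⟩
        x̄ * x̄ + n x            ≈⟨ +-cong (sym nw≈) (sym (*-identityʳ _)) ⟩
        n x * w + n x * 1#     ≈⟨ distribˡ _ _ _ ⟨
        n x * (w + 1#)         ∎)

      nn℘w≈ : n x * n x * ℘ w ≈ m * m
      nn℘w≈ = begin
        n x * n x * (w * w + w)                ≈⟨ solve 2 (λ n w → n :* n :* (w :* w :+ w) :=
              n :* w :* (n :* w) :+ n :* (n :* w)) refl (n x) w ⟩
        n x * w * (n x * w) + n x * (n x * w)  ≈⟨ +-cong (*-cong nw≈ nw≈) (*-congˡ nw≈) ⟩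
        x̄ * x̄ * (x̄ * x̄) + n x * (x̄ * x̄)
          ≈⟨ solve 2 (λ x x̄ → x̄ :* x̄ :* (x̄ :* x̄) :+ (x :* x :+ x̄ :* x̄) :* (x̄ :* x̄) :=
                x :* x̄ :* (x :* x̄)) refl x x̄ ⟩
        m * m                                  ∎

      eq : (b + 1#) * ℘ w ≈ b
      eq = *-cancelˡ-nonZero (*-nonZero b+1≉0 (*-nonZero m≉0 m≉0)) (linear₃ an≈ nn℘w≈ aa≈
        (solve 5 (λ a b n m p →
          (b :+ :1) :* (m :* m) :* ((b :+ :1) :* p) := (b :+ :1) :* (m :* m) :* b
          :+ (p :* (a :* n :+ (b :+ :1) :* m)) :* (a :* n :+ (b :+ :1) :* m)
          :+ (a :* a) :* (n :* n :* p :+ m :* m)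
          :+ (m :* m) :* (a :* a :+ b :* (b :+ :1))) refl a b (n x) m (℘ w)))

    preimage-of-b/[b+1] : ∀ {x w} → ¬ x ≈ 0# → ℘ w * (Ta x * Ta x) ≈ Ca x * C̄a x → (b + 1#) * ℘ w ≈ b
    preimage-of-b/[b+1] {x} {w} x≉0 ℘w = (*-cancelˡ-nonZero (*-nonZero (T≉0 x≉0) (T≉0 x≉0)) (begin
        t * t * ((b + 1#) * ℘ w)      ≈⟨ solve 3 (λ t b p → t :* t :* ((b :+ :1) :* p) :=
              (b :+ :1) :* (p :* (t :* t))) refl t b (℘ w) ⟩
        (b + 1#) * (℘ w * (t * t))    ≈⟨ *-congˡ ℘w ⟩
        (b + 1#) * (Ca x * C̄a x)      ≈⟨ [b+1]CC̄≈bTT x ⟩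
        b * (t * t)                   ≈⟨ *-comm _ _ ⟩
        t * t * b                     ∎))
      where t = Ta x

    no-collision : ∀ {x y} → ¬ x ≈ 0# → ¬ y ≈ 0# → ¬ Ha x y ≈ 0#
    no-collision {x} {y} x≉0 y≉0 H≈0 =
      let w , w̄≈w+1 , ℘w = collision⇒preimage b-real y≉0 (T≉0 x≉0) H≈0
      in no-shifted-preimage w̄≈w+1 (preimage-of-b/[b+1] x≉0 ℘w)

    injective : Injective _≈_ _≈_ (f a b)
    injective = no-collision⇒injective (λ x≉0 T≈0 → contradiction T≈0 (T≉0 x≉0))
      λ x≉0 y≉0 H≈0 → contradiction H≈0 (no-collision x≉0 y≉0)

  -- Necessity: the relation e = g² and its solutions

  Tr-0 : Tr k 0# ≈ 0#
  Tr-0 = trans (Tr-cong k (solve 0 (:0 := :0 :* :0 :+ :0) refl)) (Tr-℘-real conj-0)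

  conj-√ : ∀ x → conj (√ x) * conj (√ x) ≈ conj x
  conj-√ x = trans (sym (conj-* _ _)) (conj-cong (√x*√x≈x x))

  -- With o = a/ā, these are the coefficient of y in (a X̄² + ā X²)/ρ and that of y² in X⁴ + X̄⁴,
  -- for the point X attached to y in `Point`.
  P Q : (o ō α β : Carrier) → Carrier
  P o ō α β = o * (β * β) + ō * (α * α)
  Q o ō α β = o * (β * β * (β * β)) + ō * (α * α * (α * α))

  -- The relation S⁴ e = g² divided by S². The coefficient a enters only through ν = aā and, inside
  -- p and q, through the phase o.
  Star : (b ν S p q : Carrier) → Set ℓ
  Star b ν S p q =
    S * S * (b * (ν * p + (1# + S) * q)) ≈ ν * (((1# + S) * S + b * p) * ((1# + S) * S + b * p))

  module StarEquation {α β b o ō : Carrier} (α-real : conj α ≈ α) (β-real : conj β ≈ β)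
    (ō≈ : conj o ≈ ō) (oō≈1 : o * ō ≈ 1#)
    (b≈ : b ≈ (1# + α) * (1# + β)) (b≉0 : ¬ b ≈ 0#) (αβ≉0 : ¬ α * β ≈ 0#) (α+β≉0 : ¬ α + β ≈ 0#)
    (star : Star b (α * β * (α * β)) ((α + β) * (α + β)) (P o ō α β) (Q o ō α β))
    where

    private
      σ = α + β
      S = σ * σ
      ν = α * β * (α * β)
      t = o + ō
      L = b + 1# + S
      p = P o ō α β
      p̄ = P ō o α β
      Q₁ = Q o ō α β
      Q̄₁ = Q ō o α β

    S≉0 : ¬ S ≈ 0#
    S≉0 = *-nonZero α+β≉0 α+β≉0

    ν≉0 : ¬ ν ≈ 0#
    ν≉0 = *-nonZero αβ≉0 αβ≉0

    b-real : conj b ≈ b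
    b-real = trans (conj-cong b≈) (trans (conj-⟦⟧ ((:1 :+ var 0F) :* (:1
          :+ var 1F)) (α-real ∷ β-real ∷ [])) (sym b≈))

    bb≈ : b * b ≈ 1# + S + ν
    bb≈ = trans (*-cong b≈ b≈) (solve 2 (λ α β → (:1 :+ α) :* (:1 :+ β) :* ((:1 :+ α) :* (:1 :+ β)) :=
      :1 :+ (α :+ β) :* (α :+ β) :+ α :* β :* (α :* β)) refl α β)

    ō-conj : conj ō ≈ o
    ō-conj = trans (conj-cong (sym ō≈)) (conj-conj o)

    star̄ : Star b ν S p̄ Q̄₁
    star̄ = begin
      S * S * (b * (ν * p̄ + (1# + S) * Q̄₁))
        ≈⟨ conj-⟦⟧ lhs (α-real ∷ β-real ∷ b-real ∷ ō≈ ∷ ō-conj ∷ []) ⟨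
      conj (S * S * (b * (ν * p + (1# + S) * Q₁))) ≈⟨ conj-cong star ⟩
      conj (ν * (((1# + S) * S + b * p) * ((1# + S) * S + b * p)))
        ≈⟨ conj-⟦⟧ rhs (α-real ∷ β-real ∷ b-real ∷ ō≈ ∷ ō-conj ∷ []) ⟩
      ν * (((1# + S) * S + b * p̄) * ((1# + S) * S + b * p̄)) ∎
      where
      :α = var 0F
      :β = var 1F
      :b = var 2F
      :o = var 3F
      :ō = var 4F
      :S = (:α :+ :β) :* (:α :+ :β)
      :ν = :α :* :β :* (:α :* :β)
      :p = :o :* (:β :* :β) :+ :ō :* (:α :* :α)
      :Q = :o :* (:β :* :β :* (:β :* :β)) :+ :ō :* (:α :* :α :* (:α :* :α))
      lhs rhs : Polynomial 5
      lhs = :S :* :S :* (:b :* (:ν :* :p :+ (:1 :+ :S) :* :Q))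
      rhs = :ν :* (((:1 :+ :S) :* :S :+ :b :* :p) :* ((:1 :+ :S) :* :S :+ :b :* :p))

    p+p̄≈ : p + p̄ ≈ t * S
    p+p̄≈ = solve 4 (λ o ō α β → o :* (β :* β) :+ ō :* (α :* α) :+ (ō :* (β :* β) :+ o :* (α :* α)) :=
      (o :+ ō) :* ((α :+ β) :* (α :+ β))) refl o ō α β

    Q+Q̄≈ : Q₁ + Q̄₁ ≈ t * (S * S)
    Q+Q̄≈ = solve 4 (λ o ō α β → o :* (β :* β :* (β :* β)) :+ ō :* (α :* α :* (α :* α))
        :+ (ō :* (β :* β :* (β :* β)) :+ o :* (α :* α :* (α :* α))) :=
      (o :+ ō) :* ((α :+ β) :* (α :+ β) :* ((α :+ β) :* (α :+ β)))) refl o ō α β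

    LL≈ : L * L ≈ ν + (1# + S) * S
    LL≈ = linear₁ bb≈ (solve 3 (λ b S ν → (b :+ :1 :+ S) :* (b :+ :1 :+ S) := ν :+ (:1 :+ S) :* S
      :+ :1 :* (b :* b :+ (:1 :+ S :+ ν))) refl b S ν)

    -- Chosen so that ℘ g = (1 + α)(1 + β)/(α + β)² = b/S.
    g = (α + 1#) / σ

    σg≈ : σ * g ≈ α + 1#
    σg≈ = y[x/y]≈x α+β≉0

    g-real : conj g ≈ g
    g-real = real-quotient α+β≉0 (trans (conj-+ α β) (+-cong α-real β-real))
      (trans (conj-+ α 1#) (+-cong α-real conj-1)) σg≈

    -- 1/t would be ℘ w₀ with w₀ ∈ 𝔽_q, by partial fractions in S; but t ≈ o + ō with o ō ≈ 1 and o ∉ 𝔽_q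
    -- requires Tr (1/t) ≈ 1.
    module NonReal (t≉0 : ¬ t ≈ 0#) where
      summed : S * S * (b * (ν * (t * S) + (1# + S) * (t * (S * S)))) ≈ ν * (b * b * (t * S * (t * S)))
      summed = begin
        S * S * (b * (ν * (t * S) + (1# + S) * (t * (S * S))))
          ≈⟨ *-congˡ (*-congˡ (+-cong (*-congˡ p+p̄≈) (*-congˡ Q+Q̄≈))) ⟨
        S * S * (b * (ν * (p + p̄) + (1# + S) * (Q₁ + Q̄₁)))
          ≈⟨ linear₂ star star̄ (solve 7 (λ S b ν p p̄ Q Q̄ →
              S :* S :* (b :* (ν :* (p :+ p̄) :+ (:1 :+ S) :* (Q :+ Q̄))) :=
                    ν :* (b :* b :* ((p :+ p̄) :* (p :+ p̄)))
              :+ :1 :* (S :* S :* (b :* (ν :* p :+ (:1 :+ S) :* Q)) :+ ν :* (((:1 :+ S) :* S :+ b :* p) :* ((:1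
                    :+ S) :* S :+ b :* p)))
              :+ :1 :* (S :* S :* (b :* (ν :* p̄ :+ (:1 :+ S) :* Q̄)) :+ ν :* (((:1 :+ S) :* S
                    :+ b :* p̄) :* ((:1 :+ S) :* S :+ b :* p̄))))
              refl S b ν p p̄ Q₁ Q̄₁) ⟩
        ν * (b * b * ((p + p̄) * (p + p̄)))
          ≈⟨ *-congˡ (*-congˡ (*-cong p+p̄≈ p+p̄≈)) ⟩
        ν * (b * b * (t * S * (t * S))) ∎

      -- Conjugation fixes α, β and b and swaps o with ō. Squaring is additive, so the sum of `star`
      -- and its conjugate sees the phase only through t; dividing it by b t S² gives this formula
      -- for t.
      SLL≈νbt : S * (L * L) ≈ ν * b * t
      SLL≈νbt = *-cancelˡ-nonZero (*-nonZero (*-nonZero b≉0 t≉0) (*-nonZero S≉0 S≉0)) (begin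
        b * t * (S * S) * (S * (L * L))                ≈⟨ *-congˡ (*-congˡ LL≈) ⟩
        b * t * (S * S) * (S * (ν + (1# + S) * S))
          ≈⟨ solve 4 (λ b t S ν → b :* t :* (S :* S) :* (S :* (ν :+ (:1 :+ S) :* S)) :=
            S :* S :* (b :* (ν :* (t :* S) :+ (:1 :+ S) :* (t :* (S :* S))))) refl b t S ν ⟩
        S * S * (b * (ν * (t * S) + (1# + S) * (t * (S * S)))) ≈⟨ summed ⟩
        ν * (b * b * (t * S * (t * S)))
          ≈⟨ solve 4 (λ b t S ν → ν :* (b :* b :* (t :* S :* (t :* S))) :=
            b :* t :* (S :* S) :* (ν :* b :* t)) refl b t S ν ⟩
        b * t * (S * S) * (ν * b * t) ∎)

      SLL≉0 : ¬ S * (L * L) ≈ 0#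
      SLL≉0 SLL≈0 = *-nonZero (*-nonZero ν≉0 b≉0) t≉0 (trans (sym SLL≈νbt) SLL≈0)

      L≉0 : ¬ L ≈ 0#
      L≉0 L≈0 = SLL≉0 (trans (*-congˡ (trans (*-congʳ L≈0) (zeroˡ L))) (zeroʳ S))

      S-real : conj S ≈ S
      S-real = conj-⟦⟧ ((var 0F :+ var 1F) :* (var 0F :+ var 1F)) (α-real ∷ β-real ∷ [])

      -- Since b + L = 1 + S, ℘ h = b (1 + S)/L². Added to ℘ g = b/S and combined by `LL≈`, this
      -- gives ν b/(S L²), which is 1/t.
      h = b / L
      w₀ = g + h

      Lh≈ : L * h ≈ b
      Lh≈ = y[x/y]≈x L≉0

      h-real : conj h ≈ h
      h-real = real-quotient L≉0 (conj-⟦⟧ (var 0F :+ :1 :+ var 1F) (b-real ∷ S-real ∷ [])) b-real Lh≈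

      w₀-real : conj w₀ ≈ w₀
      w₀-real = trans (conj-+ g h) (+-cong g-real h-real)

      p₀ = ℘ w₀

      p₀-real : conj p₀ ≈ p₀
      p₀-real = conj-⟦⟧ (var 0F :* var 0F :+ var 0F) (w₀-real ∷ [])

      SLLp₀≈νb : S * (L * L) * p₀ ≈ ν * b
      SLLp₀≈νb = begin
        S * (L * L) * ℘ w₀
          ≈⟨ solve 4 (λ σ L g h → σ :* σ :* (L :* L) :* ((g :+ h) :* (g :+ h) :+ (g :+ h)) :=
               L :* L :* (σ :* g :* (σ :* g) :+ σ :* (σ :* g)) :+ σ :* σ :* (L :* h :* (L :* h)
                     :+ L :* (L :* h)))
               refl σ L g h ⟩
        L * L * (σ * g * (σ * g) + σ * (σ * g)) + S * (L * h * (L * h) + L * (L * h))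
          ≈⟨ +-cong (*-congˡ (+-cong (*-cong σg≈ σg≈) (*-congˡ σg≈))) (*-congˡ (+-cong (*-cong Lh≈ Lh≈) (*-congˡ Lh≈))) ⟩
        L * L * ((α + 1#) * (α + 1#) + σ * (α + 1#)) + S * (b * b + L * b)
          ≈⟨ +-congʳ (*-congˡ (trans (solve 2 (λ α β → (α :+ :1) :* (α :+ :1) :+ (α :+ β) :* (α :+ :1) :=
               (:1 :+ α) :* (:1 :+ β)) refl α β) (sym b≈))) ⟩
        L * L * b + S * (b * b + L * b)
          ≈⟨ linear₁ bb≈ (solve 3 (λ b S ν → (b :+ :1 :+ S) :* (b :+ :1 :+ S) :* b :+ S :* (b :* b :+ (b :+ :1
                :+ S) :* b) :=
               ν :* b :+ b :* (b :* b :+ (:1 :+ S :+ ν))) refl b S ν) ⟩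
        ν * b ∎

      tp₀≈1 : t * p₀ ≈ 1#
      tp₀≈1 = *-cancelˡ-nonZero SLL≉0 (begin
        S * (L * L) * (t * p₀)   ≈⟨ solve 3 (λ s t p → s :* (t :* p) := t :* (s :* p)) refl _ t p₀ ⟩
        t * (S * (L * L) * p₀)   ≈⟨ *-congˡ SLLp₀≈νb ⟩
        t * (ν * b)              ≈⟨ *-comm _ _ ⟩
        ν * b * t                ≈⟨ SLL≈νbt ⟨
        S * (L * L)              ≈⟨ *-identityʳ _ ⟨
        S * (L * L) * 1#         ∎)

      conj[op₀]≈ : conj (o * p₀) ≈ o * p₀ + 1#
      conj[op₀]≈ = begin
        conj (o * p₀)              ≈⟨ trans (conj-* o p₀) (*-cong ō≈ p₀-real) ⟩
        ō * p₀                     ≈⟨ solve 3 (λ o ō p → ō :* p := o :* p :+ (o :+ ō) :* p) refl o ō p₀ ⟩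
        o * p₀ + t * p₀            ≈⟨ +-congˡ tp₀≈1 ⟩
        o * p₀ + 1#                ∎

      -- The conjugates o p₀ and ō p₀ have sum 1 and product p₀², and p₀² = (℘ w₀)² = ℘ (w₀²).
      ℘[op₀]≈ : ℘ (o * p₀) ≈ ℘ (w₀ * w₀)
      ℘[op₀]≈ = linear₂ tp₀≈1 oō≈1 (solve 3 (λ o ō w → let p = w :* w :+ w in
        o :* p :* (o :* p) :+ o :* p := w :* w :* (w :* w) :+ w :* w
        :+ (o :* p) :* ((o :+ ō) :* p :+ :1) :+ (p :* p) :* (o :* ō :+ :1)) refl o ō w₀)

      absurd : 0# ≈ 1#
      absurd = begin
        0#                    ≈⟨ Tr-℘-real (trans (conj-* w₀ w₀) (*-cong w₀-real w₀-real)) ⟨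
        Tr k (℘ (w₀ * w₀))    ≈⟨ Tr-cong k ℘[op₀]≈ ⟨
        Tr k (℘ (o * p₀))     ≈⟨ Tr-℘-shifted conj[op₀]≈ ⟩
        1#                    ∎

    o≈ō : o ≈ ō
    o≈ō = +≈0⇒≈ (decidable-stable (t ≟ 0#) (0≉1 ∘ NonReal.absurd))

    o≈1 : o ≈ 1#
    o≈1 = x*x≈y*y⇒x≈y (trans (*-congˡ o≈ō) (trans oō≈1 (sym (*-identityʳ 1#))))

    ō≈1 : ō ≈ 1#
    ō≈1 = trans (sym o≈ō) o≈1

    p≈S : p ≈ S
    p≈S = linear₂ o≈1 ō≈1 (solve 4 (λ o ō α β → o :* (β :* β) :+ ō :* (α :* α) :=
      (α :+ β) :* (α :+ β) :+ (β :* β) :* (o :+ :1) :+ (α :* α) :* (ō :+ :1)) refl o ō α β)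

    Q≈SS : Q₁ ≈ S * S
    Q≈SS = linear₂ o≈1 ō≈1 (solve 4 (λ o ō α β → o :* (β :* β :* (β :* β)) :+ ō :* (α :* α :* (α :* α)) :=
      (α :+ β) :* (α :+ β) :* ((α :+ β) :* (α :+ β))
      :+ (β :* β :* (β :* β)) :* (o :+ :1) :+ (α :* α :* (α :* α)) :* (ō :+ :1)) refl o ō α β)

    real-star : Star b ν S S (S * S)
    real-star = begin
      S * S * (b * (ν * S + (1# + S) * (S * S)))   ≈⟨ *-congˡ (*-congˡ (+-cong (*-congˡ p≈S) (*-congˡ Q≈SS))) ⟨
      S * S * (b * (ν * p + (1# + S) * Q₁))        ≈⟨ star ⟩
      ν * (((1# + S) * S + b * p) * ((1# + S) * S + b * p))
        ≈⟨ *-congˡ (*-cong (+-congˡ (*-congˡ p≈S)) (+-congˡ (*-congˡ p≈S))) ⟩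
      ν * (((1# + S) * S + b * S) * ((1# + S) * S + b * S)) ∎

    -- For the trivial phase `Star` collapses to b S L² = ν L², and b S + ν = (b + 1) L by `bb≈`.
    [b+1]LLL≈0 : (b + 1#) * (L * (L * L)) ≈ 0#
    [b+1]LLL≈0 = xy≈0⇒y≈0 (*-nonZero S≉0 S≉0) (linear₂ real-star bb≈ (solve 3 (λ b S ν →
      let L = b :+ :1 :+ S in S :* S :* ((b :+ :1) :* (L :* (L :* L))) := :0
      :+ :1 :* (S :* S :* (b :* (ν :* S :+ (:1 :+ S) :* (S :* S))) :+ ν :* (((:1 :+ S) :* S :+ b :* S) :* ((:1
            :+ S) :* S :+ b :* S)))
      :+ (S :* S :* (b :* S :+ L :* L)) :* (b :* b :+ (:1 :+ S :+ ν))) refl b S ν))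

    b≈1∨b+1≈S : b ≈ 1# ⊎ b + 1# ≈ S
    b≈1∨b+1≈S = [ inj₁ ∘ +≈0⇒≈ , (λ LLL≈0 → inj₂ (+≈0⇒≈ (x*[x*x]≈0⇒x≈0 LLL≈0))) ]′ (xy≈0⇒x≈0∨y≈0 [b+1]LLL≈0)
      where
      x*[x*x]≈0⇒x≈0 : ∀ {x} → x * (x * x) ≈ 0# → x ≈ 0#
      x*[x*x]≈0⇒x≈0 xxx≈0 = [ (λ x≈0 → x≈0) , x*x≈0⇒x≈0 ]′ (xy≈0⇒x≈0∨y≈0 xxx≈0)

    b+1≈S⇒ν≈ : b + 1# ≈ S → ν ≈ b * (b + 1#)
    b+1≈S⇒ν≈ b+1≈S = linear₂ bb≈ b+1≈S (solve 3 (λ b S ν → ν := b :* (b :+ :1)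
      :+ :1 :* (b :* b :+ (:1 :+ S :+ ν)) :+ :1 :* (b :+ :1 :+ S)) refl b S ν)

    -- Now b/(b+1) is b/S = ℘ g, with g in 𝔽_q.
    b+1≈S⇒Tr≈0 : b + 1# ≈ S → Tr k (b / (b + 1#)) ≈ 0#
    b+1≈S⇒Tr≈0 b+1≈S = trans (Tr-cong k (*-cancelˡ-nonZero b+1≉0 (begin
        (b + 1#) * (b / (b + 1#))            ≈⟨ y[x/y]≈x b+1≉0 ⟩
        b                                    ≈⟨ b≈ ⟩
        (1# + α) * (1# + β)                  ≈⟨ linear₁ σg≈ (solve 3 (λ α β g →
          (:1 :+ α) :* (:1 :+ β) := (α :+ β) :* (α :+ β) :* (g :* g :+ g)
          :+ ((α :+ β) :* g :+ (α :+ :1) :+ (α :+ β)) :* ((α :+ β) :* g :+ (α :+ :1))) refl α β g) ⟩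
        S * ℘ g                              ≈⟨ *-congʳ b+1≈S ⟨
        (b + 1#) * ℘ g                       ∎))) (Tr-℘-real g-real)
      where
      b+1≉0 : ¬ b + 1# ≈ 0#
      b+1≉0 b+1≈0 = S≉0 (trans (sym b+1≈S) b+1≈0)

  -- Groups C C̄ into pieces that are each easily evaluated at the points of `Point`: T, the norm, ā
  -- x² + a x̄², and x⁴ + x̄⁴.
  CC̄-expansion : ∀ a A b x x̄ → C a A b x x̄ * C A a b x̄ x ≈
    M a A b * (T a A b x x̄ * (x * x̄)) + b * ((a * x̄ * x̄ + A * x * x) * (x * x̄))
      + b * (M a A b * (x * x * (x * x) + x̄ * x̄ * (x̄ * x̄)))
  CC̄-expansion = solve 5 (λ a A b x x̄ → :F.C a A b x x̄ :* :F.C A a b x̄ x :=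
    :F.M a A b :* (:F.T a A b x x̄ :* (x :* x̄)) :+ b :* ((a :* x̄ :* x̄ :+ A :* x :* x) :* (x :* x̄))
      :+ b :* (:F.M a A b :* (x :* x :* (x :* x) :+ x̄ :* x̄ :* (x̄ :* x̄)))) refl

  -- Necessity: what injectivity says about each x

  module Necessity {a b : Carrier} (a≉0 : ¬ a ≈ 0#) (b-real : conj b ≈ b) (b≉0 : ¬ b ≈ 0#)
           (f-inj : Injective _≈_ _≈_ (f a b)) where
    open Collisions a b b-real

    A≉0 : ¬ A ≈ 0#
    A≉0 = conj-nonZero a≉0

    -- Without its middle term the form C ȳ² + C̄ y² vanishes at y = √C, because y² = C and ȳ² = C̄.
    -- This y must have the direction of x.
    T≈0⇒C-proportional : ∀ {x} → ¬ x ≈ 0# → Ta x ≈ 0# →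
           ¬ Ca x ≈ 0# × x * x * C̄a x ≈ conj x * conj x * Ca x
    T≈0⇒C-proportional {x} x≉0 T≈0 = C≉0 , (begin
      x * x * C̄a x            ≈⟨ *-congˡ ȳȳ≈ ⟨
      x * x * (ȳ * ȳ)         ≈⟨ solve 2 (λ x ȳ → x :* x :* (ȳ :* ȳ) := x :* ȳ :* (x :* ȳ)) refl x ȳ ⟩
      x * ȳ * (x * ȳ)         ≈⟨ *-cong xȳ≈x̄y xȳ≈x̄y ⟩
      x̄ * y * (x̄ * y)         ≈⟨ solve 2 (λ x̄ y → x̄ :* y :* (x̄ :* y) := x̄ :* x̄ :* (y :* y)) refl x̄ y ⟩
      x̄ * x̄ * (y * y)         ≈⟨ *-congˡ yy≈ ⟩
      x̄ * x̄ * Ca x            ∎)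
      where
      C≉0 = injective⇒T≉0∨C≉0 f-inj x≉0 T≈0
      x̄ = conj x
      y = √ (Ca x)
      ȳ = conj y
      yy≈ : y * y ≈ Ca x
      yy≈ = √x*√x≈x (Ca x)
      ȳȳ≈ : ȳ * ȳ ≈ C̄a x
      ȳȳ≈ = trans (conj-√ (Ca x)) (conj-C x)
      H≈0 : Ha x y ≈ 0#
      H≈0 = linear₃ yy≈ ȳȳ≈ T≈0 (solve 5 (λ c c̄ t y ȳ →
        c :* ȳ :* ȳ :+ t :* y :* ȳ :+ c̄ :* y :* y := :0
        :+ c̄ :* (y :* y :+ c) :+ c :* (ȳ :* ȳ :+ c̄) :+ (y :* ȳ) :* (t :+ :0))
        refl (Ca x) (C̄a x) (Ta x) y ȳ)
      xȳ≈x̄y : x * ȳ ≈ x̄ * y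
      xȳ≈x̄y = injective⇒no-collision f-inj x≉0 (√-nonZero C≉0) H≈0

    -- Converse to `collision⇒preimage`: T w/C has norm 1, so Hilbert 90 supplies y with ȳ/y = T
    -- w/C, a zero of the form. Injectivity gives y the direction of x, so x̄/x is the same ratio.
    shifted-preimage⇒root : ∀ {x s w} → ¬ x ≈ 0# → ¬ Ca x ≈ 0# → Ta x * Ta x * s ≈ Ca x * C̄a x →
      ℘ w ≈ s → conj w ≈ w + 1# → Ca x * conj x ≈ Ta x * w * x
    shifted-preimage⇒root {x} {s} {w} x≉0 C≉0 TTs≈CC̄ ℘w≈s w̄≈w+1 =
      let y , y≉0 , ȳ≈zy = hilbert90 zz̄≈1 in fromY y y≉0 ȳ≈zy
      where
      t = Ta x
      z = (t * w) / Ca x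

      Cz≈tw : Ca x * z ≈ t * w
      Cz≈tw = y[x/y]≈x C≉0

      C̄z̄≈ : C̄a x * conj z ≈ t * (w + 1#)
      C̄z̄≈ = begin
        C̄a x * conj z         ≈⟨ *-congʳ (conj-C x) ⟨
        conj (Ca x) * conj z  ≈⟨ conj-* (Ca x) z ⟨
        conj (Ca x * z)       ≈⟨ conj-cong Cz≈tw ⟩
        conj (t * w)          ≈⟨ conj-* t w ⟩
        conj t * conj w       ≈⟨ *-cong (conj-T x) w̄≈w+1 ⟩
        t * (w + 1#)          ∎

      C̄≉0 : ¬ C̄a x ≈ 0#
      C̄≉0 C̄≈0 = conj-nonZero C≉0 (trans (conj-C x) C̄≈0)

      CC̄≈ : t * t * ℘ w ≈ Ca x * C̄a x
      CC̄≈ = trans (*-congˡ ℘w≈s) TTs≈CC̄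

      zz̄≈1 : z * conj z ≈ 1#
      zz̄≈1 = *-cancelˡ-nonZero (*-nonZero C≉0 C̄≉0) (begin
        Ca x * C̄a x * (z * conj z)    ≈⟨ solve 4 (λ c c̄ z z̄ → c :* c̄ :* (z :* z̄) :=
              c :* z :* (c̄ :* z̄)) refl _ _ _ _ ⟩
        Ca x * z * (C̄a x * conj z)    ≈⟨ *-cong Cz≈tw C̄z̄≈ ⟩
        t * w * (t * (w + 1#))        ≈⟨ solve 2 (λ t w → t :* w :* (t :* (w :+ :1)) :=
              t :* t :* (w :* w :+ w)) refl t w ⟩
        t * t * ℘ w                   ≈⟨ CC̄≈ ⟩
        Ca x * C̄a x                   ≈⟨ *-identityʳ _ ⟨
        Ca x * C̄a x * 1#              ∎)

      fromY : ∀ y → ¬ y ≈ 0# → conj y ≈ z * y → Ca x * conj x ≈ t * w * x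
      fromY y y≉0 ȳ≈zy = *-cancelˡ-nonZero y≉0 (linear₂ xȳ≈x̄y Cȳ≈
        (solve 7 (λ c t w x x̄ y ȳ → y :* (c :* x̄) := y :* (t :* w :* x)
          :+ c :* (x :* ȳ :+ x̄ :* y) :+ x :* (c :* ȳ :+ t :* w :* y)) refl (Ca x) t w x (conj x) y (conj y)))
        where
        Cȳ≈ : Ca x * conj y ≈ t * w * y
        Cȳ≈ = trans (*-congˡ ȳ≈zy) (trans (sym (*-assoc _ _ _)) (*-congʳ Cz≈tw))

        H≈0 : Ha x y ≈ 0#
        H≈0 = xy≈0⇒y≈0 C≉0 (linear₂ Cȳ≈ CC̄≈ (solve 6 (λ c c̄ t w y ȳ →
          c :* (c :* ȳ :* ȳ :+ t :* y :* ȳ :+ c̄ :* y :* y) := :0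
          :+ (c :* ȳ :+ t :* w :* y :+ t :* y) :* (c :* ȳ :+ t :* w :* y)
          :+ (y :* y) :* (t :* t :* (w :* w :+ w) :+ c :* c̄)) refl (Ca x) (C̄a x) t w y (conj y)))

        xȳ≈x̄y : x * conj y ≈ conj x * y
        xȳ≈x̄y = injective⇒no-collision f-inj x≉0 y≉0 H≈0

    T≉0⇒Tr≈0 : ∀ {x s} → ¬ x ≈ 0# → ¬ Ta x ≈ 0# → Ta x * Ta x * s ≈ Ca x * C̄a x → Tr k s ≈ 0#
    T≉0⇒Tr≈0 {x} {s} x≉0 T≉0 TTs≈CC̄ = [ (λ Tr≈0 → Tr≈0) , (λ Tr≈1 →
      let w , ℘w≈s = ℘-surjective-on-real s-real
      in contradiction ℘w≈s (no-preimage Tr≈1)) ]′ (conj-fixed⇒Tr-0∨1 s-real)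
      where
      t = Ta x

      s-real : conj s ≈ s
      s-real = real-quotient (*-nonZero T≉0 T≉0)
        (trans (conj-* t t) (*-cong (conj-T x) (conj-T x)))
        (trans (conj-* _ _) (trans (*-cong (conj-C x)
              (trans (conj-cong (sym (conj-C x))) (conj-conj _))) (*-comm _ _)))
        TTs≈CC̄

      no-preimage : Tr k s ≈ 1# → ∀ {w} → ¬ ℘ w ≈ s
      -- Both w and w + 1 are preimages of s, but x̄/x cannot equal T w/C and T (w + 1)/C at once.
      no-preimage Tr≈1 {w} ℘w≈s = *-nonZero T≉0 x≉0 (linear₂ (root w̄≈w+1 ℘w≈s) (root w+1-shifted ℘[w+1]≈s)
        (solve 5 (λ c t w x x̄ → t :* x := :0 :+ :1 :* (c :* x̄ :+ t :* w :* x)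
          :+ :1 :* (c :* x̄ :+ t :* (w :+ :1) :* x)) refl (Ca x) t w x (conj x)))
        where
        C≉0 : ¬ Ca x ≈ 0#
        C≉0 C≈0 = 0≉1 (trans (trans (sym Tr-0) (Tr-cong k (sym s≈0))) Tr≈1)
          where
          s≈0 : s ≈ 0#
          s≈0 = xy≈0⇒y≈0 (*-nonZero T≉0 T≉0) (trans TTs≈CC̄ (trans (*-congʳ C≈0) (zeroˡ _)))

        root : ∀ {w} → conj w ≈ w + 1# → ℘ w ≈ s → Ca x * conj x ≈ t * w * x
        root w̄≈w+1 ℘w≈s = shifted-preimage⇒root x≉0 C≉0 TTs≈CC̄ ℘w≈s w̄≈w+1

        w̄≈w+1 : conj w ≈ w + 1#
        w̄≈w+1 = trans (conj-preimage ℘w≈s) (+-congˡ Tr≈1)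

        w+1-shifted : conj (w + 1#) ≈ w + 1# + 1#
        w+1-shifted = trans (conj-+ _ _) (+-cong w̄≈w+1 conj-1)

        ℘[w+1]≈s : ℘ (w + 1#) ≈ s
        ℘[w+1]≈s = trans (solve 1 (λ w → (w :+ :1) :* (w :+ :1) :+ (w :+ :1) := w :* w :+ w) refl w) ℘w≈s

    S ν : Carrier
    S = M a A b + 1#
    ν = a * A

    S-real : conj S ≈ S
    S-real = trans (conj-⟦⟧ (var 0F :* var 1F :+ var 2F :* var 2F :+ :1) (refl ∷ conj-conj a ∷ b-real ∷ []))
      (solve 3 (λ a A b → A :* a :+ b :* b :+ :1 := a :* A :+ b :* b :+ :1) refl a A b)

    -- S is the middle coefficient of T, by which the Artin-Schreier form of its zeros divides. If
    -- it vanished, T would have the zero x = √ā; proportionality there forces a = ā and then x̄ =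
    -- x, so that C = x² (a + b + 1) with (a + b + 1)² = S = 0.
    S≉0 : ¬ S ≈ 0#
    S≉0 S≈0 = C≉0 C≈0
      where
      x = √ A
      x̄ = conj x
      xx≈ : x * x ≈ A
      xx≈ = √x*√x≈x A
      x̄x̄≈ : x̄ * x̄ ≈ a
      x̄x̄≈ = trans (conj-√ A) (conj-conj a)
      T≈0 : Ta x ≈ 0#
      T≈0 = linear₃ xx≈ x̄x̄≈ S≈0 (solve 5 (λ a A S x x̄ →
        A :* x̄ :* x̄ :+ a :* x :* x :+ S :* x :* x̄ := :0
        :+ a :* (x :* x :+ A) :+ A :* (x̄ :* x̄ :+ a) :+ (x :* x̄) :* (S :+ :0)) refl a A S x x̄)
      x≉0 = √-nonZero A≉0
      C≉0 = proj₁ (T≈0⇒C-proportional x≉0 T≈0)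
      xxC̄≈x̄x̄C = proj₂ (T≈0⇒C-proportional x≉0 T≈0)

      a≈A : a ≈ A
      a≈A = x*x≈y*y⇒x≈y (*-cancelˡ-nonZero b≉0 (linear₃ xx≈ x̄x̄≈ xxC̄≈x̄x̄C
        (solve 5 (λ a A b x x̄ → b :* (a :* a) := b :* (A :* A)
          :+ (b :* (x :* x :+ A) :+ a :* x̄ :* x) :* (x :* x :+ A)
          :+ (b :* (x̄ :* x̄ :+ a) :+ A :* x̄ :* x) :* (x̄ :* x̄ :+ a)
          :+ :1 :* (x :* x :* :F.C A a b x̄ x :+ x̄ :* x̄ :* :F.C a A b x x̄)) refl a A b x x̄)))

      x̄≈x : x̄ ≈ x
      x̄≈x = x*x≈y*y⇒x≈y (trans x̄x̄≈ (trans a≈A (sym xx≈)))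

      a+b+1≈0 : a + b + 1# ≈ 0#
      a+b+1≈0 = x*x≈0⇒x≈0 (linear₂ a≈A S≈0 (solve 3 (λ a A b →
        (a :+ b :+ :1) :* (a :+ b :+ :1) := :0 :+ a :* (a :+ A) :+ :1 :* (:F.M a A b :+ :1 :+ :0)) refl a A b))

      C≈0 : Ca x ≈ 0#
      C≈0 = trans (linear₃ x̄≈x a≈A S≈0 (solve 5 (λ a A b x x̄ → :F.C a A b x x̄ :=
        x :* x :* (a :+ b :+ :1) :+ (b :* (x̄ :+ x) :+ A :* x) :* (x̄ :+ x) :+ (x :* x) :* (a :+ A)
        :+ (x :* x) :* (:F.M a A b :+ :1 :+ :0)) refl a A b x x̄)) (trans (*-congˡ a+b+1≈0) (zeroʳ _))

    -- The single point x = 1 suffices: T = a² and C = C̄ = a + a² there, so the quotient is (1 +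
    -- a⁻¹)², and the trace commutes with squaring.
    b≈1⇒Tr≈0 : conj a ≈ a → b ≈ 1# → Tr k (1# + a ⁻¹) ≈ 0#
    b≈1⇒Tr≈0 a-real b≈1 = x*x≈0⇒x≈0 (trans (sym (Tr-* k (1# + i)))
      (T≉0⇒Tr≈0 (0≉1 ∘ sym) T≉0 (begin
        Ta 1# * Ta 1# * ((1# + i) * (1# + i)) ≈⟨ *-congʳ (*-cong T1≈ T1≈) ⟩
        a * a * (a * a) * ((1# + i) * (1# + i)) ≈⟨ linear₁ (inverseʳ a a≉0) (solve 2 (λ a i →
          a :* a :* (a :* a) :* ((:1 :+ i) :* (:1 :+ i)) := (a :+ a :* a) :* (a :+ a :* a)
          :+ (a :* a :* (a :* i :+ :1)) :* (a :* i :+ :1)) refl a i) ⟩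
        (a + a * a) * (a + a * a)             ≈⟨ *-cong C1≈ C̄1≈ ⟨
        Ca 1# * C̄a 1#                         ∎)))
      where
      i = a ⁻¹
      module B1 = CaseBIs1 a≉0 b-real b≈1 a-real

      T1≈ : Ta 1# ≈ a * a
      T1≈ = trans (B1.T≈ 1#) (linear₁ conj-1 (solve 2 (λ a j →
        a :* (:1 :* :1 :+ j :* j :+ a :* :1 :* j) :=
              a :* a :+ (a :* (j :+ :1 :+ a)) :* (j :+ :1)) refl a (conj 1#)))

      C1≈ : Ca 1# ≈ a + a * a
      C1≈ = trans (B1.C≈ 1#) (linear₁ conj-1 (solve 2 (λ a j →
        :1 :* :1 :+ j :* j :+ a :* :1 :* j :+ a :* a :* (:1 :* :1) :=
              a :+ a :* a :+ (j :+ :1 :+ a) :* (j :+ :1)) refl a (conj 1#)))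

      C̄1≈ : C̄a 1# ≈ a + a * a
      C̄1≈ = trans (B1.C̄≈ 1#) (linear₁ conj-1 (solve 2 (λ a j →
        :1 :* :1 :+ j :* j :+ a :* :1 :* j :+ a :* a :* (j :* j) :=
        a :+ a :* a :+ (j :+ :1 :+ a :+ a :* a :* (j :+ :1)) :* (j :+ :1)) refl a (conj 1#)))

      T≉0 : ¬ Ta 1# ≈ 0#
      T≉0 T≈0 = *-nonZero a≉0 a≉0 (trans (sym T1≈) T≈0)

    -- Necessity when T has a nontrivial zero

    zero-of-T : ∀ {w} → conj w ≈ w + 1# → S * S * ℘ w ≈ ν →
                ∃ λ x → ¬ x ≈ 0# × A * conj x ≈ S * w * x × a * x ≈ S * (w + 1#) * conj x
    zero-of-T {w} w̄≈w+1 SS℘w≈ν =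
      let x , x≉0 , x̄≈zx = hilbert90 zz̄≈1 in
      x , x≉0 , Ax̄≈ x x̄≈zx , ax≈ x (Ax̄≈ x x̄≈zx)
      where
      -- Substituting x̄ = (S w/ā) x in T gives x² (S² ℘ w + ν)/ā, so a zero of T is a solution of
      -- x̄ = z x with this z.
      z = (S * w) / A
      Az≈ : A * z ≈ S * w
      Az≈ = y[x/y]≈x A≉0

      conj-Sw : conj (S * w) ≈ S * (w + 1#)
      conj-Sw = trans (conj-* S w) (*-cong S-real w̄≈w+1)

      az̄≈ : a * conj z ≈ S * (w + 1#)
      az̄≈ = begin
        a * conj z        ≈⟨ *-congʳ (conj-conj a) ⟨
        conj A * conj z   ≈⟨ conj-* A z ⟨
        conj (A * z)      ≈⟨ conj-cong Az≈ ⟩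
        conj (S * w)      ≈⟨ conj-Sw ⟩
        S * (w + 1#)      ∎

      zz̄≈1 : z * conj z ≈ 1#
      zz̄≈1 = *-cancelˡ-nonZero (*-nonZero a≉0 A≉0) (begin
        a * A * (z * conj z)         ≈⟨ solve 4 (λ a A z z̄ → a :* A :* (z :* z̄) :=
              A :* z :* (a :* z̄)) refl _ _ _ _ ⟩
        A * z * (a * conj z)         ≈⟨ *-cong Az≈ az̄≈ ⟩
        S * w * (S * (w + 1#))       ≈⟨ solve 2 (λ S w → S :* w :* (S :* (w :+ :1)) :=
              S :* S :* (w :* w :+ w)) refl S w ⟩
        S * S * ℘ w                  ≈⟨ SS℘w≈ν ⟩
        a * A                        ≈⟨ *-identityʳ _ ⟨
        a * A * 1#                   ∎)

      Ax̄≈ : ∀ x → conj x ≈ z * x → A * conj x ≈ S * w * x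
      Ax̄≈ x x̄≈zx = trans (*-congˡ x̄≈zx) (trans (sym (*-assoc _ _ _)) (*-congʳ Az≈))

      ax≈ : ∀ x → A * conj x ≈ S * w * x → a * x ≈ S * (w + 1#) * conj x
      ax≈ x eq = begin
        a * x                    ≈⟨ *-cong (conj-conj a) (conj-conj x) ⟨
        conj A * conj (conj x)   ≈⟨ conj-* A _ ⟨
        conj (A * conj x)        ≈⟨ conj-cong eq ⟩
        conj (S * w * x)         ≈⟨ conj-* _ _ ⟩
        conj (S * w) * conj x    ≈⟨ *-congʳ conj-Sw ⟩
        S * (w + 1#) * conj x    ∎

    module T-has-zero {w} (w̄≈w+1 : conj w ≈ w + 1#) (SS℘w≈ν : S * S * ℘ w ≈ ν) where
      private
        zero₀ = zero-of-T w̄≈w+1 SS℘w≈ν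
        x = proj₁ zero₀
        x≉0 = proj₁ (proj₂ zero₀)
        Ax̄≈ = proj₁ (proj₂ (proj₂ zero₀))
        ax≈ = proj₂ (proj₂ (proj₂ zero₀))
        x̄ = conj x
        u = a * w + A * (w + 1#)

        T≈0 : Ta x ≈ 0#
        T≈0 = linear₂ Ax̄≈ ax≈ (solve 6 (λ a A S w x x̄ →
          A :* x̄ :* x̄ :+ a :* x :* x :+ S :* x :* x̄ := :0
          :+ x̄ :* (A :* x̄ :+ S :* w :* x) :+ x :* (a :* x :+ S :* (w :+ :1) :* x̄)) refl a A S w x x̄)

        C≉0 : ¬ Ca x ≈ 0#
        C≉0 = proj₁ (T≈0⇒C-proportional x≉0 T≈0)

        xx̄≉0 : ¬ x * x̄ ≈ 0#
        xx̄≉0 = *-nonZero x≉0 (conj-nonZero x≉0)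

        bnn≈ : b * ((x * x + x̄ * x̄) * (x * x + x̄ * x̄)) ≈ S * (x * x̄ * (x * x̄))
        bnn≈ = linear₂ (proj₂ (T≈0⇒C-proportional x≉0 T≈0)) T≈0 (solve 5 (λ a A b x x̄ →
          b :* ((x :* x :+ x̄ :* x̄) :* (x :* x :+ x̄ :* x̄)) := (:F.M a A b :+ :1) :* (x :* x̄ :* (x :* x̄))
          :+ :1 :* (x :* x :* :F.C A a b x̄ x :+ x̄ :* x̄ :* :F.C a A b x x̄)
          :+ (x :* x̄) :* (:F.T a A b x x̄ :+ :0)) refl a A b x x̄)

        aAn≈ : a * A * (x * x + x̄ * x̄) ≈ S * (x * x̄) * u
        aAn≈ = linear₂ Ax̄≈ ax≈ (solve 6 (λ a A S w x x̄ →
          a :* A :* (x :* x :+ x̄ :* x̄) := S :* (x :* x̄) :* (a :* w :+ A :* (w :+ :1))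
          :+ (a :* x̄) :* (A :* x̄ :+ S :* w :* x) :+ (A :* x) :* (a :* x :+ S :* (w :+ :1) :* x̄))
                refl a A S w x x̄)

      -- With n = x² + x̄² and m = x x̄, the root equations give aā n = S m u, and proportionality
      -- of C gives b n² = S m². Eliminating n and m leaves a relation without x.
      bSuu≈ : b * S * (u * u) ≈ a * A * (a * A)
      bSuu≈ = *-cancelˡ-nonZero (*-nonZero S≉0 (*-nonZero xx̄≉0 xx̄≉0)) (linear₂ aAn≈ bnn≈
        (solve 6 (λ b S m u v n → S :* (m :* m) :* (b :* S :* (u :* u)) := S :* (m :* m) :* (v :* v)
          :+ (b :* (v :* n :+ S :* m :* u)) :* (v :* n :+ S :* m :* u)
          :+ (v :* v) :* (b :* (n :* n) :+ S :* (m :* m))) refl b S (x * x̄) u (a * A) (x * x + x̄ * x̄)))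

      a-real⇒aa≉b[b+1] : ¬ b ≈ 1# → conj a ≈ a → ¬ a * a ≈ b * (b + 1#)
      a-real⇒aa≉b[b+1] b≉1 a-real aa≈ = *-nonZero (b≉1 ∘ +≈0⇒≈)
        (*-nonZero C≉0 λ C̄≈0 → conj-nonZero C≉0 (trans (conj-C x) C̄≈0))
        (trans (RealA.[b+1]CC̄≈bTT b-real a-real aa≈ x) (trans (*-congˡ
              (trans (*-congʳ T≈0) (zeroˡ _))) (zeroʳ b)))

    T-has-zero⇒b≈1 : ∀ {w} → conj w ≈ w + 1# → S * S * ℘ w ≈ ν → conj a ≈ a × b ≈ 1#
    T-has-zero⇒b≈1 {w} w̄≈w+1 SS℘w≈ν = sym a≈A , decidable-stable (b ≟ 1#) λ b≉1 →
      W₀.a-real⇒aa≉b[b+1] b≉1 (sym a≈A) (+≈0⇒≈ (xy≈0⇒y≈0 (b≉1 ∘ +≈0⇒≈)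
        (linear₂ a≈A bS≈aa (solve 3 (λ a A b → (b :+ :1) :* (a :* a :+ b :* (b :+ :1)) := :0
          :+ (b :* a) :* (a :+ A) :+ :1 :* (b :* (:F.M a A b :+ :1) :+ a :* a)) refl a A b))))
      where
      module W₀ = T-has-zero w̄≈w+1 SS℘w≈ν
      -- T has a second zero direction, belonging to w + 1. Both give u the same square, and the two
      -- values of u differ by a + ā, so a = ā.
      module W₁ = T-has-zero {w + 1#} (trans (conj-+ _ _) (+-cong w̄≈w+1 conj-1))
        (trans (*-congˡ (solve 1 (λ w → (w :+ :1) :* (w :+ :1) :+ (w :+ :1) := w :* w :+ w) refl w)) SS℘w≈ν)

      a≈A : a ≈ A
      a≈A = linear₁ (x*x≈y*y⇒x≈y (*-cancelˡ-nonZero (*-nonZero b≉0 S≉0) (trans W₀.bSuu≈ (sym W₁.bSuu≈))))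
        (solve 3 (λ a A w → a := A :+ :1 :* (a :* w :+ A :* (w :+ :1) :+
          (a :* (w :+ :1) :+ A :* (w :+ :1 :+ :1)))) refl a A w)

      bS≈aa : b * S ≈ a * a
      bS≈aa = *-cancelˡ-nonZero (*-nonZero a≉0 a≉0) (linear₂ W₀.bSuu≈ a≈A (solve 5 (λ a A b S w →
        let u = a :* w :+ A :* (w :+ :1) in
        a :* a :* (b :* S) := a :* a :* (a :* a)
          :+ :1 :* (b :* S :* (u :* u) :+ a :* A :* (a :* A))
          :+ (b :* S :* (w :+ :1) :* (w :+ :1) :* (a :+ A) :+ a :* a :* (a :+ A)) :* (a :+ A)) refl a A b S w))

    private
      m = M a A b

    -- Necessity when T has no nontrivial zero: the trace on the circle

    module T-has-no-zero {w} (w-real : conj w ≈ w) (SS℘w≈aA : S * S * ℘ w ≈ a * A) where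

      -- Ω removes the phase: ā = ρ Ω² and a = ρ Ω̄², so at X = Ω W̄ the form T becomes ρ (W² + W̄²)
      -- + S W W̄. As αβ = ρ and α² + β² = S, this factors as (α W + β W̄)(β W + α W̄). The phase o
      -- is Ω̄⁴ = a/ā.
      α β ρ Ω Ω̄ o ō : Carrier
      α = √ (S * w)
      β = √ (S * (w + 1#))
      ρ = α * β
      Ω = √ (A / ρ)
      Ω̄ = conj Ω
      o = Ω̄ * Ω̄ * (Ω̄ * Ω̄)
      ō = Ω * Ω * (Ω * Ω)

      α-real : conj α ≈ α
      α-real = conj-real-√ (trans (conj-* S w) (*-cong S-real w-real))

      β-real : conj β ≈ β
      β-real = conj-real-√ (trans (conj-* S (w + 1#)) (*-cong S-real
            (trans (conj-+ w 1#) (+-cong w-real conj-1))))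

      ρ-real : conj ρ ≈ ρ
      ρ-real = trans (conj-* α β) (*-cong α-real β-real)

      αα≈ : α * α ≈ S * w
      αα≈ = √x*√x≈x _

      ββ≈ : β * β ≈ S * (w + 1#)
      ββ≈ = √x*√x≈x _

      αα+ββ≈S : α * α + β * β ≈ S
      αα+ββ≈S = trans (+-cong αα≈ ββ≈) (solve 2 (λ S w → S :* w :+ S :* (w :+ :1) := S) refl S w)

      ρρ≈ : ρ * ρ ≈ a * A
      ρρ≈ = begin
        α * β * (α * β)            ≈⟨ solve 2 (λ α β → α :* β :* (α :* β) := α :* α :* (β :* β)) refl α β ⟩
        α * α * (β * β)            ≈⟨ *-cong αα≈ ββ≈ ⟩
        S * w * (S * (w + 1#))     ≈⟨ solve 2 (λ S w → S :* w :* (S :* (w :+ :1)) :=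
              S :* S :* (w :* w :+ w)) refl S w ⟩
        S * S * ℘ w                ≈⟨ SS℘w≈aA ⟩
        a * A                      ∎

      ρ≉0 : ¬ ρ ≈ 0#
      ρ≉0 ρ≈0 = *-nonZero a≉0 (conj-nonZero a≉0) (trans (sym ρρ≈) (trans (*-congʳ ρ≈0) (zeroˡ ρ)))

      [α+β]²≈S : (α + β) * (α + β) ≈ S
      [α+β]²≈S = trans (solve 2 (λ α β → (α :+ β) :* (α :+ β) := α :* α :+ β :* β) refl α β) αα+ββ≈S

      α+β≉0 : ¬ α + β ≈ 0#
      α+β≉0 eq = S≉0 (trans (sym [α+β]²≈S) (trans (*-congʳ eq) (zeroˡ _)))

      A≈ : A ≈ ρ * (Ω * Ω)
      A≈ = sym (trans (*-congˡ (√x*√x≈x (A / ρ))) (y[x/y]≈x ρ≉0))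

      a≈ : a ≈ ρ * (Ω̄ * Ω̄)
      a≈ = begin
        a                     ≈⟨ conj-conj a ⟨
        conj A                ≈⟨ conj-cong A≈ ⟩
        conj (ρ * (Ω * Ω))    ≈⟨ trans (conj-* _ _) (*-cong ρ-real (conj-* _ _)) ⟩
        ρ * (Ω̄ * Ω̄)           ∎

      ΩΩ̄≈1 : Ω * Ω̄ ≈ 1#
      ΩΩ̄≈1 = x*x≈y*y⇒x≈y (*-cancelˡ-nonZero (*-nonZero ρ≉0 ρ≉0) (begin
        ρ * ρ * (Ω * Ω̄ * (Ω * Ω̄))           ≈⟨ solve 3 (λ ρ Ω Ω̄ → ρ :* ρ :* (Ω :* Ω̄ :* (Ω :* Ω̄)) :=
              ρ :* (Ω̄ :* Ω̄) :* (ρ :* (Ω :* Ω))) refl ρ Ω Ω̄ ⟩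
        ρ * (Ω̄ * Ω̄) * (ρ * (Ω * Ω))         ≈⟨ *-cong a≈ A≈ ⟨
        a * A                               ≈⟨ ρρ≈ ⟨
        ρ * ρ                               ≈⟨ solve 1 (λ x → x := x :* (:1 :* :1)) refl _ ⟩
        ρ * ρ * (1# * 1#)                   ∎))

      oō≈1 : o * ō ≈ 1#
      oō≈1 = trans (solve 2 (λ Ω Ω̄ → Ω̄ :* Ω̄ :* (Ω̄ :* Ω̄) :* (Ω :* Ω :* (Ω :* Ω)) :=
          Ω :* Ω̄ :* (Ω :* Ω̄) :* (Ω :* Ω̄ :* (Ω :* Ω̄))) refl Ω Ω̄)
        (trans (*-cong (*-cong ΩΩ̄≈1 ΩΩ̄≈1) (*-cong ΩΩ̄≈1 ΩΩ̄≈1)) (solve 0 (:1 :* :1 :* (:1 :* :1) := :1) refl))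

      conj-o : conj o ≈ ō
      conj-o = conj-⟦⟧ (var 0F :* var 0F :* (var 0F :* var 0F)) (conj-conj Ω ∷ [])

      conj-ō : conj ō ≈ o
      conj-ō = conj-⟦⟧ (var 0F :* var 0F :* (var 0F :* var 0F)) (refl ∷ [])

      -- By definition of S, b² = 1 + S + aā = 1 + α² + β² + α²β², which is the square of the
      -- right-hand side.
      b≈ : b ≈ (1# + α) * (1# + β)
      b≈ = x*x≈y*y⇒x≈y (linear₂ αα+ββ≈S ρρ≈ (solve 5 (λ a A b α β →
        b :* b := (:1 :+ α) :* (:1 :+ β) :* ((:1 :+ α) :* (:1 :+ β))
        :+ :1 :* (α :* α :+ β :* β :+ (:F.M a A b :+ :1))
        :+ :1 :* (α :* β :* (α :* β) :+ a :* A)) refl a A b α β))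

      p p̄ q₁ q̄₁ e g ē ḡ κ : Carrier
      p = P o ō α β
      p̄ = P ō o α β
      q₁ = Q o ō α β
      q̄₁ = Q ō o α β
      e = b * (ρ * ρ * p + m * q₁)
      ē = b * (ρ * ρ * p̄ + m * q̄₁)
      g = m * (S * S) * ρ + b * (ρ * (S * p))
      ḡ = m * (S * S) * ρ + b * (ρ * (S * p̄))
      κ = m * (S * S) * S + b * (ρ * ρ * (p + p̄))

      -- X is the image of y under the projectivity moving the roots of T to 0 and ∞: T X no longer depends on y.
      module Point {y} (yȳ≈1 : y * conj y ≈ 1#) where
        ȳ Y Ȳ W W̄ X : Carrier
        ȳ = conj y
        -- W = α Y + β Ȳ solves the factors of T: α W + β W̄ = S Y and β W + α W̄ = S Ȳ. Since Y² =
        -- ȳ and Y Ȳ = 1, the products W², W̄² and W W̄ are polynomials of degree at most one in y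
        -- and ȳ.
        Y = √ ȳ
        Ȳ = conj Y
        W = α * Y + β * Ȳ
        W̄ = α * Ȳ + β * Y
        X = Ω * W̄

        YY≈ȳ : Y * Y ≈ ȳ
        YY≈ȳ = √x*√x≈x ȳ

        ȲȲ≈y : Ȳ * Ȳ ≈ y
        ȲȲ≈y = trans (conj-√ ȳ) (conj-conj y)

        YȲ≈1 : Y * Ȳ ≈ 1#
        YȲ≈1 = x*x≈y*y⇒x≈y (begin
          Y * Ȳ * (Y * Ȳ)     ≈⟨ solve 2 (λ Y Ȳ → Y :* Ȳ :* (Y :* Ȳ) := Ȳ :* Ȳ :* (Y :* Y)) refl Y Ȳ ⟩
          Ȳ * Ȳ * (Y * Y)     ≈⟨ *-cong ȲȲ≈y YY≈ȳ ⟩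
          y * ȳ               ≈⟨ yȳ≈1 ⟩
          1#                  ≈⟨ *-identityʳ 1# ⟨
          1# * 1#             ∎)

        conj-X : conj X ≈ Ω̄ * W
        conj-X = conj-⟦⟧ (var 0F :* (var 1F :* var 2F :+ var 3F :* var 4F))
          (refl ∷ α-real ∷ conj-conj Y ∷ β-real ∷ refl ∷ [])

        WW≈ : W * W ≈ α * α * ȳ + β * β * y
        WW≈ = trans (solve 4 (λ α β Y Ȳ → (α :* Y :+ β :* Ȳ) :* (α :* Y :+ β :* Ȳ) :=
          α :* α :* (Y :* Y) :+ β :* β :* (Ȳ :* Ȳ)) refl α β Y Ȳ) (+-cong (*-congˡ YY≈ȳ) (*-congˡ ȲȲ≈y))

        W̄W̄≈ : W̄ * W̄ ≈ α * α * y + β * β * ȳ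
        W̄W̄≈ = trans (solve 4 (λ α β Y Ȳ → (α :* Ȳ :+ β :* Y) :* (α :* Ȳ :+ β :* Y) :=
          α :* α :* (Ȳ :* Ȳ) :+ β :* β :* (Y :* Y)) refl α β Y Ȳ) (+-cong (*-congˡ ȲȲ≈y) (*-congˡ YY≈ȳ))

        WW̄≈ : W * W̄ ≈ ρ * (y + ȳ) + S
        WW̄≈ = begin
          W * W̄
            ≈⟨ solve 4 (λ α β Y Ȳ → (α :* Y :+ β :* Ȳ) :* (α :* Ȳ :+ β :* Y) :=
                 α :* β :* (Ȳ :* Ȳ :+ Y :* Y) :+ (α :* α :+ β :* β) :* (Y :* Ȳ)) refl α β Y Ȳ ⟩
          ρ * (Ȳ * Ȳ + Y * Y) + (α * α + β * β) * (Y * Ȳ)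
            ≈⟨ +-cong (*-congˡ (+-cong ȲȲ≈y YY≈ȳ)) (*-cong αα+ββ≈S YȲ≈1) ⟩
          ρ * (y + ȳ) + S * 1#
            ≈⟨ +-congˡ (*-identityʳ S) ⟩
          ρ * (y + ȳ) + S ∎

        WW+W̄W̄≈ : W * W + W̄ * W̄ ≈ S * (y + ȳ)
        WW+W̄W̄≈ = begin
          W * W + W̄ * W̄                                                ≈⟨ +-cong WW≈ W̄W̄≈ ⟩
          α * α * ȳ + β * β * y + (α * α * y + β * β * ȳ)
            ≈⟨ solve 4 (λ u v y ȳ → u :* ȳ :+ v :* y :+ (u :* y :+ v :* ȳ) :=
                  (u :+ v) :* (y :+ ȳ)) refl (α * α) (β * β) y ȳ ⟩
          (α * α + β * β) * (y + ȳ)                                    ≈⟨ *-congʳ αα+ββ≈S ⟩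
          S * (y + ȳ)                                                  ∎

        XX̄≈ : X * conj X ≈ W * W̄
        XX̄≈ = trans (*-congˡ conj-X) (linear₁ ΩΩ̄≈1 (solve 4 (λ Ω Ω̄ W W̄ →
          Ω :* W̄ :* (Ω̄ :* W) := W :* W̄ :+ (W :* W̄) :* (Ω :* Ω̄ :+ :1)) refl Ω Ω̄ W W̄))

        T≈SS : Ta X ≈ S * S
        T≈SS = begin
          A * conj X * conj X + a * X * X + S * X * conj X
            ≈⟨ +-cong (+-cong (*-cong (*-cong A≈ conj-X) conj-X) (*-congʳ (*-congʳ a≈)))
                 (trans (*-assoc _ _ _) (*-congˡ (trans XX̄≈ WW̄≈))) ⟩
          ρ * (Ω * Ω) * (Ω̄ * W) * (Ω̄ * W) + ρ * (Ω̄ * Ω̄) * (Ω * W̄) * (Ω * W̄) + S * (ρ * (y + ȳ) + S)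
            ≈⟨ +-congʳ (linear₁ ΩΩ̄≈1 (solve 5 (λ ρ Ω Ω̄ W W̄ →
                 ρ :* (Ω :* Ω) :* (Ω̄ :* W) :* (Ω̄ :* W) :+ ρ :* (Ω̄ :* Ω̄) :* (Ω :* W̄) :* (Ω :* W̄) :=
                 ρ :* (W :* W :+ W̄ :* W̄) :+ (ρ :* (W :* W :+ W̄ :* W̄) :* (Ω :* Ω̄ :+ :1)) :* (Ω :* Ω̄
                       :+ :1)) refl ρ Ω Ω̄ W W̄)) ⟩
          ρ * (W * W + W̄ * W̄) + S * (ρ * (y + ȳ) + S)
            ≈⟨ +-congʳ (*-congˡ WW+W̄W̄≈) ⟩
          ρ * (S * (y + ȳ)) + S * (ρ * (y + ȳ) + S)
            ≈⟨ solve 3 (λ ρ S z → ρ :* (S :* z) :+ S :* (ρ :* z :+ S) := S :* S) refl ρ S (y + ȳ) ⟩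
          S * S ∎

        T≉0 : ¬ Ta X ≈ 0#
        T≉0 T≈0 = *-nonZero S≉0 S≉0 (trans (sym T≈SS) T≈0)

        X≉0 : ¬ X ≈ 0#
        X≉0 X≈0 = T≉0 (trans (+-cong (+-cong
            (trans (*-congˡ X̄≈0) (zeroʳ _)) (trans (*-congˡ X≈0) (zeroʳ _))) (trans (*-congˡ X̄≈0) (zeroʳ _)))
          (solve 0 (:0 :+ :0 :+ :0 := :0) refl))
          where
          X̄≈0 : conj X ≈ 0#
          X̄≈0 = trans (conj-cong X≈0) conj-0

        CC̄≈ : Ca X * C̄a X ≈ e * (y * y) + ē * (ȳ * ȳ) + (g * y + ḡ * ȳ) + κ
        CC̄≈ = begin
          Ca X * C̄a X
            ≈⟨ CC̄-expansion a A b X (conj X) ⟩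
          m * (Ta X * (X * conj X)) + b * ((a * conj X * conj X + A * X * X) * (X * conj X))
            + b * (m * (X * X * (X * X) + conj X * conj X * (conj X * conj X)))
            ≈⟨ +-cong (+-cong (*-congˡ (*-cong T≈SS (trans XX̄≈ WW̄≈)))
                 (*-congˡ (*-cong quadratic (trans XX̄≈ WW̄≈)))) (*-congˡ (*-congˡ quartic)) ⟩
          m * (S * S * (ρ * (y + ȳ) + S)) + b * (ρ * (p * y + p̄ * ȳ) * (ρ * (y + ȳ) + S))
            + b * (m * (q₁ * (y * y) + q̄₁ * (ȳ * ȳ)))
            ≈⟨ linear₁ yȳ≈1 (solve 10 (λ m b S ρ p p̄ q q̄ y ȳ →
                 m :* (S :* S :* (ρ :* (y :+ ȳ) :+ S)) :+ b :* (ρ :* (p :* y :+ p̄ :* ȳ) :* (ρ :* (y :+ ȳ)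
                       :+ S))
                   :+ b :* (m :* (q :* (y :* y) :+ q̄ :* (ȳ :* ȳ))) :=
                 b :* (ρ :* ρ :* p :+ m :* q) :* (y :* y) :+ b :* (ρ :* ρ :* p̄ :+ m :* q̄) :* (ȳ :* ȳ)
                   :+ ((m :* (S :* S) :* ρ :+ b :* (ρ :* (S :* p))) :* y :+ (m :* (S :* S) :* ρ
                         :+ b :* (ρ :* (S :* p̄))) :* ȳ)
                   :+ (m :* (S :* S) :* S :+ b :* (ρ :* ρ :* (p :+ p̄)))
                   :+ (b :* (ρ :* ρ :* (p :+ p̄))) :* (y :* ȳ :+ :1)) refl m b S ρ p p̄ q₁ q̄₁ y ȳ) ⟩
          e * (y * y) + ē * (ȳ * ȳ) + (g * y + ḡ * ȳ) + κ ∎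
          where
          quadratic : a * conj X * conj X + A * X * X ≈ ρ * (p * y + p̄ * ȳ)
          quadratic = begin
            a * conj X * conj X + A * X * X
              ≈⟨ +-cong (*-cong (*-cong a≈ conj-X) conj-X) (*-congʳ (*-congʳ A≈)) ⟩
            ρ * (Ω̄ * Ω̄) * (Ω̄ * W) * (Ω̄ * W) + ρ * (Ω * Ω) * (Ω * W̄) * (Ω * W̄)
              ≈⟨ solve 5 (λ ρ Ω Ω̄ W W̄ → ρ :* (Ω̄ :* Ω̄) :* (Ω̄ :* W) :* (Ω̄ :* W)
                    :+ ρ :* (Ω :* Ω) :* (Ω :* W̄) :* (Ω :* W̄) :=
                   ρ :* (Ω̄ :* Ω̄ :* (Ω̄ :* Ω̄) :* (W :* W) :+ Ω :* Ω :* (Ω :* Ω) :* (W̄ :* W̄)))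
                         refl ρ Ω Ω̄ W W̄ ⟩
            ρ * (o * (W * W) + ō * (W̄ * W̄))
              ≈⟨ *-congˡ (+-cong (*-congˡ WW≈) (*-congˡ W̄W̄≈)) ⟩
            ρ * (o * (α * α * ȳ + β * β * y) + ō * (α * α * y + β * β * ȳ))
              ≈⟨ *-congˡ (solve 6 (λ o ō u v y ȳ → o :* (u :* ȳ :+ v :* y) :+ ō :* (u :* y :+ v :* ȳ) :=
                   (o :* v :+ ō :* u) :* y :+ (ō :* v :+ o :* u) :* ȳ) refl o ō (α * α) (β * β) y ȳ) ⟩
            ρ * (p * y + p̄ * ȳ) ∎

          quartic : X * X * (X * X) + conj X * conj X * (conj X * conj X) ≈ q₁ * (y * y) + q̄₁ * (ȳ * ȳ)
          quartic = begin
            X * X * (X * X) + conj X * conj X * (conj X * conj X)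
              ≈⟨ +-congˡ (*-cong (*-cong conj-X conj-X) (*-cong conj-X conj-X)) ⟩
            X * X * (X * X) + Ω̄ * W * (Ω̄ * W) * (Ω̄ * W * (Ω̄ * W))
              ≈⟨ solve 4 (λ Ω Ω̄ W W̄ → Ω :* W̄ :* (Ω :* W̄) :* (Ω :* W̄ :* (Ω :* W̄))
                    :+ Ω̄ :* W :* (Ω̄ :* W) :* (Ω̄ :* W :* (Ω̄ :* W)) :=
                   Ω̄ :* Ω̄ :* (Ω̄ :* Ω̄) :* (W :* W :* (W :* W))
                         :+ Ω :* Ω :* (Ω :* Ω) :* (W̄ :* W̄ :* (W̄ :* W̄))) refl Ω Ω̄ W W̄ ⟩
            o * (W * W * (W * W)) + ō * (W̄ * W̄ * (W̄ * W̄))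
              ≈⟨ +-cong (*-congˡ (*-cong WW≈ WW≈)) (*-congˡ (*-cong W̄W̄≈ W̄W̄≈)) ⟩
            o * ((α * α * ȳ + β * β * y) * (α * α * ȳ + β * β * y)) + ō * ((α * α * y + β * β * ȳ) * (α * α * y + β * β * ȳ))
              ≈⟨ solve 6 (λ o ō u v y ȳ →
                   o :* ((u :* ȳ :+ v :* y) :* (u :* ȳ :+ v :* y)) :+ ō :* ((u :* y :+ v :* ȳ) :* (u :* y
                         :+ v :* ȳ)) :=
                   (o :* (v :* v) :+ ō :* (u :* u)) :* (y :* y) :+ (ō :* (v :* v) :+ o :* (u :* u)) :* (ȳ :* ȳ))
                   refl o ō (α * α) (β * β) y ȳ ⟩
            q₁ * (y * y) + q̄₁ * (ȳ * ȳ) ∎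

      private
        S⁴ = S * S * (S * S)

      S⁴≉0 : ¬ S⁴ ≈ 0#
      S⁴≉0 = *-nonZero (*-nonZero S≉0 S≉0) (*-nonZero S≉0 S≉0)

      i ε γ γ̄ : Carrier
      -- This is 1/T² at every point X. The element ε satisfies (ε y)² = i e y², so modulo ℘ the
      -- quadratic terms become linear ones with coefficient ε.
      i = S⁴ ⁻¹
      ε = √ (i * e)
      γ = ε + i * g
      γ̄ = conj ε + i * ḡ

      S⁴i≈1 : S⁴ * i ≈ 1#
      S⁴i≈1 = inverseʳ S⁴ S⁴≉0

      i-real : conj i ≈ i
      i-real = real-quotient S⁴≉0 (conj-⟦⟧ (var 0F :* var 0F :* (var 0F :* var 0F)) (S-real ∷ [])) conj-1 S⁴i≈1

      m≈1+S : m ≈ 1# + S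
      m≈1+S = solve 1 (λ m → m := :1 :+ (m :+ :1)) refl m

      m-real : conj m ≈ m
      m-real = trans (conj-cong m≈1+S) (trans (conj-⟦⟧ (:1 :+ var 0F) (S-real ∷ [])) (sym m≈1+S))

      conj-p : conj p ≈ p̄
      conj-p = conj-⟦⟧ (var 0F :* (var 3F :* var 3F) :+ var 1F :* (var 2F :* var 2F))
        (conj-o ∷ conj-ō ∷ α-real ∷ β-real ∷ [])

      conj-q : conj q₁ ≈ q̄₁
      conj-q = conj-⟦⟧ (var 0F :* (var 3F :* var 3F :* (var 3F :* var 3F))
            :+ var 1F :* (var 2F :* var 2F :* (var 2F :* var 2F)))
        (conj-o ∷ conj-ō ∷ α-real ∷ β-real ∷ [])

      conj-ie : conj (i * e) ≈ i * ē
      conj-ie = conj-⟦⟧ (var 0F :* (var 1F :* (var 2F :* var 2F :* var 3F :+ var 4F :* var 5F)))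
        (i-real ∷ b-real ∷ ρ-real ∷ conj-p ∷ m-real ∷ conj-q ∷ [])

      conj-γ : conj γ ≈ γ̄
      conj-γ = conj-⟦⟧ (var 0F :+ var 1F :* (var 2F :* (var 3F :* var 3F) :* var 4F
            :+ var 5F :* (var 4F :* (var 3F :* var 6F))))
        (refl ∷ i-real ∷ m-real ∷ S-real ∷ ρ-real ∷ b-real ∷ conj-p ∷ [])

      Tr-γ-constant : ∀ y → y * conj y ≈ 1# → Tr k (γ * y + conj γ * conj y) ≈ Tr k (i * κ)
      Tr-γ-constant y yȳ≈1 = +≈0⇒≈ (begin
        Tr k (γ * y + conj γ * ȳ) + Tr k (i * κ)
          ≈⟨ +-congʳ (Tr-cong k (+-congˡ (*-congʳ conj-γ))) ⟩
        Tr k (γ * y + γ̄ * ȳ) + Tr k (i * κ)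
          ≈⟨ +-identityˡ _ ⟨
        0# + (Tr k (γ * y + γ̄ * ȳ) + Tr k (i * κ))
          ≈⟨ +-cong (Tr-℘-real v-real) (Tr-+ k _ _) ⟨
        Tr k (℘ v) + Tr k (γ * y + γ̄ * ȳ + i * κ)
          ≈⟨ Tr-+ k _ _ ⟨
        Tr k (℘ v + (γ * y + γ̄ * ȳ + i * κ))
          ≈⟨ T≉0⇒Tr≈0 X≉0 T≉0 TTr≈ ⟩
        0# ∎)
        where
        open Point yȳ≈1
        -- v lies in 𝔽_q, so adding ℘ v does not change the trace.
        v = ε * y + conj ε * ȳ
        v-real : conj v ≈ v
        v-real = trans (conj-⟦⟧ (var 0F :* var 1F :+ var 2F :* var 3F) (refl ∷
              refl ∷ conj-conj ε ∷ conj-conj y ∷ [])) (+-comm _ _)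

        r≈ : ℘ v + (γ * y + γ̄ * ȳ + i * κ) ≈ i * (Ca X * C̄a X)
        r≈ = begin
          ℘ v + (γ * y + γ̄ * ȳ + i * κ)
            ≈⟨ solve 8 (λ i ε ε̄ g ḡ κ y ȳ →
                 let v = ε :* y :+ ε̄ :* ȳ in
                 v :* v :+ v :+ ((ε :+ i :* g) :* y :+ (ε̄ :+ i :* ḡ) :* ȳ :+ i :* κ) :=
                 ε :* ε :* (y :* y) :+ ε̄ :* ε̄ :* (ȳ :* ȳ) :+ i :* (g :* y :+ ḡ :* ȳ :+ κ))
                       refl i ε (conj ε) g ḡ κ y ȳ ⟩
          ε * ε * (y * y) + conj ε * conj ε * (ȳ * ȳ) + i * (g * y + ḡ * ȳ + κ)
            ≈⟨ +-congʳ (+-cong (*-congʳ (√x*√x≈x (i * e))) (*-congʳ (trans (conj-√ (i * e)) conj-ie))) ⟩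
          i * e * (y * y) + i * ē * (ȳ * ȳ) + i * (g * y + ḡ * ȳ + κ)
            ≈⟨ solve 8 (λ i e ē g ḡ κ y ȳ → i :* e :* (y :* y) :+ i :* ē :* (ȳ :* ȳ) :+ i :* (g :* y :+ ḡ :* ȳ
                  :+ κ) :=
                 i :* (e :* (y :* y) :+ ē :* (ȳ :* ȳ) :+ (g :* y :+ ḡ :* ȳ) :+ κ)) refl i e ē g ḡ κ y ȳ ⟩
          i * (e * (y * y) + ē * (ȳ * ȳ) + (g * y + ḡ * ȳ) + κ)
            ≈⟨ *-congˡ CC̄≈ ⟨
          i * (Ca X * C̄a X) ∎

        TTr≈ : Ta X * Ta X * (℘ v + (γ * y + γ̄ * ȳ + i * κ)) ≈ Ca X * C̄a X
        TTr≈ = begin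
          Ta X * Ta X * (℘ v + (γ * y + γ̄ * ȳ + i * κ)) ≈⟨ *-cong (*-cong T≈SS T≈SS) r≈ ⟩
          S⁴ * (i * (Ca X * C̄a X))                      ≈⟨ *-assoc _ _ _ ⟨
          S⁴ * i * (Ca X * C̄a X)                        ≈⟨ *-congʳ S⁴i≈1 ⟩
          1# * (Ca X * C̄a X)                            ≈⟨ *-identityˡ _ ⟩
          Ca X * C̄a X                                   ∎

      S⁴e≈gg : S⁴ * e ≈ g * g
      S⁴e≈gg = begin
        S⁴ * e                       ≈⟨ linear₁ S⁴i≈1 (solve 3 (λ t i e → t :* e :=
              t :* t :* (i :* e) :+ (t :* e) :* (t :* i :+ :1)) refl S⁴ i e) ⟩
        S⁴ * S⁴ * (i * e)            ≈⟨ *-congˡ (√x*√x≈x (i * e)) ⟨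
        S⁴ * S⁴ * (ε * ε)            ≈⟨ *-congˡ (*-cong ε≈ig ε≈ig) ⟩
        S⁴ * S⁴ * (i * g * (i * g))  ≈⟨ linear₁ S⁴i≈1 (solve 3 (λ t i g → t :* t :* (i :* g :* (i :* g)) :=
              g :* g
                                          :+ (g :* g :* (t :* i :+ :1)) :* (t :* i :+ :1)) refl S⁴ i g) ⟩
        g * g                        ∎
        where
        ε≈ig : ε ≈ i * g
        ε≈ig = +≈0⇒≈ (Tr-constant-on-circle⇒0 γ (Tr k (i * κ)) Tr-γ-constant)

      private
        S₀ = (α + β) * (α + β)

        -- Here g = ρ S ((1 + S) S + b p), so g² contains the factor S² that is cancelled from both
        -- sides.
        star-in-S : Star b (ρ * ρ) S p q₁
        star-in-S = *-cancelˡ-nonZero (*-nonZero S≉0 S≉0) (linear₁ S⁴e≈gg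
          (solve 5 (λ m b ρ p q → let S = m :+ :1 in
            S :* S :* (S :* S :* (b :* (ρ :* ρ :* p :+ (:1 :+ S) :* q))) :=
            S :* S :* (ρ :* ρ :* (((:1 :+ S) :* S :+ b :* p) :* ((:1 :+ S) :* S :+ b :* p)))
            :+ :1 :* (S :* S :* (S :* S) :* (b :* (ρ :* ρ :* p :+ m :* q)) :+
              (m :* (S :* S) :* ρ :+ b :* (ρ :* (S :* p))) :* (m :* (S :* S) :* ρ :+ b :* (ρ :* (S :* p)))))
                    refl m b ρ p q₁))

        star : Star b (ρ * ρ) S₀ p q₁
        star = begin
          S₀ * S₀ * (b * (ρ * ρ * p + (1# + S₀) * q₁))
            ≈⟨ *-cong (*-cong [α+β]²≈S [α+β]²≈S) (*-congˡ (+-congˡ (*-congʳ (+-congˡ [α+β]²≈S)))) ⟩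
          S * S * (b * (ρ * ρ * p + (1# + S) * q₁))
            ≈⟨ star-in-S ⟩
          ρ * ρ * (((1# + S) * S + b * p) * ((1# + S) * S + b * p))
            ≈⟨ *-congˡ (*-cong inner inner) ⟨
          ρ * ρ * (((1# + S₀) * S₀ + b * p) * ((1# + S₀) * S₀ + b * p)) ∎
          where
          inner : (1# + S₀) * S₀ + b * p ≈ (1# + S) * S + b * p
          inner = +-congʳ (*-cong (+-congˡ [α+β]²≈S) [α+β]²≈S)

      open StarEquation α-real β-real conj-o oō≈1 b≈ b≉0 ρ≉0 α+β≉0 star
        using (o≈1; b≈1∨b+1≈S; b+1≈S⇒ν≈; b+1≈S⇒Tr≈0)

      aa≈ρρ : a * a ≈ ρ * ρ
      aa≈ρρ = begin
        a * a                              ≈⟨ *-cong a≈ a≈ ⟩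
        ρ * (Ω̄ * Ω̄) * (ρ * (Ω̄ * Ω̄))        ≈⟨ solve 2 (λ ρ z → ρ :* z :* (ρ :* z) :=
              ρ :* ρ :* (z :* z)) refl ρ (Ω̄ * Ω̄) ⟩
        ρ * ρ * o                          ≈⟨ *-congˡ o≈1 ⟩
        ρ * ρ * 1#                         ≈⟨ *-identityʳ _ ⟩
        ρ * ρ                              ∎

      a-real : conj a ≈ a
      a-real = *-cancelˡ-nonZero a≉0 (trans (sym ρρ≈) (sym aa≈ρρ))

      b≈1∨ : b ≈ 1# ⊎ (Tr k (b / (b + 1#)) ≈ 0# × a * a ≈ b * (b + 1#))
      b≈1∨ = Sum.map₂ (λ b+1≈S → b+1≈S⇒Tr≈0 b+1≈S , trans aa≈ρρ (b+1≈S⇒ν≈ b+1≈S)) b≈1∨b+1≈S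

    -- The trace of r = aā/S² decides whether T has a nontrivial zero: a preimage w of r under ℘
    -- satisfies w̄ = w + 1 or w̄ = w accordingly, which is the hypothesis of one of the two
    -- arguments above.
    injective⇒condition : conj a ≈ a × (b ≈ 1# ⊎ (Tr k (b / (b + 1#)) ≈ 0# × a * a ≈ b * (b + 1#)))
    injective⇒condition = [ no-zero , has-zero ]′ (conj-fixed⇒Tr-0∨1 r-real)
      where
      SS≉0 : ¬ S * S ≈ 0#
      SS≉0 = *-nonZero (S≉0) (S≉0)

      r = (a * A) / (S * S)

      SSr≈ : S * S * r ≈ a * A
      SSr≈ = y[x/y]≈x SS≉0

      r-real : conj r ≈ r
      r-real = real-quotient SS≉0 (trans (conj-* S S) (*-cong S-real S-real)) (norm-real a) SSr≈

      w = proj₁ (℘-surjective-on-real r-real)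
      ℘w≈r : ℘ w ≈ r
      ℘w≈r = proj₂ (℘-surjective-on-real r-real)

      SS℘w≈ : S * S * ℘ w ≈ a * A
      SS℘w≈ = trans (*-congˡ ℘w≈r) SSr≈

      no-zero : Tr k r ≈ 0# → conj a ≈ a × (b ≈ 1# ⊎ (Tr k (b / (b + 1#)) ≈ 0# × a * a ≈ b * (b + 1#)))
      no-zero Tr≈0 = a-real , b≈1∨
        where open T-has-no-zero (trans (conj-preimage ℘w≈r) (trans (+-congˡ Tr≈0) (+-identityʳ w))) SS℘w≈

      has-zero : Tr k r ≈ 1# → conj a ≈ a × (b ≈ 1# ⊎ (Tr k (b / (b + 1#)) ≈ 0# × a * a ≈ b * (b + 1#)))
      has-zero Tr≈1 = map₂ inj₁ (T-has-zero⇒b≈1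
        (trans (conj-preimage ℘w≈r) (+-congˡ Tr≈1)) SS℘w≈)

theorem1p1 : ∀ {c ℓ} (F : Field c ℓ) (k : ℕ) → 1 ≤ k →
    let open Field F
        open FieldOps F
        q = 2 ℕ.^ k
    in HasCardinality (q ℕ.* q) →
       (1# + 1#) ≈ 0# →
       (a b : Carrier) →
       ¬ (a ≈ 0#) →
       InSubfield q b → ¬ (b ≈ 0#) →
       Bijective _≈_ _≈_
         (λ x → x + a * x ^ (q ℕ.* (q ∸ 1) ℕ.+ 1) + b * x ^ (2 ℕ.* (q ∸ 1) ℕ.+ 1))
       ⇔
       ((b ≈ 1# × InSubfield q a × Tr k (1# + a ⁻¹) ≈ 0#)
        ⊎ (¬ (b ≈ 1#) × Tr k (b / (b + 1#)) ≈ 0# × a ^ 2 ≈ b * (b + 1#)))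
theorem1p1 F (suc k′) (s≤s z≤n) card 1+1≈0 a b a≉0 b∈𝔽q b≉0 = mk⇔ to from
  where
  open Field F
  open FieldOps F
  open FiniteField F card using (_≟_; injective⇒bijective)
  open QuadraticExtension F k′ card 1+1≈0 using (k; q; conj; conj≡^q)
  open PermutationTrinomial F k′ card 1+1≈0

  b-real : conj b ≈ b
  b-real = trans (reflexive (conj≡^q b)) b∈𝔽q

  a^2≈a*a : a ^ 2 ≈ a * a
  a^2≈a*a = *-congˡ (*-identityʳ a)

  Condition : Set _
  Condition = (b ≈ 1# × InSubfield q a × Tr k (1# + a ⁻¹) ≈ 0#)
    ⊎ (¬ (b ≈ 1#) × Tr k (b / (b + 1#)) ≈ 0# × a ^ 2 ≈ b * (b + 1#))

  to : Bijective _≈_ _≈_ (f a b) → Condition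
  to (f-inj , _) = condition (b ≟ 1#)
    where
    open Necessity a≉0 b-real b≉0 f-inj
    a-real = proj₁ injective⇒condition
    b≈1∨ = proj₂ injective⇒condition

    condition : Dec (b ≈ 1#) → Condition
    condition (yes b≈1) = inj₁ (b≈1 , trans (reflexive (≡.sym (conj≡^q a))) a-real , b≈1⇒Tr≈0 a-real b≈1)
    condition (no b≉1) = inj₂ (b≉1 , [ (λ b≈1 → contradiction b≈1 b≉1) , map₂ (trans a^2≈a*a) ]′ b≈1∨)

  from : Condition → Bijective _≈_ _≈_ (f a b)
  from (inj₁ (b≈1 , a∈𝔽q , Tr≈0)) = injective⇒bijective (f-cong a b)
    (CaseBIs1.injective a≉0 b-real b≈1 (trans (reflexive (conj≡^q a)) a∈𝔽q) Tr≈0)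
  from (inj₂ (b≉1 , Tr≈0 , a^2≈)) = injective⇒bijective (f-cong a b)
    (CaseBIsNot1.injective b-real b≉1 Tr≈0 (trans (sym a^2≈a*a) a^2≈))
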